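{- The following two assertions are equivalent. (A) Every bipartite cubic 2FH-graph other than the cubic graph on two vertices can be obtained from the complete bipartite graph $K_{3,3}$ and the Heawood graph by repeated star products. (B) Every bipartite cyclically 4-edge-connected cubic PMH-graph with girth at least $6$, except the Heawood graph, admits a perfect matching which can be extended to a Hamiltonian cycle in exactly one way.
   Context: Graphs are finite and connected, may have multiple (parallel) edges, and have no loops (two parallel edges form a cycle of length 2 for the purposes of girth). A cubic graph is a 3-regular graph. A $2$-factor is a $2$-regular spanning subgraph (not necessarily connected; two parallel edges count as a $2$-regular component), a Hamiltonian cycle is a connected $2$-factor, and a perfect matching is the edge set of a $1$-regular spanning subgraph. A graph is 2FH (2-factor Hamiltonian) if it has a Hamiltonian cycle and each of its $2$-factors is a Hamiltonian cycle. A graph $G$ admitting a perfect matching is PMH if for every perfect matching $M$ of $G$ there is a perfect matching $N$ of $G$ such that $M\cup N$ induces a Hamiltonian cycle of $G$ ($M$ is extended to that Hamiltonian cycle). $M$ can be extended to a Hamiltonian cycle in exactly one way if there is a unique perfect matching $N$ such that $M\cup N$ induces a Hamiltonian cycle. Star product: let $v_1\in V(G_1)$, $v_2\in V(G_2)$ be vertices of degree 3, with incident edges $v_1x_1,v_1y_1,v_1z_1$ and $v_2x_2,v_2y_2,v_2z_2$ respectively. A star product on $v_1$ and $v_2$ (between $G_1$ and $G_2$) is any graph of the form $(G_1-v_1)\cup(G_2-v_2)\cup\{x_1x_2,y_1y_2,z_1z_2\}$, for any choice of the ordering of the three neighbours. A graph obtained from $K_{3,3}$ and the Heawood graph by repeated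 star products is any member of the smallest class of graphs that contains $K_{3,3}$ and the Heawood graph and is closed under star products between members of the class. An edge-cut $X$ of $G$ is cycle-separating if at least two components of $G-X$ contain cycles. $G$ is cyclically $k$-edge-connected if it has no cycle-separating edge-cut with fewer than $k$ edges. -}

module Defs where

open import Data.Bool.Base using (Bool)
open import Data.Fin.Base using (Fin; zero; toℕ; _↑ˡ_; _↑ʳ_; remQuot; splitAt)
open import Data.Fin.Properties using (_≟_; splitAt-↑ˡ; splitAt-↑ʳ)
open import Data.Fin.Subset using (Subset; _∈_; ⊤; ∁; _∩_; _∪_; ∣_∣)
open import Data.Nat.Base using (ℕ; suc; _+_; _≤_; _<_)
open import Data.Nat.DivMod using (_mod_)
open import Data.Product using (∃; ∃₂; ∃!; _×_; _,_; proj₁; proj₂)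
open import Data.Sum.Base using (_⊎_; inj₁; inj₂)
open import Data.Sum.Properties using (inj₁-injective; inj₂-injective)
open import Data.Vec.Base using (Vec; []; _∷_; lookup; tabulate)
open import Function.Base using (_∘_)
open import Function.Bundles using (_↔_; module Inverse)
open import Function.Definitions using (Injective)
open import Relation.Binary.Construct.Closure.ReflexiveTransitive using (Star)
open import Relation.Binary.PropositionalEquality
  using (_≡_; _≢_; refl; sym; trans; cong)
open import Relation.Nullary using (¬_; Dec; does; _⊎-dec_)

-- Loopless multigraphs.  The order in which `ends` lists the two ends of an
-- edge carries no meaning: everything below goes through Joins and Incident.

record Multigraph (V E : Set) : Set where
  field
    ends     : E → V × V
    loopless : ∀ e → proj₁ (ends e) ≢ proj₂ (ends e)

  Joins : E → V → V → Set
  Joins e u v = ends e ≡ (u , v) ⊎ ends e ≡ (v , u)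

  Incident : E → V → Set
  Incident e v = proj₁ (ends e) ≡ v ⊎ proj₂ (ends e) ≡ v

open Multigraph

record _≅_ {V E V′ E′ : Set} (G : Multigraph V E) (H : Multigraph V′ E′) : Set where
  field
    vertices : V ↔ V′
    edges    : E ↔ E′
    joins    : ∀ e → Joins H (Inverse.to edges e)
                       (Inverse.to vertices (proj₁ (ends G e)))
                       (Inverse.to vertices (proj₂ (ends G e)))

FiniteGraph : ℕ → ℕ → Set
FiniteGraph n m = Multigraph (Fin n) (Fin m)

module _ {n m : ℕ} (G : FiniteGraph n m) where

  incident? : ∀ e v → Dec (Incident G e v)
  incident? e v = (proj₁ (ends G e) ≟ v) ⊎-dec (proj₂ (ends G e) ≟ v)

  δ : Fin n → Subset m
  δ v = tabulate (λ e → does (incident? e v))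

  -- A set F of edges stands for the spanning subgraph with edge set F.

  degree : Subset m → Fin n → ℕ
  degree F v = ∣ F ∩ δ v ∣

  Regular : ℕ → Subset m → Set
  Regular d F = ∀ v → degree F v ≡ d

  Adjacent : Subset m → Fin n → Fin n → Set
  Adjacent F u v = ∃ λ e → e ∈ F × Joins G e u v

  Reachable : Subset m → Fin n → Fin n → Set
  Reachable F = Star (Adjacent F)

  -- The graph without vertices does not count as connected.
  SpanningConnected : Subset m → Set
  SpanningConnected F = Fin n × (∀ u v → Reachable F u v)

  Connected : Set
  Connected = SpanningConnected ⊤

  Cubic : Set
  Cubic = Regular 3 ⊤

  Bipartite : Set
  Bipartite = ∃ λ (side : Fin n → Bool) →
    ∀ e → side (proj₁ (ends G e)) ≢ side (proj₂ (ends G e))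

  TwoFactor : Subset m → Set
  TwoFactor = Regular 2

  HamiltonianCycle : Subset m → Set
  HamiltonianCycle F = TwoFactor F × SpanningConnected F

  PerfectMatching : Subset m → Set
  PerfectMatching = Regular 1

  TwoFactorHamiltonian : Set
  TwoFactorHamiltonian =
    ∃ HamiltonianCycle × (∀ F → TwoFactor F → HamiltonianCycle F)

  ExtendsBy : Subset m → Subset m → Set
  ExtendsBy M N = PerfectMatching N × HamiltonianCycle (M ∪ N)

  PMH : Set
  PMH = ∃ PerfectMatching × (∀ M → PerfectMatching M → ∃ (ExtendsBy M))

  ExtendsUniquely : Subset m → Set
  ExtendsUniquely M = ∃! _≡_ (ExtendsBy M)

  -- Edge i joins vertices i and i + 1, indices modulo the length.  Length 1 is
  -- excluded by looplessness; length 2 is a pair of parallel edges.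
  record Cycle (F : Subset m) : Set where
    field
      length-1         : ℕ
      vertex           : Fin (suc length-1) → Fin n
      edge             : Fin (suc length-1) → Fin m
      vertex-injective : Injective _≡_ _≡_ vertex
      edge-injective   : Injective _≡_ _≡_ edge
      edge∈F           : ∀ i → edge i ∈ F
      edge-joins       : ∀ i → Joins G (edge i) (vertex i)
                                 (vertex (suc (toℕ i) mod suc length-1))

    length : ℕ
    length = suc length-1

  -- Holds vacuously for acyclic graphs, whose girth is infinite.
  GirthAtLeast : ℕ → Set
  GirthAtLeast g = (C : Cycle ⊤) → g ≤ Cycle.length C

  EdgeCut : Subset m → Set
  EdgeCut X = ¬ SpanningConnected (∁ X)

  ComponentHasCycle : Subset m → Fin n → Set
  ComponentHasCycle F u = ∃ λ (C : Cycle F) → Reachable F u (Cycle.vertex C zero)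

  CycleSeparating : Subset m → Set
  CycleSeparating X = EdgeCut X × ∃₂ λ u w →
    ¬ Reachable (∁ X) u w × ComponentHasCycle (∁ X) u × ComponentHasCycle (∁ X) w

  CyclicallyEdgeConnected : ℕ → Set
  CyclicallyEdgeConnected k = ∀ X → ∣ X ∣ < k → ¬ CycleSeparating X

-- Evidence that v has degree 3, with an ordering of the incident edges.  The
-- edges, not the neighbours, are ordered: neighbours may coincide when there
-- are parallel edges.
record Claw {V E : Set} (G : Multigraph V E) (v : V) : Set where
  field
    edge           : Fin 3 → E
    neighbour      : Fin 3 → V
    edge-injective : Injective _≡_ _≡_ edge
    edge-joins     : ∀ i → Joins G (edge i) v (neighbour i)
    complete       : ∀ e → Incident G e v → ∃ λ i → edge i ≡ e

  neighbour≢v : ∀ i → neighbour i ≢ v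
  neighbour≢v i x≡v with edge-joins i
  ... | inj₁ eq = loopless G (edge i)
    (trans (cong proj₁ eq) (trans (sym x≡v) (sym (cong proj₂ eq))))
  ... | inj₂ eq = loopless G (edge i)
    (trans (cong proj₁ eq) (trans x≡v (sym (cong proj₂ eq))))

_-ᵛ_ : {V E : Set} (G : Multigraph V E) (v : V) →
       Multigraph (∃ (_≢ v)) (∃ λ e → ¬ Incident G e v)
G -ᵛ v = record
  { ends     = λ (e , e∌v) → (proj₁ (ends G e) , e∌v ∘ inj₁)
                           , (proj₂ (ends G e) , e∌v ∘ inj₂)
  ; loopless = λ (e , _) eq → loopless G e (cong proj₁ eq)
  }

-- (G₁ - v₁) ∪ (G₂ - v₂) ∪ {x₁x₂, y₁y₂, z₁z₂}; the two claws supply the orderings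
-- of the neighbours, and the three new edges are indexed by Fin 3.
starProduct : {V₁ E₁ V₂ E₂ : Set}
  (G₁ : Multigraph V₁ E₁) (v₁ : V₁) → Claw G₁ v₁ →
  (G₂ : Multigraph V₂ E₂) (v₂ : V₂) → Claw G₂ v₂ →
  Multigraph (∃ (_≢ v₁) ⊎ ∃ (_≢ v₂))
             ((∃ λ e → ¬ Incident G₁ e v₁) ⊎ (∃ λ e → ¬ Incident G₂ e v₂) ⊎ Fin 3)
starProduct G₁ v₁ c₁ G₂ v₂ c₂ = record
  { ends = λ where
      (inj₁ e)        → let (u , w) = ends (G₁ -ᵛ v₁) e in inj₁ u , inj₁ w
      (inj₂ (inj₁ e)) → let (u , w) = ends (G₂ -ᵛ v₂) e in inj₂ u , inj₂ w
      (inj₂ (inj₂ i)) → inj₁ (neighbour c₁ i , neighbour≢v c₁ i)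
                      , inj₂ (neighbour c₂ i , neighbour≢v c₂ i)
  ; loopless = λ where
      (inj₁ e)        → loopless (G₁ -ᵛ v₁) e ∘ inj₁-injective
      (inj₂ (inj₁ e)) → loopless (G₂ -ᵛ v₂) e ∘ inj₂-injective
      (inj₂ (inj₂ i)) → λ ()
  }
  where open Claw

-- The bipartite graph on Fin a ⊎ Fin b, encoded as Fin (a + b), whose edge e
-- joins the two components of f e.
bipartiteGraph : ∀ {a b m} → (Fin m → Fin a × Fin b) → FiniteGraph (a + b) m
bipartiteGraph {a} {b} f = record
  { ends     = λ e → let (i , j) = f e in i ↑ˡ b , a ↑ʳ j
  ; loopless = λ e → disjoint (proj₁ (f e)) (proj₂ (f e))
  }
  where
  disjoint : ∀ (i : Fin a) (j : Fin b) → i ↑ˡ b ≢ a ↑ʳ j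
  disjoint i j eq
    with () ← trans (sym (splitAt-↑ˡ a i b)) (trans (cong (splitAt a) eq) (splitAt-↑ʳ a b j))

-- The cubic graph on two vertices.
theta : FiniteGraph 2 3
theta = bipartiteGraph {1} {1} (λ _ → zero , zero)

K₃,₃ : FiniteGraph 6 9
K₃,₃ = bipartiteGraph {3} {3} (remQuot 3)

-- The point–line incidence graph of the Fano plane, whose points are the
-- residues modulo 7 and whose lines are the translates of the perfect
-- difference set {0, 1, 3}.
heawood : FiniteGraph 14 21
heawood = bipartiteGraph {7} {7} λ e →
  let (line , k) = remQuot 3 e
  in  line , (toℕ line + lookup (0 ∷ 1 ∷ 3 ∷ []) k) mod 7

-- Graphs obtained from K₃,₃ and the Heawood graph by repeated star products.
-- All graphs are taken up to isomorphism.
data Generated : ∀ {n m} → FiniteGraph n m → Set where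
  isK₃,₃    : ∀ {n m} {G : FiniteGraph n m} → G ≅ K₃,₃ → Generated G
  isHeawood : ∀ {n m} {G : FiniteGraph n m} → G ≅ heawood → Generated G
  isStar    : ∀ {n m n₁ m₁ n₂ m₂} {G : FiniteGraph n m}
              {G₁ : FiniteGraph n₁ m₁} {G₂ : FiniteGraph n₂ m₂} →
              Generated G₁ → Generated G₂ →
              ∀ v₁ (c₁ : Claw G₁ v₁) v₂ (c₂ : Claw G₂ v₂) →
              G ≅ starProduct G₁ v₁ c₁ G₂ v₂ c₂ → Generated G

{-# OPTIONS --safe #-}
module Submission where

-- A perfect matching M of a cubic graph extends by N exactly when M ∪ N is a
-- Hamiltonian cycle.  Such a cycle is determined by the perfect matching
-- complementary to it and contains at most two perfect matchings.  So if, in a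
-- PMH-graph, no perfect matching extends uniquely, there are at least as many
-- Hamiltonian cycles as perfect matchings, and every 2-factor is Hamiltonian.
-- By (A) the graph is then generated; but K₃,₃ has a 4-cycle and the three new
-- edges of a star product form a cycle-separating cut, which leaves Heawood.
--
-- Conversely, in a bipartite 2FH-graph G every perfect matching extends in two
-- ways.  If G has a cut of at most three edges between two sets of at least two
-- vertices, the degree balance and the 2FH property force it to consist of
-- three edges leaving the same colour class; contracting either side gives
-- smaller 2FH-graphs whose star product is G.  Parallel edges force theta.  In
-- a 4-cycle, either Hall's theorem yields a perfect matching avoiding it, whose
-- complement has the cycle as a component, or a violating set yields such a
-- cut, or G is K₃,₃.  In all other cases (B) applies and leaves only Heawood.

open import Defs
open import Data.Bool.Base using (Bool; true; false; not; _∧_; _∨_; if_then_else_)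
open import Data.Bool.Properties using (not-injective; not-involutive; ¬-not; not-¬; ∧-zeroʳ; ∧-identityʳ; ∨-comm; ∨-zeroʳ; ∨-identityʳ; ∧-comm; ∧-assoc)
  renaming (_≟_ to _≟ᵇ_)
open import Data.Unit.Base using (tt) renaming (⊤ to Unit)
open import Data.Empty using (⊥; ⊥-elim)
open import Data.Fin.Base using (Fin; zero; suc; toℕ; punchOut; _↑ˡ_; _↑ʳ_; splitAt; join; combine; remQuot)
open import Data.Fin.Properties using (_≟_; any?; all?; injective⇒≤; punchOut-injective; join-splitAt; splitAt-↑ˡ; splitAt-↑ʳ; combine-injective; remQuot-combine)
  renaming (suc-injective to suc-injectiveᶠ)
open import Data.Fin.Subset using (Subset; ⊤; ∁; _∩_; _∪_; ∣_∣)
open import Data.Nat.Base using (ℕ; zero; suc; _+_; _*_; _≤_; _<_; z≤n; s≤s; NonZero)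
open import Data.Nat.DivMod using (_mod_; _%_; [m+kn]%n≡m%n)
open import Data.Nat.Properties renaming (_≟_ to _≟ℕ_)
open import Data.Product.Base using (∃; ∃₂; _×_; _,_; proj₁; proj₂)
import Data.Product.Base as Prod
import Data.Product.Properties as Prodₚ
open import Data.Sum.Properties using (inj₁-injective; inj₂-injective)
open import Data.Sum.Base as Sum using (_⊎_; inj₁; inj₂; [_,_]′)
open import Data.Vec.Base as Vec using (Vec; []; _∷_; lookup; tabulate)
open import Data.Vec.Properties using (lookup∘tabulate; lookup-zipWith; lookup-map; lookup-replicate; ≡-dec; ∷-injectiveˡ; ∷-injectiveʳ; []=⇒lookup; lookup⇒[]=)
open import Function.Base using (_∘_; id)
open import Function.Bundles using (_⇔_; mk⇔; _↔_; mk↔ₛ′; module Inverse)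
open import Function.Definitions using (Injective)
open import Relation.Binary.PropositionalEquality
open import Relation.Binary.Construct.Closure.ReflexiveTransitive using (ε; _◅_; _◅◅_)
open import Relation.Nullary using (¬_; Dec; yes; no; does; contradiction; _×-dec_; _⊎-dec_; _→-dec_; ¬?)
open import Relation.Nullary.Decidable using (map′; True; toWitness)
open import Algebra.Properties.Semiring.Sum +-*-semiring as ℕΣ using ()
open Multigraph
open ≤-Reasoning

-- Counting

-- The count behind (A) implies (B) closes because complementation in a cubic graph is a bijection
-- between 2-factors and perfect matchings: two extensions per matching give twice as many pairs
-- (matching, Hamiltonian cycle through it) as there are 2-factors, while a Hamiltonian cycle occurs
-- in at most two pairs. Hence no 2-factor is left over. Small cuts are controlled by one identity.
-- If a set S has a and b vertices in the two classes, and out and inn edges leave it from them,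
-- then out + 3b = inn + 3a, so out and inn agree modulo 3. With at most three edges only (0,0),
-- (1,1), (3,0) and (0,3) remain. In the first two some perfect matching contains the whole cut, and
-- its complement would be a disconnected 2-factor. In the last two every perfect matching uses
-- exactly one cut edge; this lets a 2-factor of a contraction be continued across the cut, so that
-- contractions inherit the 2FH property. All case distinctions (unique extension, reducing cut,
-- violator, isomorphism with Heawood) are settled by finite search, so the argument is
-- constructive.

abstract
  ∑ : ∀ {n} → (Fin n → ℕ) → ℕ
  ∑ = ℕΣ.sum

  ∑-suc : ∀ {n} (f : Fin (suc n) → ℕ) → ∑ f ≡ f zero + ∑ (f ∘ suc)
  ∑-suc f = refl

  ∑-zero : ∀ {f : Fin 0 → ℕ} → ∑ f ≡ 0
  ∑-zero = refl

  ∑-mono : ∀ {n} {f g : Fin n → ℕ} → (∀ i → f i ≤ g i) → ∑ f ≤ ∑ g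
  ∑-mono {zero}  f≤g = z≤n
  ∑-mono {suc n} f≤g = +-mono-≤ (f≤g zero) (∑-mono (f≤g ∘ suc))

  ∑-cong : ∀ {n} {f g : Fin n → ℕ} → (∀ i → f i ≡ g i) → ∑ f ≡ ∑ g
  ∑-cong = ℕΣ.sum-cong-≗

  ∑-0 : ∀ n → ∑ {n} (λ _ → 0) ≡ 0
  ∑-0 n = ℕΣ.sum-replicate-zero n

  ∑-+ : ∀ {n} (f g : Fin n → ℕ) → ∑ (λ i → f i + g i) ≡ ∑ f + ∑ g
  ∑-+ f g = ℕΣ.∑-distrib-+ f g

  ∑-comm : ∀ {m n} (f : Fin m → Fin n → ℕ) → ∑ (λ i → ∑ (f i)) ≡ ∑ (λ j → ∑ (λ i → f i j))
  ∑-comm f = ℕΣ.∑-comm f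

  ∑-*ˡ : ∀ {n} k (f : Fin n → ℕ) → k * ∑ f ≡ ∑ (λ i → k * f i)
  ∑-*ˡ k f = ℕΣ.*-distribˡ-sum k f

  ∑-*ʳ : ∀ {n} k (f : Fin n → ℕ) → ∑ f * k ≡ ∑ (λ i → f i * k)
  ∑-*ʳ k f = ℕΣ.*-distribʳ-sum k f

χ : Bool → ℕ
χ true  = 1
χ false = 0

# : ∀ {n} → (Fin n → Bool) → ℕ
# b = ∑ (χ ∘ b)

infix 4 _⊑_
_⊑_ : ∀ {n} → (Fin n → Bool) → (Fin n → Bool) → Set
b ⊑ c = ∀ i → b i ≡ true → c i ≡ true

infix 6 _==_

abstract
  _==_ : ∀ {n} → Fin n → Fin n → Bool
  i == j = does (i ≟ j)

  ==-def : ∀ {n} (i j : Fin n) → does (i ≟ j) ≡ (i == j)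
  ==-def i j = refl

  ==-refl : ∀ {n} (i : Fin n) → (i == i) ≡ true
  ==-refl i with i ≟ i
  ... | yes _  = refl
  ... | no i≢i = contradiction refl i≢i

  ==⇒≡ : ∀ {n} {i j : Fin n} → (i == j) ≡ true → i ≡ j
  ==⇒≡ {i = i} {j} eq with i ≟ j
  ... | yes i≡j = i≡j
  ... | no  _ with () ← eq

≡⇒== : ∀ {n} {i j : Fin n} → i ≡ j → (i == j) ≡ true
≡⇒== refl = ==-refl _

≢⇒== : ∀ {n} {i j : Fin n} → i ≢ j → (i == j) ≡ false
≢⇒== i≢j = ¬-not (i≢j ∘ ==⇒≡)

true≢false : ∀ {b} → b ≡ true → b ≢ false
true≢false refl ()

∧-true : ∀ {a b} → a ≡ true → b ≡ true → a ∧ b ≡ true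
∧-true refl refl = refl

∧-trueˡ : ∀ {a b} → a ∧ b ≡ true → a ≡ true
∧-trueˡ {true} _ = refl

∧-trueʳ : ∀ {a b} → a ∧ b ≡ true → b ≡ true
∧-trueʳ {true} eq = eq

∨-true : ∀ a {b} → a ∨ b ≡ true → a ≡ true ⊎ b ≡ true
∨-true true  _  = inj₁ refl
∨-true false eq = inj₂ eq

∨-trueˡ : ∀ {a} b → a ≡ true → a ∨ b ≡ true
∨-trueˡ _ refl = refl

∨-trueʳ : ∀ a {b} → b ≡ true → a ∨ b ≡ true
∨-trueʳ a refl = ∨-zeroʳ a

χ-mono : ∀ {a b} → (a ≡ true → b ≡ true) → χ a ≤ χ b
χ-mono {false} f = z≤n
χ-mono {true}  f rewrite f refl = ≤-refl

χ-∧ : ∀ a b → χ (a ∧ b) ≡ χ a * χ b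
χ-∧ true  b = sym (+-identityʳ (χ b))
χ-∧ false b = refl

χ-split : ∀ a b → χ a ≡ χ (a ∧ b) + χ (a ∧ not b)
χ-split true  true  = refl
χ-split true  false = refl
χ-split false _     = refl

χ-∨∧ : ∀ a b → χ (a ∨ b) + χ (a ∧ b) ≡ χ a + χ b
χ-∨∧ true  b     = refl
χ-∨∧ false true  = refl
χ-∨∧ false false = refl

#-cong : ∀ {n} {b c : Fin n → Bool} → (∀ i → b i ≡ c i) → # b ≡ # c
#-cong eq = ∑-cong (cong χ ∘ eq)

#-mono : ∀ {n} {b c : Fin n → Bool} → b ⊑ c → # b ≤ # c
#-mono b⊑c = ∑-mono (λ i → χ-mono (b⊑c i))

#-false : ∀ {n} {b : Fin n → Bool} → (∀ i → b i ≡ false) → # b ≡ 0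
#-false {n} eq = trans (#-cong eq) (∑-0 n)

#-∨∧ : ∀ {n} (b c : Fin n → Bool) →
       # (λ i → b i ∨ c i) + # (λ i → b i ∧ c i) ≡ # b + # c
#-∨∧ b c = trans (sym (∑-+ _ _)) (trans (∑-cong (λ i → χ-∨∧ (b i) (c i))) (∑-+ _ _))

#-split : ∀ {n} (b c : Fin n → Bool) →
          # b ≡ # (λ i → b i ∧ c i) + # (λ i → b i ∧ not (c i))
#-split b c = trans (∑-cong (λ i → χ-split (b i) (c i))) (∑-+ _ _)

_∖_ : ∀ {n} → (Fin n → Bool) → Fin n → Fin n → Bool
(b ∖ x) i = b i ∧ not (i == x)

∖-true : ∀ {n} (b : Fin n → Bool) {x i} → b i ≡ true → i ≢ x → (b ∖ x) i ≡ true
∖-true b bi i≢x = ∧-true bi (cong not (≢⇒== i≢x))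

∖-⊑ : ∀ {n} (b : Fin n → Bool) {x} → b ∖ x ⊑ b
∖-⊑ b i = ∧-trueˡ

∖-≢ : ∀ {n} (b : Fin n → Bool) {x i} → (b ∖ x) i ≡ true → i ≢ x
∖-≢ b {x} {i} eq refl = true≢false (∧-trueʳ {b i} eq) (cong not (==-refl i))

#-== : ∀ {n} (x : Fin n) → # (_== x) ≡ 1
#-== {suc n} zero    = trans (∑-suc _) (cong₂ _+_ (cong χ (==-refl zero)) (#-false {n} λ i → ≢⇒== λ ()))
#-== {suc n} (suc x) = trans (∑-suc _)
  (cong₂ _+_ (cong χ (≢⇒== {i = zero} λ ())) (trans (#-cong lemma) (#-== x)))
  where
  lemma : ∀ i → (suc i == suc x) ≡ (i == x)
  lemma i with i ≟ x
  ... | yes refl = trans (==-refl (suc i)) (sym (==-refl i))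
  ... | no  i≢x  = trans (≢⇒== (i≢x ∘ suc-injectiveᶠ)) (sym (≢⇒== i≢x))

#-remove : ∀ {n} (b : Fin n → Bool) {x} → b x ≡ true → # b ≡ suc (# (b ∖ x))
#-remove b {x} bx = trans (#-split b (_== x))
  (cong (_+ # (b ∖ x)) (trans (#-cong lemma) (#-== x)))
  where
  lemma : ∀ i → b i ∧ (i == x) ≡ (i == x)
  lemma i with i ≟ x
  ... | yes refl rewrite ==-refl i = trans (∧-identityʳ _) bx
  ... | no  i≢x  rewrite ≢⇒== i≢x = ∧-zeroʳ (b i)

#-unique : ∀ {n} (b : Fin n → Bool) {x} → b x ≡ true → (∀ y → b y ≡ true → y ≡ x) → # b ≡ 1
#-unique b {x} bx uniq = trans (#-remove b bx) (cong suc (#-false lemma))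
  where
  lemma : ∀ i → (b ∖ x) i ≡ false
  lemma i = ¬-not λ eq → ∖-≢ b eq (uniq i (∖-⊑ b i eq))

#-pick : ∀ {n} (b : Fin n → Bool) → 1 ≤ # b → ∃ λ i → b i ≡ true
#-pick b 1≤ with any? (λ i → b i ≟ᵇ true)
... | yes found = found
... | no  none  = contradiction 1≤ (<⇒≱ (s≤s (≤-reflexive (#-false λ i → ¬-not λ bi → none (i , bi)))))

#≥1 : ∀ {n} (b : Fin n → Bool) {x} → b x ≡ true → 1 ≤ # b
#≥1 b bx rewrite #-remove b bx = s≤s z≤n

#≥2 : ∀ {n} (b : Fin n → Bool) {x y} → b x ≡ true → b y ≡ true → x ≢ y → 2 ≤ # b
#≥2 b bx by x≢y rewrite #-remove b bx = s≤s (#≥1 (b ∖ _) (∖-true b by (x≢y ∘ sym)))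

#≥3 : ∀ {n} (b : Fin n → Bool) {x y z} → b x ≡ true → b y ≡ true → b z ≡ true →
      x ≢ y → x ≢ z → y ≢ z → 3 ≤ # b
#≥3 b bx by bz x≢y x≢z y≢z rewrite #-remove b bx =
  s≤s (#≥2 (b ∖ _) (∖-true b by (x≢y ∘ sym)) (∖-true b bz (x≢z ∘ sym)) y≢z)

#≤1⇒≡ : ∀ {n} (b : Fin n → Bool) {x y} → # b ≤ 1 → b x ≡ true → b y ≡ true → x ≡ y
#≤1⇒≡ b {x} {y} #≤1 bx by with x ≟ y
... | yes x≡y = x≡y
... | no  x≢y = contradiction (#≥2 b bx by x≢y) (<⇒≱ (s≤s #≤1))

#-pick-other : ∀ {n} (b : Fin n → Bool) {x} → 2 ≤ # b → b x ≡ true → ∃ λ y → b y ≡ true × y ≢ x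
#-pick-other b {x} 2≤ bx rewrite #-remove b bx with #-pick (b ∖ x) (≤-pred 2≤)
... | y , eq = y , ∖-⊑ b y eq , ∖-≢ b eq

#-pick-third : ∀ {n} (b : Fin n → Bool) {x y} → 3 ≤ # b → b x ≡ true → b y ≡ true → x ≢ y →
               ∃ λ z → b z ≡ true × z ≢ x × z ≢ y
#-pick-third b {x} 3≤ bx by x≢y rewrite #-remove b bx
  with z , eq , z≢y ← #-pick-other (b ∖ x) (≤-pred 3≤) (∖-true b by (x≢y ∘ sym))
  = z , ∖-⊑ b z eq , ∖-≢ b eq , z≢y

#≤2⇒ : ∀ {n} (b : Fin n → Bool) {x y z} → # b ≤ 2 → b x ≡ true → b y ≡ true → x ≢ y →
        b z ≡ true → z ≡ x ⊎ z ≡ y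
#≤2⇒ b {x} {y} {z} #≤2 bx by x≢y bz with z ≟ x | z ≟ y
... | yes z≡x | _       = inj₁ z≡x
... | no  _   | yes z≡y = inj₂ z≡y
... | no z≢x  | no z≢y  =
  contradiction (#≥3 b bx by bz x≢y (z≢x ∘ sym) (z≢y ∘ sym)) (<⇒≱ (s≤s #≤2))

#-⊑-≥ : ∀ {n} {b c : Fin n → Bool} → b ⊑ c → # c ≤ # b → c ⊑ b
#-⊑-≥ {b = b} {c} b⊑c #c≤#b i ci with b i ≟ᵇ true
... | yes bi = bi
... | no ¬bi = contradiction #c≤#b (<⇒≱ #b<#c)
  where
  #b<#c : # b < # c
  #b<#c rewrite #-remove c ci =
    s≤s (#-mono (λ j bj → ∖-true c (b⊑c j bj) λ { refl → ¬bi bj }))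

-- Double counting by exchanging two sums. With `p` an end map of edges it counts incidences at the
-- vertices of `X`; with `p` an enumeration it carries a count along a bijection.
#-fibres : ∀ {m n} (p : Fin m → Fin n) (F : Fin m → Bool) (X : Fin n → Bool) d →
           (∀ v → X v ≡ true → # (λ e → F e ∧ (p e == v)) ≡ d) →
           # (λ e → F e ∧ X (p e)) ≡ d * # X
#-fibres {m} {n} p F X d reg = begin-equality
  ∑ (λ e → χ (F e ∧ X (p e)))
    ≡⟨ ∑-cong pointwise ⟩
  ∑ (λ e → ∑ (λ v → χ (F e ∧ (p e == v)) * χ (X v)))
    ≡⟨ ∑-comm (λ e v → χ (F e ∧ (p e == v)) * χ (X v)) ⟩
  ∑ (λ v → ∑ (λ e → χ (F e ∧ (p e == v)) * χ (X v)))
    ≡⟨ ∑-cong (λ v → sym (∑-*ʳ (χ (X v)) _)) ⟩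
  ∑ (λ v → # (λ e → F e ∧ (p e == v)) * χ (X v))
    ≡⟨ ∑-cong fibre ⟩
  ∑ (λ v → d * χ (X v))
    ≡⟨ ∑-*ˡ d _ ⟨
  d * # X ∎
  where
  fibre : ∀ v → # (λ e → F e ∧ (p e == v)) * χ (X v) ≡ d * χ (X v)
  fibre v with X v in Xv
  ... | true  = cong (_* 1) (reg v Xv)
  ... | false = trans (*-zeroʳ (# (λ e → F e ∧ (p e == v)))) (sym (*-zeroʳ d))

  swap : ∀ e v → χ (F e ∧ X (p e)) * χ (v == p e) ≡ χ (F e ∧ (p e == v)) * χ (X v)
  swap e v with v ≟ p e
  ... | yes refl rewrite ==-refl (p e) | χ-∧ (F e) (X (p e)) | ∧-identityʳ (F e) = *-identityʳ _
  ... | no  v≢pe rewrite ≢⇒== v≢pe | ≢⇒== (v≢pe ∘ sym) | ∧-zeroʳ (F e) = *-zeroʳ (χ (F e ∧ X (p e)))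

  pointwise : ∀ e → χ (F e ∧ X (p e)) ≡ ∑ (λ v → χ (F e ∧ (p e == v)) * χ (X v))
  pointwise e = begin-equality
    χ (F e ∧ X (p e))                                ≡⟨ *-identityʳ _ ⟨
    χ (F e ∧ X (p e)) * 1                            ≡⟨ cong (χ (F e ∧ X (p e)) *_) (#-== (p e)) ⟨
    χ (F e ∧ X (p e)) * # (_== p e)                  ≡⟨ ∑-*ˡ (χ (F e ∧ X (p e))) _ ⟩
    ∑ (λ v → χ (F e ∧ X (p e)) * χ (v == p e))       ≡⟨ ∑-cong (swap e) ⟩
    ∑ (λ v → χ (F e ∧ (p e == v)) * χ (X v))         ∎

implies? : ∀ a b → Dec (a ≡ true → b ≡ true)
implies? false b     = yes λ ()
implies? true  true  = yes λ _ → refl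
implies? true  false = no λ f → contradiction (f refl) λ ()

-- Exhaustive search

-- Exhaustibility takes the place of excluded middle for statements that quantify over edge sets,
-- vertex sets or maps between finite graphs.
Searchable : Set → Set₁
Searchable A = ∀ {P : A → Set} → (∀ a → Dec (P a)) → Dec (∃ P)

searchBool : Searchable Bool
searchBool P? with P? true | P? false
... | yes p | _     = yes (true , p)
... | no _  | yes p = yes (false , p)
... | no ¬t | no ¬f = no λ { (true , p) → ¬t p ; (false , p) → ¬f p }

searchVec : ∀ {A} → Searchable A → ∀ n → Searchable (Vec A n)
searchVec search zero    P? = map′ (λ p → [] , p) (λ { ([] , p) → p }) (P? [])
searchVec search (suc n) P? =
  map′ (λ (x , xs , p) → x ∷ xs , p) (λ { (x ∷ xs , p) → x , xs , p })
       (search λ x → searchVec search n λ xs → P? (x ∷ xs))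

searchSubset : ∀ {n} → Searchable (Subset n)
searchSubset = searchVec searchBool _

-- Hall's theorem, by deleting edges as long as the marriage condition survives

module Marriage {m n : ℕ} (p q : Fin m → Fin n) (A : Fin n → Bool) where

  neighbours : (Fin m → Bool) → (Fin n → Bool) → Fin n → Bool
  neighbours F X w = does (any? (λ e → (F e ∧ (X (p e) ∧ (q e == w))) ≟ᵇ true))

  neighbours⁺ : ∀ F X {e} → F e ≡ true → X (p e) ≡ true → neighbours F X (q e) ≡ true
  neighbours⁺ F X {e} Fe Xpe with any? (λ e′ → (F e′ ∧ (X (p e′) ∧ (q e′ == q e))) ≟ᵇ true)
  ... | yes _   = refl
  ... | no none = contradiction (e , ∧-true Fe (∧-true Xpe (==-refl (q e)))) none

  neighbours⁻ : ∀ F X {w} → neighbours F X w ≡ true → ∃ λ e → F e ≡ true × X (p e) ≡ true × q e ≡ w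
  neighbours⁻ F X {w} eq with any? (λ e → (F e ∧ (X (p e) ∧ (q e == w))) ≟ᵇ true)
  ... | yes (e , t) = e , ∧-trueˡ t , ∧-trueˡ (∧-trueʳ {F e} t) , ==⇒≡ (∧-trueʳ {X (p e)} (∧-trueʳ {F e} t))
  ... | no _ with () ← eq

  neighbours-mono : ∀ {F F′ X X′} → F ⊑ F′ → X ⊑ X′ → neighbours F X ⊑ neighbours F′ X′
  neighbours-mono {F} {F′} {X} {X′} F⊑F′ X⊑X′ w t with neighbours⁻ F X t
  ... | e , Fe , Xpe , refl = neighbours⁺ F′ X′ (F⊑F′ e Fe) (X⊑X′ (p e) Xpe)

  Hall : (Fin m → Bool) → Set
  Hall F = ∀ X → X ⊑ A → # X ≤ # (neighbours F X)

  Violator : (Fin m → Bool) → (Fin n → Bool) → Set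
  Violator F X = X ⊑ A × # (neighbours F X) < # X

  hall? : ∀ F → Hall F ⊎ ∃ (Violator F)
  hall? F with searchSubset (λ X → all? (λ v → implies? (lookup X v) (A v))
                                     ×-dec (# (neighbours F (lookup X)) <? # (lookup X)))
  ... | yes (X , X⊑A , bad) = inj₂ (lookup X , X⊑A , bad)
  -- The search ranges over vectors, whereas `X` is a function, so `X` is replaced by its table and
  -- all counts are transferred pointwise.
  ... | no none = inj₁ λ X X⊑A → ≮⇒≥ λ bad → none
        ( tabulate X
        , (λ v t → X⊑A v (trans (sym (lookup∘tabulate X v)) t))
        , <-≤-trans (≤-<-trans (#-mono (neighbours-mono {F} (λ _ → id) (λ v t → trans (sym (lookup∘tabulate X v)) t))) bad)
                    (≤-reflexive (#-cong (λ v → sym (lookup∘tabulate X v)))) )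

  Functional : (Fin m → Bool) → Set
  Functional F = ∀ e e′ → F e ≡ true → F e′ ≡ true → A (p e) ≡ true → p e ≡ p e′ → e ≡ e′

  -- Rado: were both deletions to create violators X and Y, submodularity of
  -- the neighbourhood size would make X ∪ Y or (X ∩ Y) ∖ p e a violator for F.
  deletable : ∀ F → Hall F → ∀ {e e′} → F e ≡ true → F e′ ≡ true → e ≢ e′ → p e ≡ p e′ →
              Hall (F ∖ e) ⊎ Hall (F ∖ e′)
  deletable F hall {e} {e′} Fe Fe′ e≢e′ pe≡pe′ with hall? (F ∖ e) | hall? (F ∖ e′)
  ... | inj₁ h | _ = inj₁ h
  ... | inj₂ _ | inj₁ h = inj₂ h
  ... | inj₂ (X , X⊑A , vX) | inj₂ (Y , Y⊑A , vY) = contradiction total (<⇒≱ ≤-refl)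
    where
    a = p e

    -- A set that violates the condition only after `e₀` is deleted must contain the tail of `e₀`;
    -- otherwise its neighbourhood would be unchanged.
    contains : ∀ {e₀ Z} → Z ⊑ A → # (neighbours (F ∖ e₀) Z) < # Z → Z (p e₀) ≡ true
    contains {e₀} {Z} Z⊑A v with Z (p e₀) ≟ᵇ true
    ... | yes t = t
    ... | no ¬t = contradiction (≤-<-trans (≤-trans (hall Z Z⊑A) (#-mono same)) v) (<⇒≱ ≤-refl)
      where
      same : neighbours F Z ⊑ neighbours (F ∖ e₀) Z
      same w t with neighbours⁻ F Z t
      ... | f , Ff , Zpf , refl = neighbours⁺ (F ∖ e₀) Z (∖-true F Ff λ { refl → ¬t Zpf }) Zpf

    Xa : X a ≡ true
    Xa = contains X⊑A vX

    Ya : Y a ≡ true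
    Ya = subst (λ v → Y v ≡ true) (sym pe≡pe′) (contains Y⊑A vY)

    X∪Y X∩Y Z : Fin n → Bool
    X∪Y v = X v ∨ Y v
    X∩Y v = X v ∧ Y v
    Z = X∩Y ∖ a

    NX = neighbours (F ∖ e) X
    NY = neighbours (F ∖ e′) Y

    -- The edge deleted on one side is still present on the other, and the common tail `a` belongs
    -- to both `X` and `Y`.
    ∪⊑ : neighbours F X∪Y ⊑ (λ w → NX w ∨ NY w)
    ∪⊑ w t with neighbours⁻ F X∪Y t
    ... | f , Ff , in∪ , refl with f ≟ e | f ≟ e′ | ∨-true (X (p f)) in∪
    ... | yes refl | yes refl | _ = contradiction refl e≢e′
    ... | yes refl | no f≢e′ | _ = ∨-trueʳ (NX (q f)) (neighbours⁺ (F ∖ e′) Y (∖-true F Ff f≢e′) Ya)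
    ... | no f≢e | _ | inj₁ Xpf = ∨-trueˡ (NY (q f)) (neighbours⁺ (F ∖ e) X (∖-true F Ff f≢e) Xpf)
    ... | no f≢e | yes refl | inj₂ _ = ∨-trueˡ (NY (q f))
          (neighbours⁺ (F ∖ e) X (∖-true F Ff f≢e) (subst (λ v → X v ≡ true) pe≡pe′ Xa))
    ... | no f≢e | no f≢e′ | inj₂ Ypf = ∨-trueʳ (NX (q f)) (neighbours⁺ (F ∖ e′) Y (∖-true F Ff f≢e′) Ypf)

    -- Neither `e` nor `e′` starts in `Z`, because `a` has been taken out; this is the purpose of
    -- removing it.
    ∩⊑ : neighbours F Z ⊑ (λ w → NX w ∧ NY w)
    ∩⊑ w t with neighbours⁻ F Z t
    ... | f , Ff , Zpf , refl = ∧-true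
      (neighbours⁺ (F ∖ e) X (∖-true F Ff λ { refl → ∖-≢ X∩Y Zpf refl }) (∧-trueˡ (∖-⊑ X∩Y _ Zpf)))
      (neighbours⁺ (F ∖ e′) Y (∖-true F Ff λ { refl → ∖-≢ X∩Y Zpf (sym pe≡pe′) }) (∧-trueʳ {X (p f)} (∖-⊑ X∩Y _ Zpf)))

    -- Two violators lose one unit each, while removing `a` costs a single unit.
    total : # X + # Y < # X + # Y
    total = begin-strict
      # X + # Y                                           ≡⟨ #-∨∧ X Y ⟨
      # X∪Y + # X∩Y                                       ≡⟨ cong (# X∪Y +_) (#-remove X∩Y (∧-true Xa Ya)) ⟩
      # X∪Y + suc (# Z)                                   ≡⟨ +-suc _ _ ⟩
      suc (# X∪Y + # Z)                                   ≤⟨ s≤s (+-mono-≤ (hall X∪Y ∪A) (hall Z Z⊑A)) ⟩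
      suc (# (neighbours F X∪Y) + # (neighbours F Z))     ≤⟨ s≤s (+-mono-≤ (#-mono ∪⊑) (#-mono ∩⊑)) ⟩
      suc (# (λ w → NX w ∨ NY w) + # (λ w → NX w ∧ NY w)) ≡⟨ cong suc (#-∨∧ NX NY) ⟩
      suc (# NX + # NY)                                   <⟨ s≤s (+-monoʳ-< (# NX) vY) ⟩
      suc (# NX + # Y)                                    ≤⟨ +-monoˡ-≤ (# Y) vX ⟩
      # X + # Y                                           ∎
      where
      ∪A : X∪Y ⊑ A
      ∪A v t = [ X⊑A v , Y⊑A v ]′ (∨-true (X v) t)
      Z⊑A : Z ⊑ A
      Z⊑A v t = X⊑A v (∧-trueˡ (∖-⊑ X∩Y v t))

  -- The fuel `k` bounds the number of edges left. While two edges share a tail, `deletable` removes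
  -- one of them, so the process stops with at most one edge at each tail.
  prune : ∀ k F → # F ≤ k → Hall F → ∃ λ F′ → F′ ⊑ F × Hall F′ × Functional F′
  prune k F #F≤k hall with any? (λ e → any? (λ e′ →
    (F e ≟ᵇ true) ×-dec (F e′ ≟ᵇ true) ×-dec (p e ≟ p e′) ×-dec ¬? (e ≟ e′)))
  prune k F #F≤k hall | no none = F , (λ _ → id) , hall , functional
    where
    functional : Functional F
    functional e e′ Fe Fe′ _ pe≡pe′ with e ≟ e′
    ... | yes eq = eq
    ... | no  ≢  = contradiction (e , e′ , Fe , Fe′ , pe≡pe′ , ≢) none
  prune zero F #F≤k hall | yes (e , _ , Fe , _) = contradiction (≤-trans (#≥1 F Fe) #F≤k) λ ()
  prune (suc k) F #F≤k hall | yes (e , e′ , Fe , Fe′ , pe≡pe′ , e≢e′)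
    with deletable F hall Fe Fe′ e≢e′ pe≡pe′
  ... | inj₁ h with F′ , ⊑F , rest ← prune k (F ∖ e) (≤-pred (≤-trans (≤-reflexive (sym (#-remove F Fe))) #F≤k)) h
        = F′ , (λ i → ∖-⊑ F i ∘ ⊑F i) , rest
  ... | inj₂ h with F′ , ⊑F , rest ← prune k (F ∖ e′) (≤-pred (≤-trans (≤-reflexive (sym (#-remove F Fe′))) #F≤k)) h
        = F′ , (λ i → ∖-⊑ F i ∘ ⊑F i) , rest

  -- Two tails with the same head would form a two-element set with a single neighbour.
  functional⇒injective : ∀ {F} → Hall F → Functional F →
    ∀ {e e′} → F e ≡ true → F e′ ≡ true → A (p e) ≡ true → A (p e′) ≡ true → q e ≡ q e′ → e ≡ e′
  functional⇒injective {F} hall functional {e} {e′} Fe Fe′ Ape Ape′ qe≡qe′ with p e ≟ p e′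
  ... | yes pe≡pe′ = functional e e′ Fe Fe′ Ape pe≡pe′
  ... | no  pe≢pe′ = contradiction 2≤1 λ { (s≤s ()) }
    where
    X : Fin n → Bool
    X v = (v == p e) ∨ (v == p e′)
    X⊑A : X ⊑ A
    X⊑A v t with ∨-true (v == p e) t
    ... | inj₁ eq = subst (λ v → A v ≡ true) (sym (==⇒≡ eq)) Ape
    ... | inj₂ eq = subst (λ v → A v ≡ true) (sym (==⇒≡ eq)) Ape′
    N⊑ : neighbours F X ⊑ (_== q e)
    N⊑ w t with neighbours⁻ F X t
    ... | f , Ff , Xpf , refl with ∨-true (p f == p e) Xpf
    ... | inj₁ eq = ≡⇒== (cong q (sym (functional e f Fe Ff Ape (sym (==⇒≡ eq)))))
    ... | inj₂ eq = ≡⇒== (trans (cong q (sym (functional e′ f Fe′ Ff Ape′ (sym (==⇒≡ eq))))) (sym qe≡qe′))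
    2≤1 : 2 ≤ 1
    2≤1 = begin
      2                    ≤⟨ #≥2 X (∨-trueˡ _ (==-refl _)) (∨-trueʳ (p e′ == p e) (==-refl _)) pe≢pe′ ⟩
      # X                  ≤⟨ hall X X⊑A ⟩
      # (neighbours F X)   ≤⟨ #-mono N⊑ ⟩
      # (_== q e)          ≡⟨ #-== (q e) ⟩
      1                    ∎

-- Degrees

lookup-∩ : ∀ {n} (F H : Subset n) e → lookup (F ∩ H) e ≡ lookup F e ∧ lookup H e
lookup-∩ F H e = lookup-zipWith _∧_ e F H

lookup-∪ : ∀ {n} (F H : Subset n) e → lookup (F ∪ H) e ≡ lookup F e ∨ lookup H e
lookup-∪ F H e = lookup-zipWith _∨_ e F H

lookup-∁ : ∀ {n} (F : Subset n) e → lookup (∁ F) e ≡ not (lookup F e)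
lookup-∁ F e = lookup-map e not F

lookup-⊤ : ∀ {n} (e : Fin n) → lookup ⊤ e ≡ true
lookup-⊤ e = lookup-replicate e true

lookup-ext : ∀ {n} {F H : Subset n} → (∀ e → lookup F e ≡ lookup H e) → F ≡ H
lookup-ext {F = []}    {[]}    _  = refl
lookup-ext {F = _ ∷ _} {_ ∷ _} eq = cong₂ _∷_ (eq zero) (lookup-ext (eq ∘ suc))

∣∣≡# : ∀ {n} (F : Subset n) → ∣ F ∣ ≡ # (lookup F)
∣∣≡# []          = sym ∑-zero
∣∣≡# (true  ∷ F) = trans (cong suc (∣∣≡# F)) (sym (∑-suc _))
∣∣≡# (false ∷ F) = trans (∣∣≡# F) (sym (∑-suc _))

module _ {n m : ℕ} (G : FiniteGraph n m) where

  inc : Fin m → Fin n → Bool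
  inc e v = (proj₁ (ends G e) == v) ∨ (proj₂ (ends G e) == v)

  at : Subset m → Fin n → Fin m → Bool
  at F v e = lookup F e ∧ inc e v

  degree≡# : ∀ F v → degree G F v ≡ # (at F v)
  degree≡# F v = trans (∣∣≡# (F ∩ δ G v)) (#-cong λ e → trans (lookup-∩ F (δ G v) e)
    (cong (lookup F e ∧_) (trans (lookup∘tabulate _ e) (cong₂ _∨_ (==-def _ _) (==-def _ _)))))

  inc-proj₁ : ∀ e → inc e (proj₁ (ends G e)) ≡ true
  inc-proj₁ e = ∨-trueˡ _ (==-refl _)

  inc-proj₂ : ∀ e → inc e (proj₂ (ends G e)) ≡ true
  inc-proj₂ e = ∨-trueʳ (_ == _) (==-refl _)

  inc-joinsˡ : ∀ {e u v} → Joins G e u v → inc e u ≡ true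
  inc-joinsˡ {e} (inj₁ eq) = subst (λ x → inc e x ≡ true) (cong proj₁ eq) (inc-proj₁ e)
  inc-joinsˡ {e} (inj₂ eq) = subst (λ x → inc e x ≡ true) (cong proj₂ eq) (inc-proj₂ e)

  joins-sym : ∀ {e u v} → Joins G e u v → Joins G e v u
  joins-sym (inj₁ eq) = inj₂ eq
  joins-sym (inj₂ eq) = inj₁ eq

  inc-joinsʳ : ∀ {e u v} → Joins G e u v → inc e v ≡ true
  inc-joinsʳ = inc-joinsˡ ∘ joins-sym

  degree-cong : ∀ {F H} v → (∀ e → inc e v ≡ true → lookup F e ≡ lookup H e) → degree G F v ≡ degree G H v
  degree-cong {F} {H} v eq = trans (degree≡# F v) (trans (#-cong pointwise) (sym (degree≡# H v)))
    where
    pointwise : ∀ e → at F v e ≡ at H v e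
    pointwise e with inc e v | eq e
    ... | true  | f = cong (_∧ true) (f refl)
    ... | false | _ = trans (∧-zeroʳ (lookup F e)) (sym (∧-zeroʳ (lookup H e)))

  degree-∁ : ∀ F v → degree G ⊤ v ≡ degree G F v + degree G (∁ F) v
  degree-∁ F v = begin-equality
    degree G ⊤ v                                           ≡⟨ degree≡# ⊤ v ⟩
    # (at ⊤ v)                                             ≡⟨ #-split (at ⊤ v) (lookup F) ⟩
    # (λ e → at ⊤ v e ∧ lookup F e) + # (λ e → at ⊤ v e ∧ not (lookup F e))
      ≡⟨ cong₂ _+_ (#-cong (λ e → shuffle e (lookup F e)))
                   (#-cong (λ e → trans (shuffle e _) (cong (_∧ inc e v) (sym (lookup-∁ F e))))) ⟩
    # (at F v) + # (at (∁ F) v)                            ≡⟨ cong₂ _+_ (degree≡# F v) (degree≡# (∁ F) v) ⟨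
    degree G F v + degree G (∁ F) v                        ∎
    where
    shuffle : ∀ e b → (lookup ⊤ e ∧ inc e v) ∧ b ≡ b ∧ inc e v
    shuffle e b rewrite lookup-⊤ e = ∧-comm (inc e v) b

  degree-∪∩ : ∀ F H v → degree G (F ∪ H) v + degree G (F ∩ H) v ≡ degree G F v + degree G H v
  degree-∪∩ F H v = begin-equality
    degree G (F ∪ H) v + degree G (F ∩ H) v                ≡⟨ cong₂ _+_ (degree≡# (F ∪ H) v) (degree≡# (F ∩ H) v) ⟩
    # (at (F ∪ H) v) + # (at (F ∩ H) v)
      ≡⟨ cong₂ _+_ (#-cong λ e → trans (cong (_∧ inc e v) (lookup-∪ F H e)) (∨-distrib (lookup F e) (lookup H e) (inc e v)))
                   (#-cong λ e → trans (cong (_∧ inc e v) (lookup-∩ F H e)) (∧-distrib (lookup F e) (lookup H e) (inc e v))) ⟩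
    # (λ e → at F v e ∨ at H v e) + # (λ e → at F v e ∧ at H v e) ≡⟨ #-∨∧ (at F v) (at H v) ⟩
    # (at F v) + # (at H v)                                ≡⟨ cong₂ _+_ (degree≡# F v) (degree≡# H v) ⟨
    degree G F v + degree G H v                            ∎
    where
    ∨-distrib : ∀ a b c → (a ∨ b) ∧ c ≡ (a ∧ c) ∨ (b ∧ c)
    ∨-distrib true  b     true  = refl
    ∨-distrib true  b     false = sym (∧-zeroʳ b)
    ∨-distrib false b     c     = refl
    ∧-distrib : ∀ a b c → (a ∧ b) ∧ c ≡ (a ∧ c) ∧ (b ∧ c)
    ∧-distrib true  b true  = refl
    ∧-distrib true  b false = ∧-zeroʳ b
    ∧-distrib false b c     = refl

  degree≥1 : ∀ F {e v} → lookup F e ≡ true → inc e v ≡ true → 1 ≤ degree G F v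
  degree≥1 F Fe ev = ≤-trans (#≥1 (at F _) (∧-true Fe ev)) (≤-reflexive (sym (degree≡# F _)))

  edgeAt : ∀ F v → 1 ≤ degree G F v → ∃ λ e → lookup F e ≡ true × inc e v ≡ true
  edgeAt F v 1≤ with e , t ← #-pick (at F v) (≤-trans 1≤ (≤-reflexive (degree≡# F v)))
    = e , ∧-trueˡ t , ∧-trueʳ {lookup F e} t

  matching-unique : ∀ M {v e f} → PerfectMatching G M → lookup M e ≡ true → lookup M f ≡ true →
                    inc e v ≡ true → inc f v ≡ true → e ≡ f
  matching-unique M {v} pm Me Mf ev fv =
    #≤1⇒≡ (at M v) (≤-reflexive (trans (sym (degree≡# M v)) (pm v))) (∧-true Me ev) (∧-true Mf fv)

  twoFactor-third : ∀ F {v e f g} → TwoFactor G F → lookup F e ≡ true → lookup F f ≡ true → lookup F g ≡ true →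
                    inc e v ≡ true → inc f v ≡ true → inc g v ≡ true → e ≢ f → g ≡ e ⊎ g ≡ f
  twoFactor-third F {v} tf Fe Ff Fg ev fv gv e≢f =
    #≤2⇒ (at F v) (≤-reflexive (trans (sym (degree≡# F v)) (tf v))) (∧-true Fe ev) (∧-true Ff fv) e≢f (∧-true Fg gv)

  -- Used with (1, 2) and with (2, 1): complementation exchanges perfect matchings and 2-factors.
  ∁-regular : Cubic G → ∀ {a b} F → a + b ≡ 3 → Regular G a F → Regular G b (∁ F)
  ∁-regular cubic {a} {b} F a+b≡3 reg v = +-cancelˡ-≡ a _ _ (begin-equality
    a + degree G (∁ F) v             ≡⟨ cong (_+ degree G (∁ F) v) (reg v) ⟨
    degree G F v + degree G (∁ F) v  ≡⟨ degree-∁ F v ⟨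
    degree G ⊤ v                     ≡⟨ cubic v ⟩
    3                                ≡⟨ a+b≡3 ⟨
    a + b                            ∎)

  Disjoint : Subset m → Subset m → Set
  Disjoint F H = ∀ e → lookup F e ≡ true → lookup H e ≡ false

  disjoint-∪-twoFactor : ∀ M N → PerfectMatching G M → PerfectMatching G N → Disjoint M N → TwoFactor G (M ∪ N)
  disjoint-∪-twoFactor M N pm pn disj v = begin-equality
    degree G (M ∪ N) v                      ≡⟨ +-identityʳ _ ⟨
    degree G (M ∪ N) v + 0                  ≡⟨ cong (degree G (M ∪ N) v +_) none ⟨
    degree G (M ∪ N) v + degree G (M ∩ N) v ≡⟨ degree-∪∩ M N v ⟩
    degree G M v + degree G N v             ≡⟨ cong₂ _+_ (pm v) (pn v) ⟩
    2                                       ∎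
    where
    empty : ∀ e → at (M ∩ N) v e ≡ false
    empty e rewrite lookup-∩ M N e with lookup M e | disj e
    ... | true  | f rewrite f refl = refl
    ... | false | _ = refl
    none : degree G (M ∩ N) v ≡ 0
    none = trans (degree≡# (M ∩ N) v) (#-false empty)

  -- The degrees of union and intersection add up to 2, so degree 2 in the union leaves none for the
  -- intersection.
  twoFactor-∪-disjoint : ∀ M N → PerfectMatching G M → PerfectMatching G N → TwoFactor G (M ∪ N) → Disjoint M N
  twoFactor-∪-disjoint M N pm pn tf e Me = ¬-not λ Ne → contradiction
    (degree≥1 (M ∩ N) (trans (lookup-∩ M N e) (∧-true Me Ne)) (inc-proj₁ e))
    (<⇒≱ (s≤s (≤-reflexive (+-cancelˡ-≡ 2 _ 0 (trans (cong (_+ degree G (M ∩ N) v) (sym (tf v)))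
      (trans (degree-∪∩ M N v) (cong₂ _+_ (pm v) (pn v))))))))
    where v = proj₁ (ends G e)

-- Connectivity

  -- `S` is a union of components of the subgraph `F`. Disconnectedness is always shown by
  -- exhibiting such an `S` that is neither empty nor everything.
  Closed : (Fin m → Bool) → (Fin n → Bool) → Set
  Closed F S = ∀ e → F e ≡ true → S (proj₁ (ends G e)) ≡ S (proj₂ (ends G e))

  closed-joins : ∀ {F S} → Closed F S → ∀ {e u v} → F e ≡ true → Joins G e u v → S u ≡ S v
  closed-joins {S = S} cl {e} Fe (inj₁ eq) =
    subst₂ (λ x y → S x ≡ S y) (cong proj₁ eq) (cong proj₂ eq) (cl e Fe)
  closed-joins {S = S} cl {e} Fe (inj₂ eq) =
    subst₂ (λ x y → S y ≡ S x) (cong proj₁ eq) (cong proj₂ eq) (sym (cl e Fe))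

  reachable-closed : ∀ {F S} → Closed (lookup F) S → ∀ {u v} → Reachable G F u v → S u ≡ S v
  reachable-closed cl ε = refl
  reachable-closed {S = S} cl ((e , e∈F , j) ◅ r) =
    trans (closed-joins {S = S} cl ([]=⇒lookup e∈F) j) (reachable-closed {S = S} cl r)

  adjacent : ∀ {F e u v} → lookup F e ≡ true → Joins G e u v → Adjacent G F u v
  adjacent {F} {e} Fe j = e , lookup⇒[]= e F Fe , j

  closed⊎exit : ∀ F S → Closed (lookup F) S ⊎ ∃₂ λ u w → S u ≡ true × S w ≡ false × Adjacent G F u w
  closed⊎exit F S with any? (λ e → (lookup F e ≟ᵇ true) ×-dec ¬? (S (proj₁ (ends G e)) ≟ᵇ S (proj₂ (ends G e))))
  ... | no none = inj₁ closed
    where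
    closed : Closed (lookup F) S
    closed e Fe with S (proj₁ (ends G e)) ≟ᵇ S (proj₂ (ends G e))
    ... | yes eq = eq
    ... | no  ≢  = contradiction (e , Fe , ≢) none
  ... | yes (e , Fe , ≢) with S (proj₁ (ends G e)) in eq₁ | S (proj₂ (ends G e)) in eq₂
  ...   | true  | true  = contradiction refl ≢
  ...   | false | false = contradiction refl ≢
  ...   | true  | false = inj₂ (_ , _ , eq₁ , eq₂ , adjacent {F} Fe (inj₁ refl))
  ...   | false | true  = inj₂ (_ , _ , eq₂ , eq₁ , adjacent {F} Fe (inj₂ refl))

  ComponentOf : Subset m → Fin n → (Fin n → Bool) → Set
  ComponentOf F u S = S u ≡ true × (∀ v → S v ≡ true → Reachable G F u v) × Closed (lookup F) S

  grow : ∀ k F u S → # (not ∘ S) ≤ k → S u ≡ true → (∀ v → S v ≡ true → Reachable G F u v) → ∃ (ComponentOf F u)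
  grow k F u S #≤k Su reach with closed⊎exit F S
  ... | inj₁ closed = S , Su , reach , closed
  ... | inj₂ (u′ , w , Su′ , Sw , adj) rewrite #-remove (not ∘ S) (cong not Sw) with k
  -- Fuel zero is impossible here: `w` is still outside `S`, and the rewriting has made the bound a
  -- successor.
  ...   | suc k = grow k F u (λ v → S v ∨ (v == w)) (≤-trans (#-mono λ v → shrink v (S v)) (≤-pred #≤k))
                    (∨-trueˡ _ Su) reach′
    where
    shrink : ∀ v s → not (s ∨ (v == w)) ≡ true → not s ∧ not (v == w) ≡ true
    shrink v false t = t
    reach′ : ∀ v → S v ∨ (v == w) ≡ true → Reachable G F u v
    reach′ v t with ∨-true (S v) t
    ... | inj₁ Sv  = reach v Sv
    ... | inj₂ v≡w = subst (Reachable G F u) (sym (==⇒≡ v≡w)) (reach u′ Su′ ◅◅ (adj ◅ ε))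

  component : ∀ F u → ∃ (ComponentOf F u)
  component F u = grow _ F u (_== u) ≤-refl (==-refl u) λ v t → subst (Reachable G F u) (sym (==⇒≡ t)) ε

  reachable? : ∀ F u v → Dec (Reachable G F u v)
  reachable? F u v with S , Su , reach , closed ← component F u with S v ≟ᵇ true
  ... | yes Sv = yes (reach v Sv)
  ... | no ¬Sv = no λ r → ¬Sv (trans (sym (reachable-closed {S = S} closed r)) Su)

  spanningConnected? : ∀ F → Dec (SpanningConnected G F)
  -- The trivial search decides whether there is a vertex at all, which is part of connectedness.
  spanningConnected? F = any? {P = λ _ → Unit} (λ _ → yes tt) ×-dec′ all? λ u → all? λ v → reachable? F u v
    where
    _×-dec′_ : Dec (∃ λ (_ : Fin n) → Unit) → Dec (∀ u v → Reachable G F u v) → Dec (SpanningConnected G F)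
    d ×-dec′ d′ = map′ (λ ((v , _) , c) → v , c) (λ (v , c) → (v , tt) , c) (d ×-dec d′)

  regular? : ∀ d F → Dec (Regular G d F)
  regular? d F = all? λ v → degree G F v ≟ℕ d

  extendsBy? : ∀ M N → Dec (ExtendsBy G M N)
  extendsBy? M N = regular? 1 N ×-dec regular? 2 (M ∪ N) ×-dec spanningConnected? (M ∪ N)

-- Perfect matchings inside a Hamiltonian cycle

  -- The edge of `M` at `v` lies in `H`, hence is one of the two `H`-edges `e`, `f`, and it cannot
  -- be both.
  matching-alternates : ∀ M H {e f v} → PerfectMatching G M → TwoFactor G H → lookup M ⊑ lookup H →
    lookup H e ≡ true → lookup H f ≡ true → inc e v ≡ true → inc f v ≡ true → e ≢ f →
    lookup M f ≡ not (lookup M e)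
  matching-alternates M H {e} {f} {v} pm tf M⊑H He Hf ev fv e≢f with lookup M e in Me | lookup M f in Mf
  ... | true  | true  = contradiction (matching-unique M pm Me Mf ev fv) e≢f
  ... | true  | false = refl
  ... | false | true  = refl
  ... | false | false with g , Mg , gv ← edgeAt M v (≤-reflexive (sym (pm v)))
      with twoFactor-third H tf He Hf (M⊑H g Mg) ev fv gv e≢f
  ... | inj₁ refl = contradiction Me (true≢false Mg)
  ... | inj₂ refl = contradiction Mf (true≢false Mg)

  -- Alternation carries agreement from an edge to its successor, and connectedness of `H` carries
  -- it to all edges. So a Hamiltonian cycle contains at most two perfect matchings, told apart by
  -- any single edge.
  matching-determined : ∀ M M′ H {e₀} → HamiltonianCycle G H → PerfectMatching G M → PerfectMatching G M′ →
    lookup M ⊑ lookup H → lookup M′ ⊑ lookup H → lookup H e₀ ≡ true → lookup M e₀ ≡ lookup M′ e₀ → M ≡ M′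
  matching-determined M M′ H {e₀} (tf , _ , conn) pm pm′ M⊑H M′⊑H He₀ agree₀ = lookup-ext agree
    where
    Agree : Fin n → Set
    Agree v = ∀ e → lookup H e ≡ true → inc e v ≡ true → lookup M e ≡ lookup M′ e

    spread : ∀ {e v} → lookup H e ≡ true → inc e v ≡ true → lookup M e ≡ lookup M′ e → Agree v
    spread {e} He ev eq f Hf fv with e ≟ f
    ... | yes refl = eq
    ... | no  e≢f  = trans (matching-alternates M H pm tf M⊑H He Hf ev fv e≢f)
                       (trans (cong not eq) (sym (matching-alternates M′ H pm′ tf M′⊑H He Hf ev fv e≢f)))

    walk : ∀ {u v} → Reachable G H u v → Agree u → Agree v
    walk ε A = A
    walk ((e , e∈H , j) ◅ r) A =
      walk r (spread ([]=⇒lookup e∈H) (inc-joinsʳ j) (A e ([]=⇒lookup e∈H) (inc-joinsˡ j)))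

    agree : ∀ e → lookup M e ≡ lookup M′ e
    agree e with lookup H e in He
    ... | true  = walk (conn _ _) (spread He₀ (inc-proj₁ e₀) agree₀) e He (inc-proj₁ e)
    ... | false = trans (outside M M⊑H) (sym (outside M′ M′⊑H))
      where
      outside : ∀ M → lookup M ⊑ lookup H → lookup M e ≡ false
      outside M M⊑H = ¬-not λ Me → true≢false (M⊑H e Me) He

-- Bipartite graphs

-- Orients every edge from the class `true` to the class `false`, independently of the order in
-- `ends`. Together with `flip` this lets each counting argument be written for one class only.
record Bipartition {n m : ℕ} (G : FiniteGraph n m) : Set where
  field
    side   : Fin n → Bool
    p q    : Fin m → Fin n
    joins  : ∀ e → Joins G e (p e) (q e)
    side-p : ∀ e → side (p e) ≡ true
    side-q : ∀ e → side (q e) ≡ false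

bipartition : ∀ {n m} {G : FiniteGraph n m} → Bipartite G → Bipartition G
bipartition {G = G} (side , proper) = record
  { side   = side
  ; p      = λ e → proj₁ (pq e)
  ; q      = λ e → proj₁ (proj₂ (pq e))
  ; joins  = λ e → proj₁ (proj₂ (proj₂ (pq e)))
  ; side-p = λ e → proj₁ (proj₂ (proj₂ (proj₂ (pq e))))
  ; side-q = λ e → proj₂ (proj₂ (proj₂ (proj₂ (pq e))))
  }
  where
  pq : ∀ e → ∃₂ λ u v → Joins G e u v × side u ≡ true × side v ≡ false
  pq e with side (proj₁ (ends G e)) in eq₁ | side (proj₂ (ends G e)) in eq₂ | proper e
  ... | true  | true  | ≢ = contradiction refl ≢
  ... | true  | false | _ = _ , _ , inj₁ refl , eq₁ , eq₂
  ... | false | true  | _ = _ , _ , inj₂ refl , eq₂ , eq₁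
  ... | false | false | ≢ = contradiction refl ≢

flip : ∀ {n m} {G : FiniteGraph n m} → Bipartition G → Bipartition G
flip {G = G} B = record
  { side = not ∘ side ; p = q ; q = p ; joins = λ e → joins-sym G (joins e)
  ; side-p = λ e → cong not (side-q e) ; side-q = λ e → cong not (side-p e) }
  where open Bipartition B

module _ {n m : ℕ} {G : FiniteGraph n m} (B : Bipartition G) where
  open Bipartition B

  inc≡∨ : ∀ e v → inc G e v ≡ (p e == v) ∨ (q e == v)
  inc≡∨ e v with joins e
  ... | inj₁ eq rewrite eq = refl
  ... | inj₂ eq rewrite eq = ∨-comm (q e == v) (p e == v)

  inc-p : ∀ e → inc G e (p e) ≡ true
  inc-p e = inc-joinsˡ G (joins e)

  inc-q : ∀ e → inc G e (q e) ≡ true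
  inc-q e = inc-joinsʳ G (joins e)

  inc≡p : ∀ e {v} → side v ≡ true → inc G e v ≡ (p e == v)
  inc≡p e {v} sv = trans (inc≡∨ e v) (trans (cong ((p e == v) ∨_) (≢⇒== λ { refl → true≢false sv (side-q e) }))
    (∨-identityʳ _))

  degree-p : ∀ F {v} → side v ≡ true → degree G F v ≡ # (λ e → lookup F e ∧ (p e == v))
  degree-p F {v} sv = trans (degree≡# G F v) (#-cong λ e → cong (lookup F e ∧_) (inc≡p e sv))

  #-p : ∀ {d} F → Regular G d F → ∀ X → X ⊑ side → # (λ e → lookup F e ∧ X (p e)) ≡ d * # X
  #-p {d} F reg X X⊑ = #-fibres p (lookup F) X d λ v Xv → trans (sym (degree-p F (X⊑ v Xv))) (reg v)

  #-p-full : ∀ {d} F → Regular G d F → # (lookup F) ≡ d * # side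
  #-p-full {d} F reg = trans (#-cong λ e → sym (trans (cong (lookup F e ∧_) (side-p e)) (∧-identityʳ _)))
    (#-p F reg side (λ _ → id))

  closed⇒ : ∀ {F S} → (∀ e → F e ≡ true → S (p e) ≡ S (q e)) → Closed G F S
  closed⇒ {F} {S} f e Fe with joins e | f e Fe
  ... | inj₁ eq | t rewrite eq = t
  ... | inj₂ eq | t rewrite eq = sym t

module _ {n m : ℕ} {G : FiniteGraph n m} (B : Bipartition G) where
  open Bipartition B

  #-q : ∀ {d} F → Regular G d F → ∀ X → X ⊑ not ∘ side → # (λ e → lookup F e ∧ X (q e)) ≡ d * # X
  #-q = #-p (flip B)

  -- Every edge of `F` has one end in each class, so both classes count `F`; the degree is a
  -- successor so that it can be cancelled.
  balanced : ∀ {d} F → Regular G (suc d) F → # side ≡ # (not ∘ side)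
  balanced {d} F reg = *-cancelˡ-≡ _ _ (suc d) (trans (sym (#-p-full B F reg)) (#-p-full (flip B) F reg))

  open Marriage p q side

  -- After pruning, the edges form a function on the `true` class, injective by the marriage
  -- condition. Since the classes have equal size it is onto, which gives degree 1 on the other
  -- class as well.
  hall⇒matching : # side ≡ # (not ∘ side) → ∀ F → Hall F →
                  ∃ λ M → PerfectMatching G M × lookup M ⊑ F
  hall⇒matching bal F hall with F′ , F′⊑F , hall′ , fun ← prune _ F ≤-refl hall
    = tabulate F′ , perfect , λ e t → F′⊑F e (trans (sym (lookup∘tabulate F′ e)) t)
    where
    N⊑ : ∀ X → neighbours F′ X ⊑ not ∘ side
    N⊑ X w t with e , _ , _ , refl ← neighbours⁻ F′ X t = cong not (side-q e)

    perfect-p : ∀ v → side v ≡ true → degree G (tabulate F′) v ≡ 1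
    perfect-p v sv with w , Nw ← #-pick _ (≤-trans (≤-reflexive (sym (#-== v)))
                                   (hall′ (_== v) λ u t → subst (λ u → side u ≡ true) (sym (==⇒≡ t)) sv))
                   with e , Fe , eq , _ ← neighbours⁻ F′ (_== v) Nw =
      trans (degree-p B (tabulate F′) sv) (#-unique _ (∧-true (trans (lookup∘tabulate F′ e) Fe) eq)
        λ f t → fun f e (trans (sym (lookup∘tabulate F′ f)) (∧-trueˡ t)) Fe (side-p f)
                  (trans (==⇒≡ (∧-trueʳ {lookup (tabulate F′) f} t)) (sym (==⇒≡ eq))))

    perfect-q : ∀ v → side v ≡ false → degree G (tabulate F′) v ≡ 1
    perfect-q v sv with e , Fe , _ , refl ← neighbours⁻ F′ side
                     (#-⊑-≥ (N⊑ side) (≤-trans (≤-reflexive (sym bal)) (hall′ side (λ _ → id))) v (cong not sv)) =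
      trans (degree-p (flip B) (tabulate F′) (cong not sv))
        (#-unique _ (∧-true (trans (lookup∘tabulate F′ e) Fe) (==-refl (q e)))
          λ f t → functional⇒injective hall′ fun (trans (sym (lookup∘tabulate F′ f)) (∧-trueˡ t)) Fe
                    (side-p f) (side-p e) (==⇒≡ (∧-trueʳ {lookup (tabulate F′) f} t)))

    perfect : PerfectMatching G (tabulate F′)
    perfect v with side v in sv
    ... | true  = perfect-p v sv
    ... | false = perfect-q v sv

  -- The edges starting in `X` number `suc d` times its size, and all of them end among its
  -- neighbours, which receive at most `suc d` each.
  regular⇒matching : ∀ {d} F → Regular G (suc d) F → ∃ λ M → PerfectMatching G M × lookup M ⊑ lookup F
  regular⇒matching {d} F reg = hall⇒matching (balanced F reg) (lookup F) hall
    where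
    hall : Hall (lookup F)
    hall X X⊑ = *-cancelˡ-≤ (suc d) (begin
      suc d * # X                                              ≡⟨ #-p B F reg X X⊑ ⟨
      # (λ e → lookup F e ∧ X (p e))                           ≤⟨ #-mono (λ e t →
        ∧-true (∧-trueˡ t) (neighbours⁺ (lookup F) X (∧-trueˡ t) (∧-trueʳ {lookup F e} t))) ⟩
      # (λ e → lookup F e ∧ neighbours (lookup F) X (q e))     ≡⟨ #-q F reg (neighbours (lookup F) X) N⊑ ⟩
      suc d * # (neighbours (lookup F) X)                      ∎)
      where
      N⊑ : neighbours (lookup F) X ⊑ not ∘ side
      N⊑ w t with e , _ , _ , refl ← neighbours⁻ (lookup F) X t = cong not (side-q e)

  disjointMatching : Cubic G → ∀ M → PerfectMatching G M → ∃ λ N → PerfectMatching G N × Disjoint G M N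
  disjointMatching cubic M pm = result (regular⇒matching (∁ M) (∁-regular G cubic M refl pm))
    where
    result : (∃ λ N → PerfectMatching G N × lookup N ⊑ lookup (∁ M)) → ∃ λ N → PerfectMatching G N × Disjoint G M N
    result (N , pn , N⊑) = N , pn , λ f Mf → ¬-not λ Nf → true≢false (N⊑ f Nf) (trans (lookup-∁ M f) (cong not Mf))

  thirdMatching : Cubic G → ∀ M N → PerfectMatching G M → PerfectMatching G N → Disjoint G M N →
                  PerfectMatching G (∁ (M ∪ N))
  thirdMatching cubic M N pm pn disj = ∁-regular G cubic (M ∪ N) refl (disjoint-∪-twoFactor G M N pm pn disj)

  -- Two disjoint perfect matchings and the complement of their union partition the edges, so one of
  -- the three contains `e`.
  edge∈matching : Cubic G → ∀ e → ∃ λ M → PerfectMatching G M × lookup M e ≡ true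
  edge∈matching cubic e = first (regular⇒matching ⊤ cubic)
    where
    Goal = ∃ λ M → PerfectMatching G M × lookup M e ≡ true

    third : ∀ M N b → lookup N e ≡ b → lookup M e ≡ false →
            PerfectMatching G M → PerfectMatching G N → Disjoint G M N → Goal
    third M N true  Ne _  _  pn _    = N , pn , Ne
    third M N false Ne Me pm pn disj = ∁ (M ∪ N) , thirdMatching cubic M N pm pn disj
      , trans (lookup-∁ (M ∪ N) e) (cong not (trans (lookup-∪ M N e) (cong₂ _∨_ Me Ne)))

    second : ∀ M b → lookup M e ≡ b → PerfectMatching G M → Goal
    second M true  Me pm = M , pm , Me
    second M false Me pm =
      let N , pn , disj = disjointMatching cubic M pm in third M N _ refl Me pm pn disj

    first : (∃ λ M → PerfectMatching G M × lookup M ⊑ lookup ⊤) → Goal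
    first (M , pm , _) = second M _ refl pm

-- Two extensions for each perfect matching

injective⇒surjective : ∀ {k} (f : Fin k → Fin k) → Injective _≡_ _≡_ f → ∀ y → ∃ λ x → f x ≡ y
injective⇒surjective {suc k} f inj y with any? (λ x → f x ≟ y)
... | yes hit = hit
... | no miss = contradiction (injective⇒≤ {f = λ x → punchOut (y≢f x)} (λ {x} {x′} eq →
                  inj (punchOut-injective (y≢f x) (y≢f x′) eq))) (<⇒≱ ≤-refl)
  where
  y≢f : ∀ x → y ≢ f x
  y≢f x eq = miss (x , sym eq)

-- Numbers the subsets (the size obtained is two to the power `n`), so that the pigeonhole principle
-- for `Fin` applies to maps between edge sets.
encode : ∀ n → ∃ λ k → Subset n ↔ Fin k
encode zero = 1 , mk↔ₛ′ (λ _ → zero) (λ _ → []) (λ { zero → refl }) (λ { [] → refl })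
encode (suc n) with k , code ← encode n = k + k , mk↔ₛ′ to from to∘from from∘to
  where
  module C = Inverse code
  to : Subset (suc n) → Fin (k + k)
  to (true  ∷ F) = C.to F ↑ˡ k
  to (false ∷ F) = k ↑ʳ C.to F
  branch : Fin k ⊎ Fin k → Subset (suc n)
  branch (inj₁ i) = true ∷ C.from i
  branch (inj₂ i) = false ∷ C.from i
  from : Fin (k + k) → Subset (suc n)
  from = branch ∘ splitAt k
  to∘branch : ∀ s → to (branch s) ≡ join k k s
  to∘branch (inj₁ i) = cong (_↑ˡ k) (C.strictlyInverseˡ i)
  to∘branch (inj₂ i) = cong (k ↑ʳ_) (C.strictlyInverseˡ i)
  to∘from : ∀ i → to (from i) ≡ i
  to∘from i = trans (to∘branch (splitAt k i)) (join-splitAt k k i)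
  from∘to : ∀ F → from (to F) ≡ F
  from∘to (true  ∷ F) rewrite splitAt-↑ˡ k (C.to F) k = cong (true ∷_) (C.strictlyInverseʳ F)
  from∘to (false ∷ F) rewrite splitAt-↑ʳ k k (C.to F) = cong (false ∷_) (C.strictlyInverseʳ F)

to-injective : ∀ {A B : Set} (c : A ↔ B) {x y} → Inverse.to c x ≡ Inverse.to c y → x ≡ y
to-injective c {x} {y} eq = trans (sym (Inverse.strictlyInverseʳ c x))
  (trans (cong (Inverse.from c) eq) (Inverse.strictlyInverseʳ c y))

from-injective : ∀ {A B : Set} (c : A ↔ B) {x y} → Inverse.from c x ≡ Inverse.from c y → x ≡ y
from-injective c {x} {y} eq = trans (sym (Inverse.strictlyInverseˡ c x))
  (trans (cong (Inverse.to c) eq) (Inverse.strictlyInverseˡ c y))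

subset-injective⇒surjective : ∀ {n} (f : Subset n → Subset n) → Injective _≡_ _≡_ f → ∀ y → ∃ λ x → f x ≡ y
subset-injective⇒surjective {n} f inj y
  with k , code ← encode n
  with i , eq ← injective⇒surjective (Inverse.to code ∘ f ∘ Inverse.from code)
                  (from-injective code ∘ inj ∘ to-injective code) (Inverse.to code y)
  = Inverse.from code i , to-injective code eq

-- Whether M contains the first edge of H.
mark : ∀ {n} → Subset n → Subset n → Bool
mark []          []      = false
mark (true  ∷ H) (b ∷ M) = b
mark (false ∷ H) (_ ∷ M) = mark H M

-- The edge `e` shows that `H` is non-empty, so the mark is a genuine membership bit and not the
-- default value `false`.
mark-agree : ∀ {n} (H M M′ : Subset n) {e} → lookup H e ≡ true → mark H M ≡ mark H M′ →
             ∃ λ e₀ → lookup H e₀ ≡ true × lookup M e₀ ≡ lookup M′ e₀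
mark-agree (true  ∷ H) (b ∷ M) (b′ ∷ M′) _ eq = zero , refl , eq
mark-agree (false ∷ H) (_ ∷ M) (_ ∷ M′) {suc e} He eq
  with e₀ , He₀ , agree ← mark-agree H M M′ He eq = suc e₀ , He₀ , agree

∁-injective : ∀ {n} {F H : Subset n} → ∁ F ≡ ∁ H → F ≡ H
∁-injective {F = F} {H} eq = lookup-ext λ e → not-injective
  (trans (sym (lookup-∁ F e)) (trans (cong (λ X → lookup X e) eq) (lookup-∁ H e)))

module _ {n m : ℕ} (G : FiniteGraph n m) where

  extensions⊎unique : ∀ M N → ExtendsBy G M N →
    ExtendsUniquely G M ⊎ ∃ λ N′ → ExtendsBy G M N′ × N′ ≢ N
  extensions⊎unique M N ext with searchSubset (λ N′ → extendsBy? G M N′ ×-dec ¬? (≡-dec _≟ᵇ_ N′ N))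
  ... | yes other = inj₂ other
  ... | no  none  = inj₁ (N , ext , unique)
    where
    unique : ∀ {N′} → ExtendsBy G M N′ → N ≡ N′
    unique {N′} ext′ with ≡-dec _≟ᵇ_ N′ N
    ... | yes eq = sym eq
    ... | no  ≢  = contradiction (N′ , ext′ , ≢) none

  extendsUniquely? : ∀ M → Dec (ExtendsUniquely G M)
  extendsUniquely? M with searchSubset (extendsBy? G M)
  ... | no none = no λ (N , ext , _) → none (N , ext)
  ... | yes (N , ext) with extensions⊎unique M N ext
  ...   | inj₁ unique = yes unique
  ...   | inj₂ (N′ , ext′ , N′≢N) = no λ (_ , _ , same) → N′≢N (trans (sym (same ext′)) (same ext))

  -- If every perfect matching extends in two ways, sending (M, one of its
  -- extensions H) to (complement of H, which half of H is M) is an injection of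
  -- PerfectMatching × Bool into itself, so every 2-factor is some such H.
  module _ (cubic : Cubic G) (pmh : PMH G)
           (none : ¬ ∃ λ M → PerfectMatching G M × ExtendsUniquely G M) where

    twoExtensions : ∀ M → PerfectMatching G M →
      ∃ λ (N : Bool → Subset m) → (∀ b → ExtendsBy G M (N b)) × N true ≢ N false
    twoExtensions M pm = first (proj₂ pmh M pm)
      where
      Goal = ∃ λ (N : Bool → Subset m) → (∀ b → ExtendsBy G M (N b)) × N true ≢ N false
      second : ∀ N → ExtendsBy G M N → ExtendsUniquely G M ⊎ (∃ λ N′ → ExtendsBy G M N′ × N′ ≢ N) → Goal
      second N ext (inj₁ unique) = contradiction (M , pm , unique) none
      second N ext (inj₂ (N′ , ext′ , ≢)) = (λ b → if b then N′ else N) , (λ { true → ext′ ; false → ext }) , ≢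
      first : ∃ (ExtendsBy G M) → Goal
      first (N , ext) = second N ext (extensions⊎unique M N ext)

    -- Off the perfect matchings the value is a dummy; making the function total allows the counting
    -- to run over all subsets.
    extension′ : ∀ M → Dec (PerfectMatching G M) → Bool → Subset m
    extension′ M (yes pm) b = proj₁ (twoExtensions M pm) b
    extension′ M (no _)   b = M

    extension : Subset m → Bool → Subset m
    extension M = extension′ M (regular? G 1 M)

    cycle : Subset m → Bool → Subset m
    cycle M b = M ∪ extension M b

    extension-extends : ∀ M → PerfectMatching G M → ∀ b → ExtendsBy G M (extension M b)
    extension-extends M pm b = aux (regular? G 1 M)
      where
      aux : ∀ d → ExtendsBy G M (extension′ M d b)
      aux (yes pm′) = proj₁ (proj₂ (twoExtensions M pm′)) b
      aux (no ¬pm)  = contradiction pm ¬pm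

    extension-distinct : ∀ M → PerfectMatching G M → extension M true ≢ extension M false
    extension-distinct M pm = aux (regular? G 1 M)
      where
      aux : ∀ d → extension′ M d true ≢ extension′ M d false
      aux (yes pm′) = proj₂ (proj₂ (twoExtensions M pm′))
      aux (no ¬pm)  = contradiction pm ¬pm

    extension-injective : ∀ M → PerfectMatching G M → ∀ {b b′} → extension M b ≡ extension M b′ → b ≡ b′
    extension-injective M pm {true}  {true}  _  = refl
    extension-injective M pm {true}  {false} eq = contradiction eq (extension-distinct M pm)
    extension-injective M pm {false} {true}  eq = contradiction (sym eq) (extension-distinct M pm)
    extension-injective M pm {false} {false} _  = refl

    extension≡ : ∀ M → PerfectMatching G M → ∀ b e → lookup (extension M b) e ≡ lookup (cycle M b) e ∧ not (lookup M e)
    extension≡ M pm b e = aux (extension-extends M pm b)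
      where
      N = extension M b
      bool : ∀ x y → (x ≡ true → y ≡ false) → y ≡ (x ∨ y) ∧ not x
      bool true  y f = f refl
      bool false y _ = sym (∧-identityʳ y)
      aux : ExtendsBy G M N → lookup N e ≡ lookup (cycle M b) e ∧ not (lookup M e)
      aux (pn , tf , _) = trans (bool (lookup M e) (lookup N e) (twoFactor-∪-disjoint G M N pm pn tf e))
        (cong (_∧ not (lookup M e)) (sym (lookup-∪ M N e)))

    -- Being the identity off the perfect matchings, it acts on the whole type `Subset (suc m)`,
    -- where injective maps are onto, so the perfect matchings never have to be counted. The leading
    -- bit selects an extension on input and records the half of the cycle on output.
    swap′ : ∀ M → Dec (PerfectMatching G M) → Bool → Subset (suc m)
    swap′ M (yes _) b = mark (cycle M b) M ∷ ∁ (cycle M b)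
    swap′ M (no _)  b = b ∷ M

    swap : Subset (suc m) → Subset (suc m)
    swap (b ∷ M) = swap′ M (regular? G 1 M) b

    cycle-∁ : ∀ M → PerfectMatching G M → ∀ b → PerfectMatching G (∁ (cycle M b))
    cycle-∁ M pm b = ∁-regular G cubic (cycle M b) refl (proj₁ (proj₂ (extension-extends M pm b)))

    M⊑cycle : ∀ M b → lookup M ⊑ lookup (cycle M b)
    M⊑cycle M b e Me = trans (lookup-∪ M (extension M b) e) (∨-trueˡ _ Me)

    -- The tail of the value recovers the cycle, the mark then recovers `M` among the at most two
    -- perfect matchings in it, and the cycle without `M` is the extension, which recovers the bit.
    swap-injective : Injective _≡_ _≡_ swap
    swap-injective {b ∷ M} {b′ ∷ M′} = aux (regular? G 1 M) (regular? G 1 M′)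
      where
      same : PerfectMatching G M → PerfectMatching G M′ → cycle M b ≡ cycle M′ b′ →
             mark (cycle M b) M ≡ mark (cycle M′ b′) M′ → b ∷ M ≡ b′ ∷ M′
      same pm pm′ H≡H′ marks = conclude M≡M′ H≡H′
        where
        H = cycle M b
        ham : HamiltonianCycle G H
        ham = proj₂ (extension-extends M pm b)
        M′⊑H : lookup M′ ⊑ lookup H
        M′⊑H = subst (λ H → lookup M′ ⊑ lookup H) (sym H≡H′) (M⊑cycle M′ b′)
        edgeOfH : ∃ λ e → lookup H e ≡ true
        edgeOfH = let v = proj₁ (proj₂ ham)
                      e , Me , _ = edgeAt G M v (≤-reflexive (sym (pm v)))
                  in e , M⊑cycle M b e Me
        agreement : ∃ λ e₀ → lookup H e₀ ≡ true × lookup M e₀ ≡ lookup M′ e₀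
        agreement = mark-agree H M M′ (proj₂ edgeOfH) (trans marks (cong (λ H → mark H M′) (sym H≡H′)))
        M≡M′ : M ≡ M′
        M≡M′ = matching-determined G M M′ H ham pm pm′ (M⊑cycle M b) M′⊑H
                 (proj₁ (proj₂ agreement)) (proj₂ (proj₂ agreement))
        conclude : M ≡ M′ → cycle M b ≡ cycle M′ b′ → b ∷ M ≡ b′ ∷ M′
        conclude refl eq = cong (_∷ M) (extension-injective M pm (lookup-ext λ e →
          trans (extension≡ M pm b e) (trans (cong (λ H → lookup H e ∧ not (lookup M e)) eq) (sym (extension≡ M pm b′ e)))))
      aux : ∀ d d′ → swap′ M d b ≡ swap′ M′ d′ b′ → b ∷ M ≡ b′ ∷ M′
      aux (no _)   (no _)    eq = eq
      -- In the mixed cases one tail is a perfect matching, being the complement of a 2-factor, and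
      -- the other is not.
      aux (no ¬pm) (yes pm′) eq = contradiction (subst (PerfectMatching G) (sym (∷-injectiveʳ eq)) (cycle-∁ M′ pm′ b′)) ¬pm
      aux (yes pm) (no ¬pm′) eq = contradiction (subst (PerfectMatching G) (∷-injectiveʳ eq) (cycle-∁ M pm b)) ¬pm′
      aux (yes pm) (yes pm′) eq = same pm pm′ (∁-injective (∷-injectiveʳ eq)) (∷-injectiveˡ eq)

    twoFactorHamiltonian : TwoFactorHamiltonian G
    twoFactorHamiltonian = (_ , proj₂ (extension-extends (proj₁ (proj₁ pmh)) (proj₂ (proj₁ pmh)) true)) , every
      where
      every : ∀ F → TwoFactor G F → HamiltonianCycle G F
      -- The complement of `F` is a perfect matching, so its preimage cannot come from the identity
      -- branch; it is a pair whose cycle is `F`.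
      every F tf = hit (subset-injective⇒surjective swap swap-injective (true ∷ ∁ F))
        where
        ∁F : PerfectMatching G (∁ F)
        ∁F = ∁-regular G cubic F refl tf
        aux : ∀ M b d → swap′ M d b ≡ true ∷ ∁ F → HamiltonianCycle G F
        aux M b (yes pm) eq = subst (HamiltonianCycle G) (∁-injective (∷-injectiveʳ eq)) (proj₂ (extension-extends M pm b))
        aux M b (no ¬pm) eq = contradiction (subst (PerfectMatching G) (sym (∷-injectiveʳ eq)) ∁F) ¬pm
        hit : (∃ λ x → swap x ≡ true ∷ ∁ F) → HamiltonianCycle G F
        hit (b ∷ M , eq) = aux M b (regular? G 1 M) eq

module _ {n m : ℕ} {G : FiniteGraph n m} (B : Bipartition G) (cubic : Cubic G) (tfh : TwoFactorHamiltonian G) where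

  disjoint⇒extends : ∀ M N → PerfectMatching G M → PerfectMatching G N → Disjoint G M N → ExtendsBy G M N
  disjoint⇒extends M N pm pn disj = pn , proj₂ tfh (M ∪ N) (disjoint-∪-twoFactor G M N pm pn disj)

  twoFactorHamiltonian⇒PMH : PMH G
  twoFactorHamiltonian⇒PMH =
    (let M , pm , _ = regular⇒matching B ⊤ cubic in M , pm) ,
    λ M pm → let N , pn , disj = disjointMatching B cubic M pm in N , disjoint⇒extends M N pm pn disj

  -- Some `N` disjoint from `M` exists, and both `N` and the complement of `M ∪ N` extend `M`. They
  -- are disjoint and non-empty, hence different.
  notUniquelyExtendible : ∀ M → PerfectMatching G M → ¬ ExtendsUniquely G M
  notUniquelyExtendible M pm (_ , _ , same) =
    let N , pn , disj = disjointMatching B cubic M pm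
        N′ = ∁ (M ∪ N)
        disj′ : Disjoint G M N′
        disj′ e Me = trans (lookup-∁ (M ∪ N) e) (cong not (trans (lookup-∪ M N e) (∨-trueˡ _ Me)))
        N≡N′ = trans (sym (same (disjoint⇒extends M N pm pn disj)))
                 (same (disjoint⇒extends M N′ pm (thirdMatching B cubic M N pm pn disj) disj′))
        v = proj₁ (proj₂ (proj₂ (proj₁ tfh)))
        e , Ne , _ = edgeAt G N v (≤-reflexive (sym (pn v)))
    in true≢false Ne (trans (cong (λ X → lookup X e) N≡N′)
         (trans (lookup-∁ (M ∪ N) e) (cong not (trans (lookup-∪ M N e) (∨-trueʳ (lookup M e) Ne)))))

-- Enumerations

-- Identifies a set of vertices or edges with `Fin k`, so that a part of a finite graph can become a
-- `FiniteGraph` again.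
record Enumeration {n : ℕ} (b : Fin n → Bool) (k : ℕ) : Set where
  field
    elem           : Fin k → Fin n
    elem-true      : ∀ i → b (elem i) ≡ true
    elem-injective : Injective _≡_ _≡_ elem
    index          : ∀ x → b x ≡ true → ∃ λ i → elem i ≡ x

enumerate : ∀ {n} (b : Fin n → Bool) k → # b ≡ k → Enumeration b k
enumerate b zero    #≡0 = record
  { elem = λ () ; elem-true = λ () ; elem-injective = λ {}
  ; index = λ x bx → contradiction (≤-trans (#≥1 b bx) (≤-reflexive #≡0)) λ () }
enumerate {n} b (suc k) #≡ with x , bx ← #-pick b (≤-trans (s≤s z≤n) (≤-reflexive (sym #≡))) = record
  { elem = elem ; elem-true = elem-true ; elem-injective = elem-injective ; index = index }
  where
  module R = Enumeration (enumerate (b ∖ x) k (suc-injective (trans (sym (#-remove b bx)) #≡)))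
  elem : Fin (suc k) → Fin n
  elem zero    = x
  elem (suc i) = R.elem i
  elem-true : ∀ i → b (elem i) ≡ true
  elem-true zero    = bx
  elem-true (suc i) = ∖-⊑ b _ (R.elem-true i)
  elem-injective : Injective _≡_ _≡_ elem
  elem-injective {zero}  {zero}  _  = refl
  elem-injective {zero}  {suc j} eq = contradiction (sym eq) (∖-≢ b (R.elem-true j))
  elem-injective {suc i} {zero}  eq = contradiction eq (∖-≢ b (R.elem-true i))
  elem-injective {suc i} {suc j} eq = cong suc (R.elem-injective eq)
  index : ∀ y → b y ≡ true → ∃ λ i → elem i ≡ y
  index y by with y ≟ x
  ... | yes refl = zero , refl
  ... | no  y≢x  with i , eq ← R.index y (∖-true b by y≢x) = suc i , eq

#-injection : ∀ {n k} (b : Fin n → Bool) (f : Fin n → Fin k) →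
              (∀ {x y} → b x ≡ true → b y ≡ true → f x ≡ f y → x ≡ y) → # b ≤ k
#-injection b f inj = injective⇒≤ {f = f ∘ elem} λ eq → elem-injective (inj (elem-true _) (elem-true _) eq)
  where open Enumeration (enumerate b (# b) refl)

-- Cycles

-- Unlike Cycle, this also makes sense for multigraphs on arbitrary types.
record Circuit {V E : Set} (H : Multigraph V E) (l : ℕ) : Set where
  field
    vertex           : Fin (suc l) → V
    edge             : Fin (suc l) → E
    vertex-injective : Injective _≡_ _≡_ vertex
    edge-injective   : Injective _≡_ _≡_ edge
    edge-joins       : ∀ i → Joins H (edge i) (vertex i) (vertex (suc (toℕ i) mod suc l))

circuit⇒cycle : ∀ {n m l} {G : FiniteGraph n m} (c : Circuit G l) F →
                (∀ i → lookup F (Circuit.edge c i) ≡ true) → Cycle G F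
circuit⇒cycle {l = l} c F ∈F = record
  { length-1 = l ; vertex = vertex ; edge = edge
  ; vertex-injective = vertex-injective ; edge-injective = edge-injective
  ; edge∈F = λ i → lookup⇒[]= (edge i) F (∈F i) ; edge-joins = edge-joins }
  where open Circuit c

girth⇒¬circuit : ∀ {n m g l} {G : FiniteGraph n m} → GirthAtLeast G g → suc l < g → ¬ Circuit G l
girth⇒¬circuit girth l<g c = <⇒≱ l<g (girth (circuit⇒cycle c ⊤ λ i → lookup-⊤ (Circuit.edge c i)))

joins-map : ∀ {V E V′ E′ : Set} {G : Multigraph V E} {H : Multigraph V′ E′} {e e′} {f : V → V′} →
            ends H e′ ≡ (f (proj₁ (ends G e)) , f (proj₂ (ends G e))) →
            ∀ {u v} → Joins G e u v → Joins H e′ (f u) (f v)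
joins-map {f = f} eq (inj₁ j) = inj₁ (trans eq (cong₂ _,_ (cong (f ∘ proj₁) j) (cong (f ∘ proj₂) j)))
joins-map {f = f} eq (inj₂ j) = inj₂ (trans eq (cong₂ _,_ (cong (f ∘ proj₁) j) (cong (f ∘ proj₂) j)))

module _ {V E V′ E′ : Set} {G : Multigraph V E} {H : Multigraph V′ E′} (iso : G ≅ H) where
  private
    module I = _≅_ iso
    module Vs = Inverse I.vertices
    module Es = Inverse I.edges

  joins-from : ∀ {e x y} → Joins H e x y → Joins G (Es.from e) (Vs.from x) (Vs.from y)
  joins-from {e} {x} {y} j = orient (subst (λ e → Joins H e _ _) (Es.strictlyInverseˡ e) (I.joins (Es.from e))) j
    where
    e₀ = Es.from e
    u = proj₁ (ends G e₀)
    v = proj₂ (ends G e₀)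
    same : ∀ {a b x y} → ends H e ≡ (Vs.to a , Vs.to b) → ends H e ≡ (x , y) → (a , b) ≡ (Vs.from x , Vs.from y)
    same eq eq′ = cong₂ _,_ (move (trans (sym (cong proj₁ eq)) (cong proj₁ eq′)))
                            (move (trans (sym (cong proj₂ eq)) (cong proj₂ eq′)))
      where
      move : ∀ {a x} → Vs.to a ≡ x → a ≡ Vs.from x
      move {a} eq = trans (sym (Vs.strictlyInverseʳ a)) (cong Vs.from eq)
    orient : Joins H e (Vs.to u) (Vs.to v) → Joins H e x y → Joins G e₀ (Vs.from x) (Vs.from y)
    orient (inj₁ a) (inj₁ b) = inj₁ (same a b)
    orient (inj₁ a) (inj₂ b) = inj₂ (same a b)
    orient (inj₂ a) (inj₁ b) = inj₂ (cong Prod.swap (same a b))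
    orient (inj₂ a) (inj₂ b) = inj₁ (cong Prod.swap (same a b))

  circuit-from : ∀ {l} → Circuit H l → Circuit G l
  circuit-from c = record
    { vertex = Vs.from ∘ vertex ; edge = Es.from ∘ edge
    ; vertex-injective = vertex-injective ∘ from-injective I.vertices
    ; edge-injective = edge-injective ∘ from-injective I.edges
    ; edge-joins = joins-from ∘ edge-joins }
    where open Circuit c

-- The invariant carried through generation: if every vertex is missed by some cycle, each factor of
-- a star product keeps a cycle when its vertex is deleted.
CircuitAvoiding : ∀ {V E} → Multigraph V E → V → Set
CircuitAvoiding H v = ∃₂ λ l (c : Circuit H l) → ∀ i → Circuit.vertex c i ≢ v

circuitAvoiding-from : ∀ {V E V′ E′} {G : Multigraph V E} {H : Multigraph V′ E′} → G ≅ H →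
                       (∀ v → CircuitAvoiding H v) → ∀ v → CircuitAvoiding G v
circuitAvoiding-from iso avoid v with l , c , c∌v ← avoid (Inverse.to (_≅_.vertices iso) v) =
  l , circuit-from iso c , λ i eq →
    c∌v i (trans (sym (Inverse.strictlyInverseˡ (_≅_.vertices iso) _)) (cong (Inverse.to (_≅_.vertices iso)) eq))

incident-joins : ∀ {V E} {G : Multigraph V E} {e u w v} → Joins G e u w → Incident G e v → u ≡ v ⊎ w ≡ v
incident-joins (inj₁ eq) (inj₁ i) = inj₁ (trans (sym (cong proj₁ eq)) i)
incident-joins (inj₁ eq) (inj₂ i) = inj₂ (trans (sym (cong proj₂ eq)) i)
incident-joins (inj₂ eq) (inj₁ i) = inj₂ (trans (sym (cong proj₁ eq)) i)
incident-joins (inj₂ eq) (inj₂ i) = inj₁ (trans (sym (cong proj₂ eq)) i)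

circuit-ᵛ : ∀ {V E} {G : Multigraph V E} {v l} (c : Circuit G l) → (∀ i → Circuit.vertex c i ≢ v) → Circuit (G -ᵛ v) l
circuit-ᵛ {G = G} {v} c c∌v = record
  { vertex = λ i → vertex i , c∌v i
  ; edge = λ i → edge i , e∌v i
  ; vertex-injective = vertex-injective ∘ cong proj₁
  ; edge-injective = edge-injective ∘ cong proj₁
  ; edge-joins = λ i → lift {e∌v = e∌v i} (edge-joins i) }
  where
  open Circuit c
  e∌v : ∀ i → ¬ Incident G (edge i) v
  e∌v i inc = [ c∌v _ , c∌v _ ]′ (incident-joins {G = G} (edge-joins i) inc)
  lift : ∀ {e u w} {e∌v : ¬ Incident G e v} {u≢v : u ≢ v} {w≢v : w ≢ v} →
         Joins G e u w → Joins (G -ᵛ v) (e , e∌v) (u , u≢v) (w , w≢v)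
  lift (inj₁ refl) = inj₁ refl
  lift (inj₂ refl) = inj₂ refl

module _ {V₁ E₁ V₂ E₂ : Set} (G₁ : Multigraph V₁ E₁) (v₁ : V₁) (c₁ : Claw G₁ v₁)
         (G₂ : Multigraph V₂ E₂) (v₂ : V₂) (c₂ : Claw G₂ v₂) where
  private ★ = starProduct G₁ v₁ c₁ G₂ v₂ c₂

  circuit-★ˡ : ∀ {l} → Circuit (G₁ -ᵛ v₁) l → Circuit ★ l
  circuit-★ˡ c = record
    { vertex = inj₁ ∘ vertex ; edge = inj₁ ∘ edge
    ; vertex-injective = vertex-injective ∘ inj₁-injective
    ; edge-injective = edge-injective ∘ inj₁-injective
    ; edge-joins = λ i → joins-map {G = G₁ -ᵛ v₁} {H = ★} {e = edge i} {e′ = inj₁ (edge i)} {f = inj₁} refl (edge-joins i) }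
    where open Circuit c

  circuit-★ʳ : ∀ {l} → Circuit (G₂ -ᵛ v₂) l → Circuit ★ l
  circuit-★ʳ c = record
    { vertex = inj₂ ∘ vertex ; edge = inj₂ ∘ inj₁ ∘ edge
    ; vertex-injective = vertex-injective ∘ inj₂-injective
    ; edge-injective = edge-injective ∘ inj₁-injective ∘ inj₂-injective
    ; edge-joins = λ i → joins-map {G = G₂ -ᵛ v₂} {H = ★} {e = edge i} {e′ = inj₂ (inj₁ (edge i))} {f = inj₂} refl (edge-joins i) }
    where open Circuit c

  -- A vertex of the product lies in one factor; the required cycle is found in the other, where it
  -- avoids the deleted vertex.
  circuitAvoiding-★ : (∀ v → CircuitAvoiding G₁ v) → (∀ v → CircuitAvoiding G₂ v) → ∀ v → CircuitAvoiding ★ v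
  circuitAvoiding-★ avoid₁ avoid₂ (inj₁ _) with l , c , c∌ ← avoid₂ v₂ = l , circuit-★ʳ (circuit-ᵛ c c∌) , λ i ()
  circuitAvoiding-★ avoid₁ avoid₂ (inj₂ _) with l , c , c∌ ← avoid₁ v₁ = l , circuit-★ˡ (circuit-ᵛ c c∌) , λ i ()

module _ {n m : ℕ} (G : FiniteGraph n m) where

  joins? : ∀ e u v → Dec (Joins G e u v)
  joins? e u v = Prodₚ.≡-dec _≟_ _≟_ (ends G e) (u , v) ⊎-dec Prodₚ.≡-dec _≟_ _≟_ (ends G e) (v , u)

  injective? : ∀ {k l} (f : Fin k → Fin l) → Dec (∀ i j → f i ≡ f j → i ≡ j)
  injective? f = all? λ i → all? λ j → (f i ≟ f j) →-dec (i ≟ j)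

  IsCircuit : ∀ {l} → Vec (Fin n) (suc l) → Vec (Fin m) (suc l) → Set
  IsCircuit {l} vs es = (∀ i j → lookup vs i ≡ lookup vs j → i ≡ j) × (∀ i j → lookup es i ≡ lookup es j → i ≡ j) ×
    (∀ i → Joins G (lookup es i) (lookup vs i) (lookup vs (suc (toℕ i) mod suc l)))

  isCircuit? : ∀ {l} vs es → Dec (IsCircuit {l} vs es)
  isCircuit? {l} vs es = injective? (lookup vs) ×-dec injective? (lookup es) ×-dec
    all? λ i → joins? (lookup es i) (lookup vs i) (lookup vs (suc (toℕ i) mod suc l))

  circuit : ∀ {l} vs es → {True (isCircuit? {l} vs es)} → Circuit G l
  circuit vs es {ok} = let injᵥ , injₑ , j = toWitness ok in record
    { vertex = lookup vs ; edge = lookup es ; vertex-injective = injᵥ _ _ ; edge-injective = injₑ _ _ ; edge-joins = j }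

  avoids? : ∀ {l} (c : Circuit G l) v → Dec (∀ i → Circuit.vertex c i ≢ v)
  avoids? c v = all? λ i → ¬? (Circuit.vertex c i ≟ v)

residues : ∀ {k} n .{{_ : NonZero n}} → Vec ℕ k → Vec (Fin n) k
residues n = Vec.map (_mod n)

theta-circuit : Circuit theta 1
theta-circuit = circuit theta (residues 2 (0 ∷ 1 ∷ [])) (residues 3 (0 ∷ 1 ∷ []))

K₃,₃-circuit : Circuit K₃,₃ 3
K₃,₃-circuit = circuit K₃,₃ (residues 6 (0 ∷ 3 ∷ 1 ∷ 4 ∷ [])) (residues 9 (0 ∷ 3 ∷ 4 ∷ 1 ∷ []))

-- Edge `3i + j` joins `i` to `3 + j`. The three 4-cycles omit the pairs {2, 5}, {1, 4} and {0, 3},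
-- which together are all vertices.
K₃,₃-avoiding : ∀ v → CircuitAvoiding K₃,₃ v
K₃,₃-avoiding v = [ (λ a → 3 , c₁ , a) , [ (λ a → 3 , c₂ , a) , (λ a → 3 , c₃ , a) ]′ ]′
  (toWitness {a? = all? λ v → avoids? K₃,₃ c₁ v ⊎-dec avoids? K₃,₃ c₂ v ⊎-dec avoids? K₃,₃ c₃ v} tt v)
  where
  c₁ = K₃,₃-circuit
  c₂ = circuit K₃,₃ (residues 6 (0 ∷ 3 ∷ 2 ∷ 5 ∷ [])) (residues 9 (0 ∷ 6 ∷ 8 ∷ 2 ∷ []))
  c₃ = circuit K₃,₃ (residues 6 (1 ∷ 4 ∷ 2 ∷ 5 ∷ [])) (residues 9 (4 ∷ 7 ∷ 8 ∷ 5 ∷ []))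

-- The two 6-cycles are vertex-disjoint, so each vertex is missed by at least one of them.
heawood-avoiding : ∀ v → CircuitAvoiding heawood v
heawood-avoiding v = [ (λ a → 5 , c₁ , a) , (λ a → 5 , c₂ , a) ]′
  (toWitness {a? = all? λ v → avoids? heawood c₁ v ⊎-dec avoids? heawood c₂ v} tt v)
  where
  c₁ = circuit heawood (residues 14 (0 ∷ 7 ∷ 4 ∷ 11 ∷ 1 ∷ 8 ∷ [])) (residues 21 (0 ∷ 14 ∷ 12 ∷ 5 ∷ 3 ∷ 1 ∷ []))
  c₂ = circuit heawood (residues 14 (2 ∷ 9 ∷ 6 ∷ 13 ∷ 3 ∷ 10 ∷ [])) (residues 21 (6 ∷ 20 ∷ 18 ∷ 11 ∷ 9 ∷ 7 ∷ []))

generated-avoiding : ∀ {n m} {G : FiniteGraph n m} → Generated G → ∀ v → CircuitAvoiding G v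
generated-avoiding (isK₃,₃ iso)    = circuitAvoiding-from iso K₃,₃-avoiding
generated-avoiding (isHeawood iso) = circuitAvoiding-from iso heawood-avoiding
generated-avoiding (isStar {G₁ = G₁} {G₂} gen₁ gen₂ v₁ c₁ v₂ c₂ iso) = circuitAvoiding-from iso
  (circuitAvoiding-★ G₁ v₁ c₁ G₂ v₂ c₂ (generated-avoiding gen₁) (generated-avoiding gen₂))

star⇒¬cyclically4 : ∀ {n m n₁ m₁ n₂ m₂} {G : FiniteGraph n m} {G₁ : FiniteGraph n₁ m₁} {G₂ : FiniteGraph n₂ m₂} →
  Generated G₁ → Generated G₂ → ∀ v₁ (c₁ : Claw G₁ v₁) v₂ (c₂ : Claw G₂ v₂) →
  G ≅ starProduct G₁ v₁ c₁ G₂ v₂ c₂ → ¬ CyclicallyEdgeConnected G 4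
star⇒¬cyclically4 {n} {m} {G = G} {G₁} {G₂} gen₁ gen₂ v₁ c₁ v₂ c₂ iso cyc =
  cyc X (s≤s ∣X∣≤3) ((λ (_ , conn) → separated (conn u w)) , u , w , separated , (cycle-u , ε) , (cycle-w , ε))
  where
  ★ = starProduct G₁ v₁ c₁ G₂ v₂ c₂
  module I = _≅_ iso
  module Vs = Inverse I.vertices
  module Es = Inverse I.edges
  E★ = (∃ λ e → ¬ Incident G₁ e v₁) ⊎ (∃ λ e → ¬ Incident G₂ e v₂) ⊎ Fin 3

  new : E★ → Bool
  new (inj₁ _)        = false
  new (inj₂ (inj₁ _)) = false
  new (inj₂ (inj₂ _)) = true

  -- The value on old edges is arbitrary: injectivity is asked for on the three new edges only.
  label : E★ → Fin 3
  label (inj₂ (inj₂ i)) = i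
  label _               = zero

  label-injective : ∀ {x y} → new x ≡ true → new y ≡ true → label x ≡ label y → x ≡ y
  label-injective {inj₂ (inj₂ _)} {inj₂ (inj₂ _)} _ _ refl = refl

  left : ∃ (_≢ v₁) ⊎ ∃ (_≢ v₂) → Bool
  left (inj₁ _) = true
  left (inj₂ _) = false

  X : Subset m
  X = tabulate (new ∘ Es.to)

  ∣X∣≤3 : ∣ X ∣ ≤ 3
  ∣X∣≤3 = ≤-trans (≤-reflexive (trans (∣∣≡# X) (#-cong (lookup∘tabulate _))))
    (#-injection (new ∘ Es.to) (label ∘ Es.to) λ a b eq → to-injective I.edges (label-injective a b eq))

  old-joins : ∀ {x a b} → new x ≡ false → Joins ★ x a b → left a ≡ left b
  old-joins {inj₁ _}        _ (inj₁ refl) = refl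
  old-joins {inj₁ _}        _ (inj₂ refl) = refl
  old-joins {inj₂ (inj₁ _)} _ (inj₁ refl) = refl
  old-joins {inj₂ (inj₁ _)} _ (inj₂ refl) = refl

  lookup-∁X : ∀ e → lookup (∁ X) e ≡ not (new (Es.to e))
  lookup-∁X e = trans (lookup-∁ X e) (cong not (lookup∘tabulate _ e))

  closed : Closed G (lookup (∁ X)) (left ∘ Vs.to)
  closed e e∉X = old-joins {Es.to e} (not-injective (trans (sym (lookup-∁X e)) e∉X)) (I.joins e)

  circuit₁ : ∃ (Circuit (G₁ -ᵛ v₁))
  circuit₁ = let l , c , c∌v = generated-avoiding gen₁ v₁ in l , circuit-ᵛ c c∌v

  circuit₂ : ∃ (Circuit (G₂ -ᵛ v₂))
  circuit₂ = let l , c , c∌v = generated-avoiding gen₂ v₂ in l , circuit-ᵛ c c∌v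

  cycle-u : Cycle G (∁ X)
  cycle-u = circuit⇒cycle (circuit-from iso (circuit-★ˡ G₁ v₁ c₁ G₂ v₂ c₂ (proj₂ circuit₁))) (∁ X)
    λ i → trans (lookup-∁X _) (cong (not ∘ new) (Es.strictlyInverseˡ _))

  cycle-w : Cycle G (∁ X)
  cycle-w = circuit⇒cycle (circuit-from iso (circuit-★ʳ G₁ v₁ c₁ G₂ v₂ c₂ (proj₂ circuit₂))) (∁ X)
    λ i → trans (lookup-∁X _) (cong (not ∘ new) (Es.strictlyInverseˡ _))

  u = Cycle.vertex cycle-u zero
  w = Cycle.vertex cycle-w zero

  separated : ¬ Reachable G (∁ X) u w
  separated r = true≢false
    (trans (sym (reachable-closed G {S = left ∘ Vs.to} closed r)) (cong left (Vs.strictlyInverseˡ _)))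
    (cong left (Vs.strictlyInverseˡ _))

-- From generation by star products to unique extensions

Generation : Set
Generation = ∀ {n m} (G : FiniteGraph n m) →
  Connected G → Bipartite G → Cubic G → TwoFactorHamiltonian G → ¬ (G ≅ theta) → Generated G

UniqueExtension : Set
UniqueExtension = ∀ {n m} (G : FiniteGraph n m) →
  Connected G → Bipartite G → CyclicallyEdgeConnected G 4 → Cubic G → PMH G → GirthAtLeast G 6 →
  ¬ (G ≅ heawood) → ∃ λ M → PerfectMatching G M × ExtendsUniquely G M

generation⇒uniqueExtension : Generation → UniqueExtension
generation⇒uniqueExtension generate G conn bip cyc cubic pmh girth ¬heawood =
  -- Deciding whether a uniquely extendible matching exists makes the argument by contradiction
  -- legitimate.
  result (searchSubset λ M → regular? G 1 M ×-dec extendsUniquely? G M)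
  where
  Goal = ∃ λ M → PerfectMatching G M × ExtendsUniquely G M
  ¬theta : ¬ (G ≅ theta)
  ¬theta iso = girth⇒¬circuit girth (s≤s (s≤s (s≤s z≤n))) (circuit-from iso theta-circuit)
  ¬generated : ¬ Generated G
  ¬generated (isK₃,₃ iso)    = girth⇒¬circuit girth (s≤s (s≤s (s≤s (s≤s (s≤s z≤n))))) (circuit-from iso K₃,₃-circuit)
  ¬generated (isHeawood iso) = ¬heawood iso
  ¬generated (isStar gen₁ gen₂ v₁ c₁ v₂ c₂ iso) = star⇒¬cyclically4 gen₁ gen₂ v₁ c₁ v₂ c₂ iso cyc
  result : Dec Goal → Goal
  result (yes found) = found
  result (no none) = contradiction
    (generate G conn bip cubic (twoFactorHamiltonian G cubic pmh none) ¬theta) ¬generated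

-- Edge cuts

#-true : ∀ m → # {m} (λ _ → true) ≡ m
#-true zero    = ∑-zero
#-true (suc m) = trans (∑-suc _) (cong suc (#-true m))

#-∨≤ : ∀ {n} (b c : Fin n → Bool) → # (λ i → b i ∨ c i) ≤ # b + # c
#-∨≤ b c = ≤-trans (m≤m+n _ _) (≤-reflexive (#-∨∧ b c))

#≤3⇒ : ∀ {n} (b : Fin n → Bool) {x y z w} → # b ≤ 3 → b x ≡ true → b y ≡ true → b z ≡ true →
       x ≢ y → z ≢ x → z ≢ y → b w ≡ true → w ≡ x ⊎ w ≡ y ⊎ w ≡ z
#≤3⇒ b {x} {w = w} #≤3 bx by bz x≢y z≢x z≢y bw with w ≟ x
... | yes w≡x = inj₁ w≡x
... | no  w≢x = inj₂ (#≤2⇒ (b ∖ x) (≤-pred (≤-trans (≤-reflexive (sym (#-remove b bx))) #≤3))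
                  (∖-true b by (x≢y ∘ sym)) (∖-true b bz z≢x) (z≢y ∘ sym) (∖-true b bw w≢x))

module _ {n m : ℕ} {G : FiniteGraph n m} (B : Bipartition G) where
  open Bipartition B

  leaving : (Fin n → Bool) → Fin m → Bool
  leaving S e = S (p e) ∧ not (S (q e))

  entering : (Fin n → Bool) → Fin m → Bool
  entering S e = S (q e) ∧ not (S (p e))

  boundary : (Fin n → Bool) → Fin m → Bool
  boundary S e = leaving S e ∨ entering S e

  #-side-p : ∀ {d} F → Regular G d F → ∀ (S : Fin n → Bool) →
             # (λ e → lookup F e ∧ S (p e)) ≡ d * # (λ v → S v ∧ side v)
  #-side-p F reg S = trans (#-cong λ e → cong (lookup F e ∧_) (sym (trans (cong (S (p e) ∧_) (side-p e)) (∧-identityʳ _))))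
    (#-p B F reg (λ v → S v ∧ side v) λ v → ∧-trueʳ {S v})

module _ {n m : ℕ} {G : FiniteGraph n m} (B : Bipartition G) where
  open Bipartition B

  -- Double counting: after adding the F-edges inside S, both sides count the
  -- F-edges that meet S.
  balance : ∀ {d} F → Regular G d F → ∀ (S : Fin n → Bool) →
    # (λ e → lookup F e ∧ leaving B S e) + d * # (λ v → S v ∧ not (side v)) ≡
    # (λ e → lookup F e ∧ entering B S e) + d * # (λ v → S v ∧ side v)
  balance {d} F reg S = begin-equality
    out + d * # (λ v → S v ∧ not (side v))      ≡⟨ cong (out +_) (#-side-p (flip B) F reg S) ⟨
    out + # (λ e → lookup F e ∧ S (q e))        ≡⟨ cong (out +_) (split (S ∘ q) (S ∘ p)) ⟩
    out + (# (λ e → (lookup F e ∧ S (q e)) ∧ S (p e)) + inn) ≡⟨ cong (λ k → out + (k + inn)) (#-cong both) ⟩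
    out + (inside + inn)                        ≡⟨ +-comm out _ ⟩
    (inside + inn) + out                        ≡⟨ cong (_+ out) (+-comm inside inn) ⟩
    (inn + inside) + out                        ≡⟨ +-assoc inn inside out ⟩
    inn + (inside + out)                        ≡⟨ cong (inn +_) (split (S ∘ p) (S ∘ q)) ⟨
    inn + # (λ e → lookup F e ∧ S (p e))        ≡⟨ cong (inn +_) (#-side-p B F reg S) ⟩
    inn + d * # (λ v → S v ∧ side v)            ∎
    where
    out inn inside : ℕ
    out = # (λ e → lookup F e ∧ leaving B S e)
    inn = # (λ e → lookup F e ∧ entering B S e)
    inside = # (λ e → (lookup F e ∧ S (p e)) ∧ S (q e))
    both : ∀ e → (lookup F e ∧ S (q e)) ∧ S (p e) ≡ (lookup F e ∧ S (p e)) ∧ S (q e)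
    both e = trans (∧-assoc (lookup F e) _ _) (trans (cong (lookup F e ∧_) (∧-comm (S (q e)) _)) (sym (∧-assoc (lookup F e) _ _)))
    split : ∀ f g → # (λ e → lookup F e ∧ f e) ≡ # (λ e → (lookup F e ∧ f e) ∧ g e) + # (λ e → lookup F e ∧ (f e ∧ not (g e)))
    split f g = trans (#-split _ g) (cong (# (λ e → (lookup F e ∧ f e) ∧ g e) +_) (#-cong λ e → ∧-assoc (lookup F e) _ _))

  -- Two vertices on either side exclude the cut around a single vertex; they make both contractions
  -- smaller than `G` and keep both from being `theta`.
  Reducing : (Fin n → Bool) → Set
  Reducing S = 2 ≤ # S × 2 ≤ # (not ∘ S) × # (boundary B S) ≤ 3

  reducing-cong : ∀ {S S′} → (∀ v → S v ≡ S′ v) → Reducing S → Reducing S′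
  reducing-cong eq (a , b , c) =
    subst (2 ≤_) (#-cong eq) a , subst (2 ≤_) (#-cong (cong not ∘ eq)) b ,
    subst (_≤ 3) (#-cong λ e → cong₂ _∨_ (cong₂ (λ x y → x ∧ not y) (eq (p e)) (eq (q e)))
                                          (cong₂ (λ x y → x ∧ not y) (eq (q e)) (eq (p e)))) c

  reducible? : Dec (∃ Reducing)
  reducible? with searchSubset (λ S → (2 ≤? # (lookup S)) ×-dec (2 ≤? # (not ∘ lookup S)) ×-dec
                                      (# (boundary B (lookup S)) ≤? 3))
  ... | yes (S , red) = yes (lookup S , red)
  ... | no  none      = no λ (S , red) → none (tabulate S , reducing-cong (λ v → sym (lookup∘tabulate S v)) red)

  boundary-≡ : ∀ S {e} → boundary B S e ≡ false → S (p e) ≡ S (q e)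
  boundary-≡ S {e} eq with S (p e) | S (q e)
  ... | true  | true  = refl
  ... | false | false = refl

module _ {n m : ℕ} {G : FiniteGraph n m} (B : Bipartition G) (cubic : Cubic G) where
  open Bipartition B

  degree-p≡3 : ∀ e → # (λ f → p f == p e) ≡ 3
  degree-p≡3 e = trans (#-cong λ f → sym (cong (_∧ (p f == p e)) (lookup-⊤ f)))
    (trans (sym (degree-p B ⊤ (side-p e))) (cubic (p e)))

  cubic-balance : ∀ S → # (leaving B S) + 3 * # (λ v → S v ∧ not (side v)) ≡
                        # (entering B S) + 3 * # (λ v → S v ∧ side v)
  cubic-balance S = trans (cong (_+ _) (#-cong λ e → sym (cong (_∧ leaving B S e) (lookup-⊤ e))))
    (trans (balance B ⊤ cubic S) (cong (_+ _) (#-cong λ e → cong (_∧ entering B S e) (lookup-⊤ e))))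

  -- If no edge enters S, then S has exactly three leaving edges for each
  -- vertex that it has in excess on the p-side.
  boundary≤3 : ∀ S → (∀ e → S (q e) ≡ true → S (p e) ≡ true) →
               # (λ v → S v ∧ side v) ≤ suc (# (λ v → S v ∧ not (side v))) → # (boundary B S) ≤ 3
  boundary≤3 S q⇒p excess = +-cancelʳ-≤ (3 * b) _ _ (begin
    # (boundary B S) + 3 * b                ≤⟨ +-monoˡ-≤ (3 * b) (#-∨≤ (leaving B S) (entering B S)) ⟩
    (# (leaving B S) + # (entering B S)) + 3 * b
      ≡⟨ cong (λ k → (# (leaving B S) + k) + 3 * b) none ⟩
    (# (leaving B S) + 0) + 3 * b           ≡⟨ cong (_+ 3 * b) (+-identityʳ (# (leaving B S))) ⟩
    # (leaving B S) + 3 * b                 ≡⟨ cubic-balance S ⟩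
    # (entering B S) + 3 * a                ≡⟨ cong (_+ 3 * a) none ⟩
    3 * a                                   ≤⟨ *-monoʳ-≤ 3 excess ⟩
    3 * suc b                               ≡⟨ *-suc 3 b ⟩
    3 + 3 * b                               ∎)
    where
    a = # (λ v → S v ∧ side v)
    b = # (λ v → S v ∧ not (side v))
    none : # (entering B S) ≡ 0
    none = #-false λ e → ¬-not λ t → true≢false (∧-trueʳ {S (q e)} t) (cong not (q⇒p e (∧-trueˡ t)))

-- The shape of the cut in a star product. All cut edges leave `S` from the `true` class, so
-- contraction stays bipartite, and each perfect matching uses exactly one of them, as it must at
-- the contracted vertex.
record StarCut {n m : ℕ} {G : FiniteGraph n m} (B : Bipartition G) (S : Fin n → Bool) : Set where
  open Bipartition B
  field
    q⇒p      : ∀ e → S (q e) ≡ true → S (p e) ≡ true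
    size     : # (leaving B S) ≡ 3
    matching : ∀ M → PerfectMatching G M → # (λ e → lookup M e ∧ leaving B S e) ≡ 1

leaving-flip : ∀ {n m} {G : FiniteGraph n m} (B : Bipartition G) S e → leaving B S e ≡ leaving (flip B) (not ∘ S) e
leaving-flip B S e with S (Bipartition.p B e)
... | true  = sym (∧-identityʳ _)
... | false = sym (∧-zeroʳ _)

-- Exchanging the classes and passing to the complement leaves the set of leaving edges unchanged,
-- so one contraction construction serves both sides of the cut.
starCut-flip : ∀ {n m} {G : FiniteGraph n m} {B : Bipartition G} {S} → StarCut B S → StarCut (flip B) (not ∘ S)
starCut-flip {B = B} {S} cut = record
  { q⇒p = λ e ¬Sp → ¬-not-true (λ Sq → true≢false (q⇒p e Sq) (not-injective ¬Sp))
  ; size = trans (#-cong λ e → sym (leaving-flip B S e)) size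
  ; matching = λ M pm → trans (#-cong λ e → cong (lookup M e ∧_) (sym (leaving-flip B S e))) (matching M pm) }
  where
  open StarCut cut
  ¬-not-true : ∀ {b} → b ≢ true → not b ≡ true
  ¬-not-true {true}  f = contradiction refl f
  ¬-not-true {false} f = refl

data CutType (out inn a b : ℕ) : Set where
  balanced-cut : out ≡ inn → out ≤ 1 → a ≡ b → CutType out inn a b
  leaving-cut  : out ≡ 3 → inn ≡ 0 → a ≡ suc b → CutType out inn a b
  entering-cut : out ≡ 0 → inn ≡ 3 → b ≡ suc a → CutType out inn a b

-- Reduced modulo 3, the equation says that `out` and `inn` are congruent; of the ten pairs with sum
-- at most 3 only four satisfy this. Cancelling the factor 3 then relates `a` and `b`.
cutType : ∀ out inn a b → out + inn ≤ 3 → out + 3 * b ≡ inn + 3 * a → CutType out inn a b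
cutType out inn a b ≤3 eq = classify out inn ≤3 eq (mod3 out inn eq)
  where
  mod3 : ∀ x y → x + 3 * b ≡ y + 3 * a → x % 3 ≡ y % 3
  mod3 x y eq = trans (sym (reduce x b)) (trans (cong (_% 3) eq) (reduce y a))
    where
    reduce : ∀ x k → (x + 3 * k) % 3 ≡ x % 3
    reduce x k = trans (cong (λ t → (x + t) % 3) (*-comm 3 k)) ([m+kn]%n≡m%n x k 3)
  cancel : ∀ {x y} → 3 * x ≡ 3 * y → x ≡ y
  cancel = *-cancelˡ-≡ _ _ 3
  classify : ∀ x y → x + y ≤ 3 → x + 3 * b ≡ y + 3 * a → x % 3 ≡ y % 3 → CutType x y a b
  classify 0 0 _ eq _ = balanced-cut refl z≤n (cancel (sym eq))
  classify 1 1 _ eq _ = balanced-cut refl ≤-refl (cancel (sym (+-cancelˡ-≡ 1 _ _ eq)))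
  classify 3 0 _ eq _ = leaving-cut refl refl (cancel (trans (sym eq) (sym (*-suc 3 b))))
  classify 0 3 _ eq _ = entering-cut refl refl (cancel (trans eq (sym (*-suc 3 a))))
  classify 0 1 _ _ ()
  classify 0 2 _ _ ()
  classify 1 0 _ _ ()
  classify 1 2 _ _ ()
  classify 2 0 _ _ ()
  classify 2 1 _ _ ()
  classify 0 (suc (suc (suc (suc _)))) (s≤s (s≤s (s≤s ())))
  classify 1 (suc (suc (suc _))) (s≤s (s≤s (s≤s ())))
  classify 2 (suc (suc _)) (s≤s (s≤s (s≤s ())))
  classify 3 (suc _) (s≤s (s≤s (s≤s ())))
  classify (suc (suc (suc (suc _)))) _ (s≤s (s≤s (s≤s ())))

module _ {n m : ℕ} {G : FiniteGraph n m} (B : Bipartition G) (cubic : Cubic G) (tfh : TwoFactorHamiltonian G) where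
  open Bipartition B

  ∁-hamiltonian : ∀ M → PerfectMatching G M → HamiltonianCycle G (∁ M)
  ∁-hamiltonian M pm = proj₂ tfh (∁ M) (∁-regular G cubic M refl pm)

  -- The complementary 2-factor would never cross the border of `S` and so could not be a
  -- Hamiltonian cycle. In this form the 2FH property is used against balanced cuts, parallel edges
  -- and 4-cycles.
  matching-misses-cut : ∀ M → PerfectMatching G M → ∀ S → (∀ e → lookup M e ≡ false → S (p e) ≡ S (q e)) →
                        ∀ {u v} → S u ≡ true → S v ≡ false → ⊥
  matching-misses-cut M pm S same {u} {v} Su Sv = true≢false Su
    (trans (reachable-closed G {S = S} closed (proj₂ (proj₂ (∁-hamiltonian M pm)) u v)) Sv)
    where
    closed : Closed G (lookup (∁ M)) S
    closed = closed⇒ B {S = S} λ e t → same e (not-injective (trans (sym (lookup-∁ M e)) t))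

  reducing⇒starCut : ∀ S → Reducing B S → StarCut B S ⊎ StarCut (flip B) S
  reducing⇒starCut S (2≤S , 2≤∁S , ∂≤3) = result
    (cutType out inn a b (≤-trans (≤-reflexive out+inn) ∂≤3) (cubic-balance B cubic S))
    where
    out = # (leaving B S)
    inn = # (entering B S)
    a = # (λ v → S v ∧ side v)
    b = # (λ v → S v ∧ not (side v))
    in-S : ∃ λ u → S u ≡ true
    in-S = #-pick S (≤-trans (s≤s z≤n) 2≤S)
    out-S : ∃ λ v → not (S v) ≡ true
    out-S = #-pick (not ∘ S) (≤-trans (s≤s z≤n) 2≤∁S)
    exclusive : ∀ x y → (x ∧ not y) ∧ (y ∧ not x) ≡ false
    exclusive true  true  = refl
    exclusive true  false = refl
    exclusive false y     = refl
    out+inn : out + inn ≡ # (boundary B S)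
    out+inn = trans (sym (#-∨∧ (leaving B S) (entering B S)))
      (trans (cong (# (boundary B S) +_) (#-false λ e → exclusive (S (p e)) (S (q e)))) (+-identityʳ _))

    misses : ∀ M → PerfectMatching G M → (∀ e → boundary B S e ≡ true → lookup M e ≡ true) → ⊥
    misses M pm ∂⊑M = matching-misses-cut M pm S
      (λ e Me → boundary-≡ B S (¬-not λ ∂e → true≢false (∂⊑M e ∂e) Me)) (proj₂ in-S) (not-injective (proj₂ out-S))

    M₀ : ∃ λ M → PerfectMatching G M
    M₀ = let M , pm , _ = regular⇒matching B ⊤ cubic in M , pm

    -- With no cut edge any perfect matching will do. With one edge in each direction, a perfect
    -- matching through the leaving edge uses the entering one too, by `balance`, and so contains
    -- the whole cut.
    balancedCase : out ≡ inn → out ≤ 1 → a ≡ b → ⊥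
    balancedCase out≡inn out≤1 a≡b with out ≟ℕ 0
    ... | yes out≡0 = misses (proj₁ M₀) (proj₂ M₀) λ e ∂e → contradiction (≤-trans (#≥1 (boundary B S) ∂e)
          (≤-reflexive (trans (sym out+inn) (cong₂ _+_ out≡0 (trans (sym out≡inn) out≡0))))) λ ()
    ... | no out≢0 = covering (#-pick (leaving B S) (n≢0⇒n>0 out≢0)) (edge∈matching B cubic _)
      where
      covering : (f : ∃ λ e → leaving B S e ≡ true) → (∃ λ M → PerfectMatching G M × lookup M (proj₁ f) ≡ true) → ⊥
      covering f (M , pm , Mf) = misses M pm contains
       where
       outM = # (λ e → lookup M e ∧ leaving B S e)
       innM = # (λ e → lookup M e ∧ entering B S e)
       outM≡innM : outM ≡ innM
       outM≡innM = +-cancelʳ-≡ (1 * b) _ _ (trans (balance B M pm S) (cong (λ k → innM + 1 * k) a≡b))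
       g : ∃ λ e → lookup M e ∧ entering B S e ≡ true
       g = #-pick (λ e → lookup M e ∧ entering B S e) (≤-trans
         (#≥1 (λ e → lookup M e ∧ leaving B S e) (∧-true Mf (proj₂ f))) (≤-reflexive outM≡innM))
       contains : ∀ e → boundary B S e ≡ true → lookup M e ≡ true
       contains e ∂e =
         [ (λ t → subst (λ e → lookup M e ≡ true) (#≤1⇒≡ (leaving B S) out≤1 (proj₂ f) t) Mf)
         , (λ t → subst (λ e → lookup M e ≡ true)
             (#≤1⇒≡ (entering B S) (≤-trans (≤-reflexive (sym out≡inn)) out≤1) (∧-trueʳ {lookup M (proj₁ g)} (proj₂ g)) t)
             (∧-trueˡ (proj₂ g)))
         ]′ (∨-true (leaving B S e) ∂e)

    empty : ∀ {k} (c : Fin k → Bool) → # c ≡ 0 → ∀ e → c e ≡ false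
    empty c #≡0 e = ¬-not λ t → contradiction (≤-trans (#≥1 c t) (≤-reflexive #≡0)) λ ()

    ∧not : ∀ {x y} → x ≡ true → x ∧ not y ≡ false → y ≡ true
    ∧not {y = true}  _    _  = refl
    ∧not {y = false} refl ()

    -- The same balance with degree 1 in place of 3: the excess of one vertex is exactly one
    -- crossing edge of `M`.
    leavingM : inn ≡ 0 → a ≡ suc b → ∀ M → PerfectMatching G M → # (λ e → lookup M e ∧ leaving B S e) ≡ 1
    leavingM inn≡0 a≡ M pm = +-cancelʳ-≡ (1 * b) _ _ (begin-equality
      # (λ e → lookup M e ∧ leaving B S e) + 1 * b      ≡⟨ balance B M pm S ⟩
      # (λ e → lookup M e ∧ entering B S e) + 1 * a
        ≡⟨ cong (_+ 1 * a) (#-false λ e → trans (cong (lookup M e ∧_) (empty (entering B S) inn≡0 e)) (∧-zeroʳ _)) ⟩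
      1 * a                                             ≡⟨ cong (1 *_) a≡ ⟩
      1 * suc b                                         ∎)

    enteringM : out ≡ 0 → b ≡ suc a → ∀ M → PerfectMatching G M → # (λ e → lookup M e ∧ entering B S e) ≡ 1
    enteringM out≡0 b≡ M pm = +-cancelʳ-≡ (1 * a) _ _ (begin-equality
      # (λ e → lookup M e ∧ entering B S e) + 1 * a     ≡⟨ balance B M pm S ⟨
      # (λ e → lookup M e ∧ leaving B S e) + 1 * b
        ≡⟨ cong (_+ 1 * b) (#-false λ e → trans (cong (lookup M e ∧_) (empty (leaving B S) out≡0 e)) (∧-zeroʳ _)) ⟩
      1 * b                                             ≡⟨ cong (1 *_) b≡ ⟩
      1 * suc a                                         ∎)

    result : CutType out inn a b → StarCut B S ⊎ StarCut (flip B) S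
    result (balanced-cut x y z) = ⊥-elim (balancedCase x y z)
    result (leaving-cut x y z) = inj₁ record
      { q⇒p = λ e Sq → ∧not Sq (empty (entering B S) y e) ; size = x ; matching = leavingM y z }
    result (entering-cut x y z) = inj₂ record
      { q⇒p = λ e Sp → ∧not Sp (empty (leaving B S) x e) ; size = y ; matching = enteringM x z }

-- Contracting one side of a 3-edge cut

module EnumerationProperties {n k : ℕ} {b : Fin n → Bool} (En : Enumeration b k) where
  open Enumeration En

  #-elem : ∀ c → # (c ∘ elem) ≡ # (λ x → b x ∧ c x)
  #-elem c = begin-equality
    # (λ i → c (elem i))                          ≡⟨ #-cong (λ i → cong (_∧ c (elem i)) (sym (elem-true i))) ⟩
    # (λ i → b (elem i) ∧ c (elem i))             ≡⟨ #-fibres elem (λ _ → true) (λ x → b x ∧ c x) 1 fibre ⟩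
    1 * # (λ x → b x ∧ c x)                       ≡⟨ *-identityˡ _ ⟩
    # (λ x → b x ∧ c x)                           ∎
    where
    fibre : ∀ x → b x ∧ c x ≡ true → # (λ i → elem i == x) ≡ 1
    fibre x t with i , refl ← index x (∧-trueˡ t) = #-unique _ (==-refl (elem i)) λ j eq → elem-injective (==⇒≡ eq)

  extend : (Fin k → Bool) → Fin n → Bool
  extend f x = does (any? λ i → ((elem i == x) ∧ f i) ≟ᵇ true)

  extend-elem : ∀ f i → extend f (elem i) ≡ f i
  extend-elem f i with any? (λ j → ((elem j == elem i) ∧ f j) ≟ᵇ true)
  ... | yes (j , t) = trans (sym (∧-trueʳ {elem j == elem i} t)) (cong f (elem-injective (==⇒≡ (∧-trueˡ t))))
  ... | no none = sym (¬-not λ fi → none (i , ∧-true (==-refl (elem i)) fi))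

-- In the contraction `zero` is the collapsed complement of `S` and `suc i` a vertex of `S`. No edge
-- enters `S`, so the edges that survive are exactly those whose `p`-end lies in `S`. `K` fixes an
-- order of the cut edges that both contractions can share.
module Contraction {n m : ℕ} {G : FiniteGraph n m} (B : Bipartition G) (S : Fin n → Bool) (cut : StarCut B S)
                   (K : Enumeration (leaving B S) 3) (out : ∃ λ v → S v ≡ false) where
  open Bipartition B
  open StarCut cut

  k m₁ : ℕ
  k = # S
  m₁ = # (S ∘ p)

  abstract
    Vs : Enumeration S k
    Vs = enumerate S k refl

    Es : Enumeration (S ∘ p) m₁
    Es = enumerate (S ∘ p) m₁ refl

  module Vs = Enumeration Vs
  module Es = Enumeration Es
  module K = Enumeration K

  abstract
    φ′ : ∀ v b → S v ≡ b → Fin (suc k)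
    φ′ v true  Sv = suc (proj₁ (Vs.index v Sv))
    φ′ v false _  = zero

    φ : Fin n → Fin (suc k)
    φ v = φ′ v (S v) refl

    φ-out : ∀ {v} → S v ≡ false → φ v ≡ zero
    φ-out {v} Sv = aux (S v) refl
      where
      aux : ∀ b (eq : S v ≡ b) → φ′ v b eq ≡ zero
      aux true  eq = contradiction Sv (true≢false eq)
      aux false eq = refl

    φ-in : ∀ {v} → S v ≡ true → ∃ λ i → φ v ≡ suc i × Vs.elem i ≡ v
    φ-in {v} Sv = aux (S v) refl
      where
      aux : ∀ b (eq : S v ≡ b) → ∃ λ i → φ′ v b eq ≡ suc i × Vs.elem i ≡ v
      aux true  eq = _ , refl , proj₂ (Vs.index v eq)
      aux false eq = contradiction eq (true≢false Sv)

  φ-elem : ∀ i → φ (Vs.elem i) ≡ suc i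
  φ-elem i with j , eq , eq′ ← φ-in (Vs.elem-true i) = trans eq (cong suc (Vs.elem-injective eq′))

  φ-injective : ∀ {u v} → S u ≡ true → φ u ≡ φ v → u ≡ v
  φ-injective {u} {v} Su eq with φ-in Su | S v in Sv
  ... | i , eq₁ , refl | false with () ← trans (sym eq₁) (trans eq (φ-out Sv))
  ... | i , eq₁ , refl | true with j , eq₂ , refl ← φ-in Sv =
    cong Vs.elem (suc-injectiveᶠ (trans (sym eq₁) (trans eq eq₂)))

  φ≢0 : ∀ {v} → S v ≡ true → φ v ≢ zero
  φ≢0 Sv eq with i , eq₁ , _ ← φ-in Sv with () ← trans (sym eq₁) eq

  p≢q : ∀ e → p e ≢ q e
  p≢q e eq = true≢false (side-p e) (trans (cong side eq) (side-q e))

  G₁ : FiniteGraph (suc k) m₁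
  G₁ = record
    { ends     = λ i → φ (p (Es.elem i)) , φ (q (Es.elem i))
    ; loopless = λ i eq → p≢q (Es.elem i) (φ-injective (Es.elem-true i) eq) }

  -- Cut edges have their `q`-end outside `S`, which forces the collapsed vertex into the class
  -- `false`.
  side₁ : Fin (suc k) → Bool
  side₁ zero    = false
  side₁ (suc i) = side (Vs.elem i)

  side₁-in : ∀ {v} → S v ≡ true → side₁ (φ v) ≡ side v
  side₁-in Sv with i , eq , refl ← φ-in Sv = cong side₁ eq

  side₁-q : ∀ e → side₁ (φ (q e)) ≡ false
  side₁-q e with S (q e) in Sq
  ... | true  = trans (side₁-in Sq) (side-q e)
  ... | false = cong side₁ (φ-out Sq)

  B₁ : Bipartition G₁
  B₁ = record
    { side = side₁ ; p = λ i → φ (p (Es.elem i)) ; q = λ i → φ (q (Es.elem i)) ; joins = λ i → inj₁ refl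
    ; side-p = λ i → trans (side₁-in (Es.elem-true i)) (side-p (Es.elem i))
    ; side-q = λ i → side₁-q (Es.elem i) }

  bipartite : Bipartite G₁
  bipartite = side₁ , λ i eq → true≢false (Bipartition.side-p B₁ i) (trans eq (Bipartition.side-q B₁ i))

  ==-φ : ∀ {u v} → S v ≡ true → (φ u == φ v) ≡ (u == v)
  ==-φ {u} {v} Sv with u ≟ v
  ... | yes refl = trans (==-refl (φ u)) (sym (==-refl u))
  ... | no  u≢v  = trans (≢⇒== λ eq → u≢v (sym (φ-injective Sv (sym eq)))) (sym (≢⇒== u≢v))

  inc-φ : ∀ i {v} → S v ≡ true → inc G₁ i (φ v) ≡ inc G (Es.elem i) v
  inc-φ i Sv = trans (cong₂ _∨_ (==-φ Sv) (==-φ Sv)) (sym (inc≡∨ B (Es.elem i) _))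

  inc-zero : ∀ i → inc G₁ i zero ≡ not (S (q (Es.elem i)))
  inc-zero i rewrite ≢⇒== (φ≢0 (Es.elem-true i)) with S (q (Es.elem i)) in Sq
  ... | true  = ≢⇒== (φ≢0 Sq)
  ... | false = ≡⇒== (φ-out Sq)

  -- Hence no edge at a vertex of `S` is lost in the contraction, and degrees there are preserved.
  inc⇒p∈S : ∀ e {v} → S v ≡ true → inc G e v ≡ true → S (p e) ≡ true
  inc⇒p∈S e Sv ev with ∨-true (p e == _) (trans (sym (inc≡∨ B e _)) ev)
  ... | inj₁ eq = trans (cong S (==⇒≡ eq)) Sv
  ... | inj₂ eq = q⇒p e (trans (cong S (==⇒≡ eq)) Sv)

  Restricts : Subset m → Subset m₁ → Set
  Restricts F F₁ = ∀ i → lookup F (Es.elem i) ≡ lookup F₁ i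

  degree-φ : ∀ F F₁ → Restricts F F₁ → ∀ {v} → S v ≡ true → degree G₁ F₁ (φ v) ≡ degree G F v
  degree-φ F F₁ res {v} Sv = begin-equality
    degree G₁ F₁ (φ v)                                 ≡⟨ degree≡# G₁ F₁ (φ v) ⟩
    # (at G₁ F₁ (φ v))                                 ≡⟨ #-cong (λ i → cong₂ _∧_ (sym (res i)) (inc-φ i Sv)) ⟩
    # (at G F v ∘ Es.elem)                             ≡⟨ EnumerationProperties.#-elem Es (at G F v) ⟩
    # (λ e → S (p e) ∧ at G F v e)                     ≡⟨ #-cong pointwise ⟩
    # (at G F v)                                       ≡⟨ degree≡# G F v ⟨
    degree G F v                                       ∎
    where
    pointwise : ∀ e → S (p e) ∧ at G F v e ≡ at G F v e
    pointwise e with S (p e) in Sp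
    ... | true  = refl
    ... | false = sym (¬-not λ t → true≢false (inc⇒p∈S e Sv (∧-trueʳ {lookup F e} t)) Sp)

  degree-zero : ∀ F F₁ → Restricts F F₁ → degree G₁ F₁ zero ≡ # (λ e → lookup F e ∧ leaving B S e)
  degree-zero F F₁ res = begin-equality
    degree G₁ F₁ zero                                  ≡⟨ degree≡# G₁ F₁ zero ⟩
    # (at G₁ F₁ zero)                                  ≡⟨ #-cong (λ i → cong₂ _∧_ (sym (res i)) (inc-zero i)) ⟩
    # (λ i → lookup F (Es.elem i) ∧ not (S (q (Es.elem i))))
      ≡⟨ EnumerationProperties.#-elem Es (λ e → lookup F e ∧ not (S (q e))) ⟩
    # (λ e → S (p e) ∧ (lookup F e ∧ not (S (q e))))   ≡⟨ #-cong (λ e → shuffle (S (p e)) (lookup F e) (not (S (q e)))) ⟩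
    # (λ e → lookup F e ∧ leaving B S e)               ∎
    where
    shuffle : ∀ a b c → a ∧ (b ∧ c) ≡ b ∧ (a ∧ c)
    shuffle true  b c = refl
    shuffle false b c = sym (∧-zeroʳ b)

  regular-φ : ∀ {d} F F₁ → Restricts F F₁ → Regular G d F → # (λ e → lookup F e ∧ leaving B S e) ≡ d → Regular G₁ d F₁
  regular-φ F F₁ res reg cut zero    = trans (degree-zero F F₁ res) cut
  regular-φ F F₁ res reg cut (suc i) =
    trans (cong (degree G₁ F₁) (sym (φ-elem i))) (trans (degree-φ F F₁ res (Vs.elem-true i)) (reg (Vs.elem i)))

  lift : Fin (suc k) → Fin n
  lift zero    = proj₁ out
  lift (suc i) = Vs.elem i

  φ-lift : ∀ x → φ (lift x) ≡ x
  φ-lift zero    = φ-out (proj₂ out)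
  φ-lift (suc i) = φ-elem i

  adjacent-φ : ∀ F F₁ → Restricts F F₁ → ∀ {u v} → Adjacent G F u v → Reachable G₁ F₁ (φ u) (φ v)
  adjacent-φ F F₁ res {u} {v} (e , e∈F , j) with S (p e) in Sp
  ... | true with i , refl ← Es.index e Sp =
    adjacent G₁ {F₁} (trans (sym (res i)) ([]=⇒lookup e∈F)) (orient (joins (Es.elem i)) j) ◅ ε
    where
    orient : ∀ {e x y u v} → Joins G e x y → Joins G e u v →
             (φ x , φ y) ≡ (φ u , φ v) ⊎ (φ x , φ y) ≡ (φ v , φ u)
    orient (inj₁ a) (inj₁ b) with refl ← trans (sym a) b = inj₁ refl
    orient (inj₁ a) (inj₂ b) with refl ← trans (sym a) b = inj₂ refl
    orient (inj₂ a) (inj₁ b) with refl ← trans (sym a) b = inj₂ refl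
    orient (inj₂ a) (inj₂ b) with refl ← trans (sym a) b = inj₁ refl
  -- An edge whose `p`-end is outside `S` lies outside `S` altogether; it collapses to `zero` and
  -- contributes the empty path.
  ... | false = subst (Reachable G₁ F₁ (φ u)) (trans (φ-out (outside (inc-joinsˡ G j))) (sym (φ-out (outside (inc-joinsʳ G j))))) ε
    where
    outside : ∀ {w} → inc G e w ≡ true → S w ≡ false
    outside ew = ¬-not λ Sw → true≢false (inc⇒p∈S e Sw ew) Sp

  reachable-φ : ∀ F F₁ → Restricts F F₁ → ∀ {u v} → Reachable G F u v → Reachable G₁ F₁ (φ u) (φ v)
  reachable-φ F F₁ res ε       = ε
  reachable-φ F F₁ res (a ◅ r) = adjacent-φ F F₁ res a ◅◅ reachable-φ F F₁ res r

  connected-φ : ∀ F F₁ → Restricts F F₁ → SpanningConnected G F → SpanningConnected G₁ F₁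
  connected-φ F F₁ res (_ , conn) = zero , λ x y →
    subst₂ (Reachable G₁ F₁) (φ-lift x) (φ-lift y) (reachable-φ F F₁ res (conn (lift x) (lift y)))

  restricts-⊤ : Restricts ⊤ ⊤
  restricts-⊤ i = trans (lookup-⊤ (Es.elem i)) (sym (lookup-⊤ i))

  connected : Connected G → Connected G₁
  connected = connected-φ ⊤ ⊤ restricts-⊤

  cubic₁ : Cubic G → Cubic G₁
  cubic₁ cubic = regular-φ ⊤ ⊤ restricts-⊤ cubic (trans (#-cong λ e → cong (_∧ leaving B S e) (lookup-⊤ e)) size)

  -- A 2-factor F₁ of the contraction misses exactly one cut edge z; outside S
  -- it is continued by the complement of a perfect matching through z.
  module _ (cubic : Cubic G) (tfh : TwoFactorHamiltonian G) (F₁ : Subset m₁) (tf₁ : TwoFactor G₁ F₁) where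

    ∁F₁-zero : # (at G₁ (∁ F₁) zero) ≡ 1
    ∁F₁-zero = trans (sym (degree≡# G₁ (∁ F₁) zero)) (∁-regular G₁ (cubic₁ cubic) F₁ refl tf₁ zero)

    module Glue (z : Fin m₁) (z∉F₁ : at G₁ (∁ F₁) zero z ≡ true)
                (M : Subset m) (pm : PerfectMatching G M) (z∈M : lookup M (Es.elem z) ≡ true) where

      glue : Fin m → Bool
      glue e = if S (p e) then EnumerationProperties.extend Es (lookup F₁) e else not (lookup M e)

      F : Subset m
      F = tabulate glue

      restricts : Restricts F F₁
      restricts i = trans (lookup∘tabulate glue (Es.elem i))
        (trans (cong (λ b → if b then EnumerationProperties.extend Es (lookup F₁) (Es.elem i) else not (lookup M (Es.elem i))) (Es.elem-true i)) (EnumerationProperties.extend-elem Es (lookup F₁) i))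

      z-leaving : leaving B S (Es.elem z) ≡ true
      z-leaving = ∧-true (Es.elem-true z) (trans (sym (inc-zero z)) (∧-trueʳ {lookup (∁ F₁) z} z∉F₁))

      -- `z` is the only cut edge missing from `F₁` and the only one in `M`, so both rules of `glue`
      -- give the same answer on the cut.
      cut-edges : ∀ i → S (q (Es.elem i)) ≡ false → lookup F₁ i ≡ not (lookup M (Es.elem i))
      cut-edges i Sq with i ≟ z
      ... | yes refl = trans (not-injective (trans (sym (lookup-∁ F₁ z)) (∧-trueˡ z∉F₁))) (cong not (sym z∈M))
      ... | no  i≢z  = trans F₁i (cong not (sym Mi))
        where
        F₁i : lookup F₁ i ≡ true
        F₁i = ¬-not λ ¬F₁i → i≢z (#≤1⇒≡ (at G₁ (∁ F₁) zero) (≤-reflexive ∁F₁-zero)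
          (∧-true (trans (lookup-∁ F₁ i) (cong not ¬F₁i)) (trans (inc-zero i) (cong not Sq))) z∉F₁)
        Mi : lookup M (Es.elem i) ≡ false
        Mi = ¬-not λ t → i≢z (Es.elem-injective (#≤1⇒≡ (λ e → lookup M e ∧ leaving B S e)
          (≤-reflexive (matching M pm)) (∧-true t (∧-true (Es.elem-true i) (cong not Sq))) (∧-true z∈M z-leaving)))

      agrees-outside : ∀ e {v} → S v ≡ false → inc G e v ≡ true → glue e ≡ not (lookup M e)
      agrees-outside e {v} Sv ev with S (p e) in Sp
      ... | false = refl
      ... | true with i , refl ← Es.index e Sp =
        trans (EnumerationProperties.extend-elem Es (lookup F₁) i) (cut-edges i Sq)
        where
        Sq : S (q (Es.elem i)) ≡ false
        Sq with ∨-true (p (Es.elem i) == v) (trans (sym (inc≡∨ B (Es.elem i) v)) ev)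
        ... | inj₁ eq = contradiction (trans (cong S (==⇒≡ eq)) Sv) (true≢false Sp)
        ... | inj₂ eq = trans (cong S (==⇒≡ eq)) Sv

      twoFactor : TwoFactor G F
      twoFactor v = aux (S v) refl
        where
        aux : ∀ b → S v ≡ b → degree G F v ≡ 2
        aux true  Sv = trans (sym (degree-φ F F₁ restricts Sv)) (tf₁ (φ v))
        aux false Sv = trans (degree-cong G {F} {∁ M} v λ e ev →
          trans (lookup∘tabulate glue e) (trans (agrees-outside e Sv ev) (sym (lookup-∁ M e))))
          (∁-regular G cubic M refl pm v)

      -- The glued 2-factor is a Hamiltonian cycle of `G`, and connectedness survives the
      -- contraction.
      hamiltonian : HamiltonianCycle G₁ F₁
      hamiltonian = tf₁ , connected-φ F F₁ restricts (proj₂ (proj₂ tfh F twoFactor))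

    hamiltonian : HamiltonianCycle G₁ F₁
    hamiltonian = aux (#-pick (at G₁ (∁ F₁) zero) (≤-reflexive (sym ∁F₁-zero)))
      where
      aux : (∃ λ z → at G₁ (∁ F₁) zero z ≡ true) → HamiltonianCycle G₁ F₁
      aux (z , z∉F₁) = aux′ (edge∈matching B cubic (Es.elem z))
        where
        aux′ : (∃ λ M → PerfectMatching G M × lookup M (Es.elem z) ≡ true) → HamiltonianCycle G₁ F₁
        aux′ (M , pm , z∈M) = Glue.hamiltonian z z∉F₁ M pm z∈M

  twoFactorHamiltonian₁ : Cubic G → TwoFactorHamiltonian G → TwoFactorHamiltonian G₁
  twoFactorHamiltonian₁ cubic tfh = exists (regular⇒matching B₁ ⊤ (cubic₁ cubic)) , hamiltonian cubic tfh
    where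
    exists : (∃ λ M → PerfectMatching G₁ M × lookup M ⊑ lookup ⊤) → ∃ (HamiltonianCycle G₁)
    exists (M , pm , _) = ∁ M , hamiltonian cubic tfh (∁ M) (∁-regular G₁ (cubic₁ cubic) M refl pm)

  ¬theta : 2 ≤ k → ¬ (G₁ ≅ theta)
  ¬theta 2≤k iso = <⇒≱ (s≤s 2≤k) (injective⇒≤ (to-injective (_≅_.vertices iso)))

  K-index : ∀ i → ∃ λ j → Es.elem j ≡ K.elem i
  K-index i = Es.index (K.elem i) (∧-trueˡ (K.elem-true i))

  q∉S : ∀ i → S (q (K.elem i)) ≡ false
  q∉S i = not-injective (∧-trueʳ {S (p (K.elem i))} (K.elem-true i))

  incident-zero : ∀ {j} → S (q (Es.elem j)) ≡ false → Incident G₁ j zero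
  incident-zero Sq = inj₂ (φ-out Sq)

  incident-zero⁻ : ∀ {j} → Incident G₁ j zero → S (q (Es.elem j)) ≡ false
  incident-zero⁻ {j} (inj₁ eq) = contradiction eq (φ≢0 (Es.elem-true j))
  incident-zero⁻     (inj₂ eq) = ¬-not λ Sq → φ≢0 Sq eq

  claw : Claw G₁ zero
  claw = record
    { edge           = λ i → proj₁ (K-index i)
    ; neighbour      = λ i → φ (p (K.elem i))
    ; edge-injective = λ {i} {j} eq → K.elem-injective
        (trans (sym (proj₂ (K-index i))) (trans (cong Es.elem eq) (proj₂ (K-index j))))
    ; edge-joins     = λ i → inj₂ (cong₂ _,_ (cong (φ ∘ p) (proj₂ (K-index i)))
                               (trans (cong (φ ∘ q) (proj₂ (K-index i))) (φ-out (q∉S i))))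
    ; complete       = complete
    }
    where
    complete : ∀ j → Incident G₁ j zero → ∃ λ i → proj₁ (K-index i) ≡ j
    complete j inc with i , eq ← K.index (Es.elem j) (∧-true (Es.elem-true j) (cong not (incident-zero⁻ inc)))
      = i , Es.elem-injective (trans (proj₂ (K-index i)) eq)

  unlift : ∃ {A = Fin (suc k)} (_≢ zero) → Fin n
  unlift (zero  , ≢0) = contradiction refl ≢0
  unlift (suc i , _)  = Vs.elem i

  unlift-true : ∀ x → S (unlift x) ≡ true
  unlift-true (zero  , ≢0) = contradiction refl ≢0
  unlift-true (suc i , _)  = Vs.elem-true i

  unlift-injective : ∀ {x y} → unlift x ≡ unlift y → x ≡ y
  unlift-injective {zero  , ≢0} {_}          _  = contradiction refl ≢0
  unlift-injective {suc _ , _}  {zero , ≢0}  _  = contradiction refl ≢0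
  unlift-injective {suc i , _}  {suc j , _}  eq with refl ← Vs.elem-injective eq = refl

  unlift-surjective : ∀ v → S v ≡ true → ∃ λ x → unlift x ≡ v
  unlift-surjective v Sv with i , eq ← Vs.index v Sv = (suc i , λ ()) , eq

  unlift-φ : ∀ {v} (φv≢0 : φ v ≢ zero) → unlift (φ v , φv≢0) ≡ v
  unlift-φ {v} φv≢0 with S v in Sv
  ... | false = contradiction (φ-out Sv) φv≢0
  ... | true with i , eq , refl ← φ-in Sv = aux φv≢0 eq
    where
    aux : ∀ {x} (x≢0 : x ≢ zero) → x ≡ suc i → unlift (x , x≢0) ≡ Vs.elem i
    aux _ refl = refl

-- Reassembling a graph from its two contractions

isoFrom : ∀ {V E V′ E′ : Set} {G : Multigraph V E} {H : Multigraph V′ E′} (fᵥ : V′ → V) (fₑ : E′ → E) →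
  Injective _≡_ _≡_ fᵥ → (∀ v → ∃ λ x → fᵥ x ≡ v) → Injective _≡_ _≡_ fₑ → (∀ e → ∃ λ x → fₑ x ≡ e) →
  (∀ x → Joins G (fₑ x) (fᵥ (proj₁ (ends H x))) (fᵥ (proj₂ (ends H x)))) → G ≅ H
isoFrom {G = G} {H} fᵥ fₑ injᵥ surjᵥ injₑ surjₑ js = record
  { vertices = mk↔ₛ′ toᵥ fᵥ (λ x → injᵥ (proj₂ (surjᵥ (fᵥ x)))) (λ v → proj₂ (surjᵥ v))
  ; edges    = mk↔ₛ′ (λ e → proj₁ (surjₑ e)) fₑ (λ x → injₑ (proj₂ (surjₑ (fₑ x)))) (λ e → proj₂ (surjₑ e))
  ; joins    = λ e → lemma (subst (λ e → Joins G e _ _) (proj₂ (surjₑ e)) (js (proj₁ (surjₑ e)))) }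
  where
  toᵥ = λ v → proj₁ (surjᵥ v)
  back : ∀ {v x} → v ≡ fᵥ x → x ≡ toᵥ v
  back {v} eq = injᵥ (trans (sym eq) (sym (proj₂ (surjᵥ v))))
  lemma : ∀ {e x} → Joins G e (fᵥ (proj₁ (ends H x))) (fᵥ (proj₂ (ends H x))) →
          Joins H x (toᵥ (proj₁ (ends G e))) (toᵥ (proj₂ (ends G e)))
  lemma (inj₁ eq) = inj₁ (cong₂ _,_ (back (cong proj₁ eq)) (back (cong proj₂ eq)))
  lemma (inj₂ eq) = inj₂ (cong₂ _,_ (back (cong proj₂ eq)) (back (cong proj₁ eq)))

enumeration-cong : ∀ {n k} {b c : Fin n → Bool} → (∀ x → b x ≡ c x) → Enumeration b k → Enumeration c k
enumeration-cong eq En = record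
  { elem = elem ; elem-true = λ i → trans (sym (eq (elem i))) (elem-true i)
  ; elem-injective = elem-injective ; index = λ x cx → index x (trans (eq x) cx) }
  where open Enumeration En

module Decomposition {n m : ℕ} {G : FiniteGraph n m} (B : Bipartition G) (S : Fin n → Bool) (cut : StarCut B S)
                     (inside : ∃ λ v → S v ≡ true) (outside : ∃ λ v → S v ≡ false) where
  open Bipartition B
  open StarCut cut

  abstract
    K : Enumeration (leaving B S) 3
    K = enumerate (leaving B S) 3 size

  module C₁ = Contraction B S cut K outside
  -- The list `K` is reused, so that the claws of the two contractions pair the two halves of the
  -- same cut edge.
  module C₂ = Contraction (flip B) (not ∘ S) (starCut-flip cut) (enumeration-cong (leaving-flip B S) K)
                (proj₁ inside , cong not (proj₂ inside))
  open Enumeration K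

  ★ : Multigraph _ _
  ★ = starProduct C₁.G₁ zero C₁.claw C₂.G₁ zero C₂.claw

  V★ E★ : Set
  V★ = ∃ {A = Fin (suc C₁.k)} (_≢ zero) ⊎ ∃ {A = Fin (suc C₂.k)} (_≢ zero)
  E★ = (∃ λ e → ¬ Incident C₁.G₁ e zero) ⊎ (∃ λ e → ¬ Incident C₂.G₁ e zero) ⊎ Fin 3

  fromᵥ : V★ → Fin n
  fromᵥ (inj₁ x) = C₁.unlift x
  fromᵥ (inj₂ x) = C₂.unlift x

  fromₑ : E★ → Fin m
  fromₑ (inj₁ (i , _))        = C₁.Es.elem i
  fromₑ (inj₂ (inj₁ (i , _))) = C₂.Es.elem i
  fromₑ (inj₂ (inj₂ i))       = elem i

  S-right : ∀ x → S (C₂.unlift x) ≡ false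
  S-right x = not-injective (C₂.unlift-true x)

  fromᵥ-injective : Injective _≡_ _≡_ fromᵥ
  fromᵥ-injective {inj₁ x} {inj₁ y} eq = cong inj₁ (C₁.unlift-injective eq)
  fromᵥ-injective {inj₁ x} {inj₂ y} eq = contradiction (trans (cong S eq) (S-right y)) (true≢false (C₁.unlift-true x))
  fromᵥ-injective {inj₂ x} {inj₁ y} eq = contradiction (trans (sym (cong S eq)) (S-right x)) (true≢false (C₁.unlift-true y))
  fromᵥ-injective {inj₂ x} {inj₂ y} eq = cong inj₂ (C₂.unlift-injective eq)

  fromᵥ-surjective : ∀ v → ∃ λ x → fromᵥ x ≡ v
  fromᵥ-surjective v with S v in Sv
  ... | true  with x , eq ← C₁.unlift-surjective v Sv            = inj₁ x , eq
  ... | false with x , eq ← C₂.unlift-surjective v (cong not Sv) = inj₂ x , eq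

  inside-q : ∀ i → ¬ Incident C₁.G₁ i zero → S (q (C₁.Es.elem i)) ≡ true
  inside-q i ¬inc with S (q (C₁.Es.elem i)) in Sq
  ... | true  = refl
  ... | false = contradiction (C₁.incident-zero Sq) ¬inc

  outside-p : ∀ i → ¬ Incident C₂.G₁ i zero → S (p (C₂.Es.elem i)) ≡ false
  outside-p i ¬inc with S (p (C₂.Es.elem i)) in Sp
  ... | false = refl
  ... | true  = contradiction (C₂.incident-zero (cong not Sp)) ¬inc

  -- Together with `side-of-q` this tells the three kinds of edges apart by which of their ends lie
  -- in `S`. The fourth combination would be an edge entering `S`, and there is none.
  side-of-p : E★ → Bool
  side-of-p (inj₂ (inj₁ _)) = false
  side-of-p _               = true

  side-of-q : E★ → Bool
  side-of-q (inj₁ _) = true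
  side-of-q _        = false

  S-p : ∀ x → S (p (fromₑ x)) ≡ side-of-p x
  S-p (inj₁ (i , _))        = C₁.Es.elem-true i
  S-p (inj₂ (inj₁ (i , h))) = outside-p i h
  S-p (inj₂ (inj₂ i))       = ∧-trueˡ (elem-true i)

  S-q : ∀ x → S (q (fromₑ x)) ≡ side-of-q x
  S-q (inj₁ (i , h))        = inside-q i h
  S-q (inj₂ (inj₁ (i , _))) = not-injective (C₂.Es.elem-true i)
  S-q (inj₂ (inj₂ i))       = C₁.q∉S i

  fromₑ-injective : Injective _≡_ _≡_ fromₑ
  fromₑ-injective {x} {y} eq =
    aux x y eq (trans (sym (S-p x)) (trans (cong (S ∘ p) eq) (S-p y)))
               (trans (sym (S-q x)) (trans (cong (S ∘ q) eq) (S-q y)))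
    where
    aux : ∀ x y → fromₑ x ≡ fromₑ y → side-of-p x ≡ side-of-p y → side-of-q x ≡ side-of-q y → x ≡ y
    aux (inj₁ (i , _))        (inj₁ (j , _))        eq _ _ with refl ← C₁.Es.elem-injective eq = refl
    aux (inj₂ (inj₁ (i , _))) (inj₂ (inj₁ (j , _))) eq _ _ with refl ← C₂.Es.elem-injective eq = refl
    aux (inj₂ (inj₂ i))       (inj₂ (inj₂ j))       eq _ _ = cong (inj₂ ∘ inj₂) (elem-injective eq)
    aux (inj₁ _)        (inj₂ (inj₁ _)) _ ()
    aux (inj₁ _)        (inj₂ (inj₂ _)) _ _ ()
    aux (inj₂ (inj₁ _)) (inj₁ _)        _ ()
    aux (inj₂ (inj₁ _)) (inj₂ (inj₂ _)) _ ()
    aux (inj₂ (inj₂ _)) (inj₁ _)        _ _ ()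
    aux (inj₂ (inj₂ _)) (inj₂ (inj₁ _)) _ ()

  fromₑ-surjective : ∀ e → ∃ λ x → fromₑ x ≡ e
  fromₑ-surjective e = aux (S (p e)) (S (q e)) refl refl
    where
    aux : ∀ a b → S (p e) ≡ a → S (q e) ≡ b → ∃ λ x → fromₑ x ≡ e
    aux true  true  Sp Sq = let i , eq = C₁.Es.index e Sp in
      inj₁ (i , λ inc → true≢false Sq (trans (cong (S ∘ q) (sym eq)) (C₁.incident-zero⁻ inc))) , eq
    aux true  false Sp Sq = let i , eq = index e (∧-true Sp (cong not Sq)) in inj₂ (inj₂ i) , eq
    aux false true  Sp Sq = contradiction (q⇒p e Sq) λ Sp′ → true≢false Sp′ Sp
    aux false false Sp Sq = let i , eq = C₂.Es.index e (cong not Sq) in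
      inj₂ (inj₁ (i , λ inc → true≢false (cong not Sp) (trans (cong (not ∘ S ∘ p) (sym eq)) (C₂.incident-zero⁻ inc)))) , eq

  from-joins : ∀ x → Joins G (fromₑ x) (fromᵥ (proj₁ (ends ★ x))) (fromᵥ (proj₂ (ends ★ x)))
  from-joins (inj₁ (i , _)) =
    subst₂ (Joins G _) (sym (C₁.unlift-φ _)) (sym (C₁.unlift-φ _)) (joins (C₁.Es.elem i))
  from-joins (inj₂ (inj₁ (i , _))) =
    subst₂ (Joins G _) (sym (C₂.unlift-φ _)) (sym (C₂.unlift-φ _)) (joins-sym G (joins (C₂.Es.elem i)))
  from-joins (inj₂ (inj₂ i)) =
    subst₂ (Joins G _) (sym (C₁.unlift-φ _)) (sym (C₂.unlift-φ _)) (joins (elem i))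

  decomposition : G ≅ ★
  decomposition = isoFrom fromᵥ fromₑ fromᵥ-injective fromᵥ-surjective fromₑ-injective fromₑ-surjective from-joins

-- Recognising theta, K₃,₃ and the Heawood graph

isoBipartite : ∀ {n m a b m′} {G : FiniteGraph n m} (B : Bipartition G)
  (U : Enumeration (Bipartition.side B) a) (W : Enumeration (not ∘ Bipartition.side B) b) (f : Fin m′ → Fin a × Fin b) (g : Fin m′ → Fin m) →
  Injective _≡_ _≡_ g → (∀ e → ∃ λ x → g x ≡ e) →
  (∀ x → Enumeration.elem U (proj₁ (f x)) ≡ Bipartition.p B (g x) ×
         Enumeration.elem W (proj₂ (f x)) ≡ Bipartition.q B (g x)) →
  G ≅ bipartiteGraph f
isoBipartite {n} {a = a} {b} {G = G} B U W f g g-inj g-surj ends≡ =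
  isoFrom vertex g (λ {x} {y} → vertex-injective x y) vertex-surjective g-inj g-surj joins′
  where
  open Bipartition B
  module U = Enumeration U
  module W = Enumeration W
  place : Fin a ⊎ Fin b → Fin n
  place = [ U.elem , W.elem ]′
  vertex : Fin (a + b) → Fin n
  vertex = place ∘ splitAt a
  side-W : ∀ j → side (W.elem j) ≡ false
  side-W j = not-injective (W.elem-true j)
  place-injective : ∀ s t → place s ≡ place t → s ≡ t
  place-injective (inj₁ i) (inj₁ j) eq = cong inj₁ (U.elem-injective eq)
  place-injective (inj₁ i) (inj₂ j) eq = contradiction (trans (cong side eq) (side-W j)) (true≢false (U.elem-true i))
  place-injective (inj₂ i) (inj₁ j) eq = contradiction (trans (cong side (sym eq)) (side-W i)) (true≢false (U.elem-true j))
  place-injective (inj₂ i) (inj₂ j) eq = cong inj₂ (W.elem-injective eq)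
  vertex-injective : ∀ x y → vertex x ≡ vertex y → x ≡ y
  vertex-injective x y eq = trans (sym (join-splitAt a b x))
    (trans (cong (join a b) (place-injective (splitAt a x) (splitAt a y) eq)) (join-splitAt a b y))
  vertex-surjective : ∀ v → ∃ λ x → vertex x ≡ v
  vertex-surjective v with side v in sv
  ... | true  with i , eq ← U.index v sv = i ↑ˡ b , trans (cong place (splitAt-↑ˡ a i b)) eq
  ... | false with j , eq ← W.index v (cong not sv) = a ↑ʳ j , trans (cong place (splitAt-↑ʳ a b j)) eq
  joins′ : ∀ x → Joins G (g x) (vertex (proj₁ (f x) ↑ˡ b)) (vertex (a ↑ʳ proj₂ (f x)))
  joins′ x = subst₂ (Joins G (g x))
    (trans (sym (proj₁ (ends≡ x))) (sym (cong place (splitAt-↑ˡ a (proj₁ (f x)) b))))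
    (trans (sym (proj₂ (ends≡ x))) (sym (cong place (splitAt-↑ʳ a b (proj₂ (f x))))))
    (joins (g x))

injective⇒bijective : ∀ {k l} → k ≡ l → (h : Fin k → Fin l) → Injective _≡_ _≡_ h →
  ∃ λ (g : Fin l → Fin k) → (∀ y → h (g y) ≡ y) × (∀ x → g (h x) ≡ x)
injective⇒bijective refl h inj = (λ y → proj₁ (surj y)) , (λ y → proj₂ (surj y)) , λ x → inj (proj₂ (surj (h x)))
  where surj = injective⇒surjective h inj

inverse-injective : ∀ {A B : Set} (g : B → A) (h : A → B) → (∀ y → h (g y) ≡ y) → Injective _≡_ _≡_ g
inverse-injective g h hg {x} {y} eq = trans (sym (hg x)) (trans (cong h eq) (hg y))

#-not : ∀ {n} (b : Fin n → Bool) → # b + # (not ∘ b) ≡ n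
#-not {n} b = trans (sym (#-split (λ _ → true) b)) (#-true n)

module _ {n m : ℕ} {G : FiniteGraph n m} (B : Bipartition G) where
  open Bipartition B

  Simple : Set
  Simple = ∀ e f → p e ≡ p f → q e ≡ q f → e ≡ f

  Parallel : Fin m → Fin m → Set
  Parallel e f = e ≢ f × p e ≡ p f × q e ≡ q f

  simple⊎parallel : Simple ⊎ ∃₂ Parallel
  simple⊎parallel with any? (λ e → any? (λ f → ¬? (e ≟ f) ×-dec (p e ≟ p f) ×-dec (q e ≟ q f)))
  ... | yes par = inj₂ par
  ... | no none = inj₁ simple
    where
    simple : Simple
    simple e f pe≡pf qe≡qf with e ≟ f
    ... | yes e≡f = e≡f
    ... | no  e≢f = contradiction (e , f , e≢f , pe≡pf , qe≡qf) none

  -- e₁, e₂, e₃, e₄ are the edges ab, cb, cd, ad.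
  record FourCycle : Set where
    field
      e₁ e₂ e₃ e₄ : Fin m
      pe₄≡pe₁     : p e₄ ≡ p e₁
      pe₃≡pe₂     : p e₃ ≡ p e₂
      qe₂≡qe₁     : q e₂ ≡ q e₁
      qe₄≡qe₃     : q e₄ ≡ q e₃
      a≢c         : p e₁ ≢ p e₂
      b≢d         : q e₁ ≢ q e₃

  fourCycle? : Dec FourCycle
  fourCycle? = map′
    (λ (e₁ , e₂ , e₃ , e₄ , x , y , z , w , u , v) → record
      { e₁ = e₁ ; e₂ = e₂ ; e₃ = e₃ ; e₄ = e₄ ; pe₄≡pe₁ = x ; pe₃≡pe₂ = y ; qe₂≡qe₁ = z ; qe₄≡qe₃ = w ; a≢c = u ; b≢d = v })
    (λ C → let open FourCycle C in e₁ , e₂ , e₃ , e₄ , pe₄≡pe₁ , pe₃≡pe₂ , qe₂≡qe₁ , qe₄≡qe₃ , a≢c , b≢d)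
    (any? λ e₁ → any? λ e₂ → any? λ e₃ → any? λ e₄ →
      (p e₄ ≟ p e₁) ×-dec (p e₃ ≟ p e₂) ×-dec (q e₂ ≟ q e₁) ×-dec (q e₄ ≟ q e₃) ×-dec
      ¬? (p e₁ ≟ p e₂) ×-dec ¬? (q e₁ ≟ q e₃))

module _ {n m : ℕ} {G : FiniteGraph n m} (B : Bipartition G) (cubic : Cubic G) where
  open Bipartition B

  #-edges : m ≡ 3 * # side
  #-edges = trans (sym (#-true m)) (trans (#-cong λ e → sym (lookup-⊤ e)) (#-p-full B ⊤ cubic))

  isTheta : # side ≡ 1 → G ≅ theta
  isTheta #side = isoBipartite B U W _ g (inverse-injective g h hg) (λ e → h e , gh e)
    λ x → only U refl (side-p (g x)) , only W refl (cong not (side-q (g x)))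
    where
    U : Enumeration side 1
    U = enumerate side 1 #side
    W : Enumeration (not ∘ side) 1
    W = enumerate (not ∘ side) 1 (trans (sym (balanced B ⊤ cubic)) #side)
    m≡3 : m ≡ 3
    m≡3 = trans #-edges (cong (3 *_) #side)
    h : Fin m → Fin 3
    h = subst Fin m≡3
    h-injective : Injective _≡_ _≡_ h
    h-injective = subst-injective m≡3
    inverse = injective⇒bijective m≡3 h h-injective
    g = proj₁ inverse
    hg = proj₁ (proj₂ inverse)
    gh = proj₂ (proj₂ inverse)
    only : ∀ {b} (V : Enumeration b 1) {i v} → i ≡ zero → b v ≡ true → Enumeration.elem V i ≡ v
    only V refl bv with zero , eq ← Enumeration.index V _ bv = eq

  -- Simplicity makes the pair of ends an injection of the nine edges into the nine pairs of
  -- vertices, hence a bijection.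
  isK₃,₃-simple : Simple B → # side ≡ 3 → G ≅ K₃,₃
  isK₃,₃-simple simple #side = isoBipartite B U W (remQuot 3) g (inverse-injective g h hg) (λ e → h e , gh e) ends≡
    where
    U : Enumeration side 3
    U = enumerate side 3 #side
    W : Enumeration (not ∘ side) 3
    W = enumerate (not ∘ side) 3 (trans (sym (balanced B ⊤ cubic)) #side)
    module U = Enumeration U
    module W = Enumeration W
    u : ∀ e → ∃ λ i → U.elem i ≡ p e
    u e = U.index (p e) (side-p e)
    w : ∀ e → ∃ λ j → W.elem j ≡ q e
    w e = W.index (q e) (cong not (side-q e))
    h : Fin m → Fin 9
    h e = combine (proj₁ (u e)) (proj₁ (w e))
    h-injective : Injective _≡_ _≡_ h
    h-injective {e} {f} eq with eqᵤ , eq𝓌 ← combine-injective (proj₁ (u e)) (proj₁ (w e)) (proj₁ (u f)) (proj₁ (w f)) eq =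
      simple e f (trans (sym (proj₂ (u e))) (trans (cong U.elem eqᵤ) (proj₂ (u f))))
                 (trans (sym (proj₂ (w e))) (trans (cong W.elem eq𝓌) (proj₂ (w f))))
    inverse = injective⇒bijective (trans #-edges (cong (3 *_) #side)) h h-injective
    g = proj₁ inverse
    hg = proj₁ (proj₂ inverse)
    gh = proj₂ (proj₂ inverse)
    quotient : ∀ x → remQuot 3 x ≡ (proj₁ (u (g x)) , proj₁ (w (g x)))
    quotient x = trans (cong (remQuot 3) (sym (hg x))) (remQuot-combine (proj₁ (u (g x))) (proj₁ (w (g x))))
    ends≡ : ∀ x → U.elem (proj₁ (remQuot 3 x)) ≡ p (g x) × W.elem (proj₂ (remQuot {3} 3 x)) ≡ q (g x)
    ends≡ x = trans (cong (U.elem ∘ proj₁) (quotient x)) (proj₂ (u (g x))) ,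
              trans (cong (W.elem ∘ proj₂) (quotient x)) (proj₂ (w (g x)))

module _ {n m n′ m′ : ℕ} (G : FiniteGraph n m) (H : FiniteGraph n′ m′) where

  IsIso : (Fin n′ → Fin n) → (Fin m′ → Fin m) → Set
  IsIso fᵥ fₑ = (∀ i j → fᵥ i ≡ fᵥ j → i ≡ j) × (∀ v → ∃ λ x → fᵥ x ≡ v) ×
    (∀ i j → fₑ i ≡ fₑ j → i ≡ j) × (∀ e → ∃ λ x → fₑ x ≡ e) ×
    (∀ x → Joins G (fₑ x) (fᵥ (proj₁ (ends H x))) (fᵥ (proj₂ (ends H x))))

  isIso? : ∀ fᵥ fₑ → Dec (IsIso fᵥ fₑ)
  isIso? fᵥ fₑ = injective? G fᵥ ×-dec (all? λ v → any? λ x → fᵥ x ≟ v) ×-dec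
    injective? G fₑ ×-dec (all? λ e → any? λ x → fₑ x ≟ e) ×-dec
    (all? λ x → joins? G (fₑ x) (fᵥ (proj₁ (ends H x))) (fᵥ (proj₂ (ends H x))))

  isIso-cong : ∀ {fᵥ gᵥ fₑ gₑ} → (∀ x → fᵥ x ≡ gᵥ x) → (∀ x → fₑ x ≡ gₑ x) → IsIso fᵥ fₑ → IsIso gᵥ gₑ
  isIso-cong eqᵥ eqₑ (a , b , c , d , e) =
    (λ i j eq → a i j (trans (eqᵥ i) (trans eq (sym (eqᵥ j))))) ,
    (λ v → let x , eq = b v in x , trans (sym (eqᵥ x)) eq) ,
    (λ i j eq → c i j (trans (eqₑ i) (trans eq (sym (eqₑ j))))) ,
    (λ v → let x , eq = d v in x , trans (sym (eqₑ x)) eq) ,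
    (λ x → subst (λ e → Joins G e _ _) (eqₑ x) (subst₂ (Joins G _) (eqᵥ _) (eqᵥ _) (e x)))

  isIso-from : (iso : G ≅ H) → IsIso (Inverse.from (_≅_.vertices iso)) (Inverse.from (_≅_.edges iso))
  isIso-from iso = (λ _ _ → from-injective vertices) , (λ v → Inverse.to vertices v , Inverse.strictlyInverseʳ vertices v) ,
    (λ _ _ → from-injective edges) , (λ e → Inverse.to edges e , Inverse.strictlyInverseʳ edges e) ,
    λ x → joins-from iso (inj₁ refl)
    where open _≅_ iso

  abstract
    -- Brute force over tables of vertex and edge maps. The extension hypothesis assumes that the
    -- graph is not Heawood, so this has to be decided before that hypothesis can be applied.
    _≅?_ : Dec (G ≅ H)
    _≅?_ = map′
      (λ (vs , es , a , b , c , d , e) → isoFrom (lookup vs) (lookup es) (a _ _) b (c _ _) d e)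
      (λ iso → tabulate (Inverse.from (_≅_.vertices iso)) , tabulate (Inverse.from (_≅_.edges iso)) ,
        isIso-cong (λ x → sym (lookup∘tabulate _ x)) (λ x → sym (lookup∘tabulate _ x)) (isIso-from iso))
      (searchVec any? n′ λ vs → searchVec any? m′ λ es → isIso? (lookup vs) (lookup es))

-- Short cycles

⇔⇒≡ : ∀ {a b} → (a ≡ true → b ≡ true) → (b ≡ true → a ≡ true) → a ≡ b
⇔⇒≡ {true}          f _ = sym (f refl)
⇔⇒≡ {false} {true}  _ g = g refl
⇔⇒≡ {false} {false} _ _ = refl

module _ {n m : ℕ} {G : FiniteGraph n m} (B : Bipartition G) where
  open Bipartition B

  inc-at-p : ∀ e {v} → p e ≡ v → inc G e v ≡ true
  inc-at-p e refl = inc-p B e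

  inc-at-q : ∀ e {v} → q e ≡ v → inc G e v ≡ true
  inc-at-q e refl = inc-q B e

module _ {n m : ℕ} {G : FiniteGraph n m} (B : Bipartition G) (cubic : Cubic G) (tfh : TwoFactorHamiltonian G) where
  open Bipartition B

  ∁-pair : ∀ M → PerfectMatching G M → ∀ {e f g v} → lookup M e ≡ false → lookup M f ≡ false → lookup M g ≡ false →
           inc G e v ≡ true → inc G f v ≡ true → inc G g v ≡ true → e ≢ f → g ≡ e ⊎ g ≡ f
  ∁-pair M pm {e} {f} {g} Me Mf Mg =
    twoFactor-third G (∁ M) (∁-regular G cubic M refl pm) (outside e Me) (outside f Mf) (outside g Mg)
    where
    outside : ∀ e → lookup M e ≡ false → lookup (∁ M) e ≡ true
    outside e Me = trans (lookup-∁ M e) (cong not Me)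

  -- A perfect matching through the third edge at `p e` avoids both parallel edges, which then form
  -- a component of the complementary 2-factor. Since that is a Hamiltonian cycle, there are no
  -- further vertices.
  parallel⇒theta : ∀ {e f} → Parallel B e f → G ≅ theta
  parallel⇒theta {e} {f} (e≢f , pe≡pf , qe≡qf) = isTheta B cubic (≤-antisym #≤1 (#≥1 side (side-p e)))
    where
    S : Fin n → Bool
    S v = (v == p e) ∨ (v == q e)

    third : ∃ λ g → (p g == p e) ≡ true × g ≢ e × g ≢ f
    third = #-pick-third (λ g → p g == p e) (≤-reflexive (sym (degree-p≡3 B cubic e))) (==-refl (p e)) (≡⇒== (sym pe≡pf)) e≢f

    avoid : (t : ∃ λ g → (p g == p e) ≡ true × g ≢ e × g ≢ f) →
            (∃ λ M → PerfectMatching G M × lookup M (proj₁ t) ≡ true) → ∀ v → S v ≢ false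
    avoid (g , pg , g≢e , g≢f) (M , pm , Mg) v Sv =
      matching-misses-cut B cubic tfh M pm S same (∨-trueˡ _ (==-refl (p e))) Sv
      where
      misses : ∀ {h} → g ≢ h → p h ≡ p e → lookup M h ≡ false
      misses {h} g≢h ph = ¬-not λ Mh →
        g≢h (matching-unique G M pm Mg Mh (inc-at-p B g (==⇒≡ pg)) (inc-at-p B h ph))
      Me = misses g≢e refl
      Mf = misses g≢f (sym pe≡pf)
      to-q : ∀ h → lookup M h ≡ false → S (p h) ≡ true → S (q h) ≡ true
      to-q h Mh t = [ atp , (λ eq → ⊥-elim (true≢false (side-p h) (trans (cong side (==⇒≡ eq)) (side-q e)))) ]′ (∨-true (p h == p e) t)
        where
        atp : (p h == p e) ≡ true → S (q h) ≡ true
        atp eq = ∨-trueʳ (q h == p e) (≡⇒== ([ cong q , (λ h≡f → trans (cong q h≡f) (sym qe≡qf)) ]′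
          (∁-pair M pm Me Mf Mh (inc-p B e) (inc-at-p B f (sym pe≡pf)) (inc-at-p B h (==⇒≡ eq)) e≢f)))
      to-p : ∀ h → lookup M h ≡ false → S (q h) ≡ true → S (p h) ≡ true
      to-p h Mh t = [ (λ eq → ⊥-elim (true≢false (side-p e) (trans (cong side (sym (==⇒≡ eq))) (side-q h)))) , atq ]′ (∨-true (q h == p e) t)
        where
        atq : (q h == q e) ≡ true → S (p h) ≡ true
        atq eq = ∨-trueˡ _ (≡⇒== ([ cong p , (λ h≡f → trans (cong p h≡f) (sym pe≡pf)) ]′
          (∁-pair M pm Me Mf Mh (inc-q B e) (inc-at-q B f (sym qe≡qf)) (inc-at-q B h (==⇒≡ eq)) e≢f)))
      same : ∀ h → lookup M h ≡ false → S (p h) ≡ S (q h)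
      same h Mh = ⇔⇒≡ (to-q h Mh) (to-p h Mh)

    side⊑ : side ⊑ (_== p e)
    side⊑ v sv = [ id , (λ eq → ⊥-elim (true≢false sv (trans (cong side (==⇒≡ eq)) (side-q e)))) ]′
      (∨-true (v == p e) (¬-not (avoid third (edge∈matching B cubic _) v)))

    #≤1 : # side ≤ 1
    #≤1 = ≤-trans (#-mono side⊑) (≤-reflexive (#-== (p e)))

module FourCycles {n m : ℕ} {G : FiniteGraph n m} (B : Bipartition G) (connected : Connected G) (cubic : Cubic G)
                  (tfh : TwoFactorHamiltonian G) (simple : Simple B) (C : FourCycle B) where
  open Bipartition B
  open FourCycle C

  a b c d : Fin n
  a = p e₁
  b = q e₁
  c = p e₂
  d = q e₃

  side-b : ∀ {v} → v ≡ b ⊎ v ≡ d → side v ≡ false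
  side-b (inj₁ refl) = side-q e₁
  side-b (inj₂ refl) = side-q e₃

  thirdEdge : ∀ {e f} → q f ≡ q e → e ≢ f → ∃ λ g → (q g == q e) ≡ true × g ≢ e × g ≢ f
  thirdEdge {e} {f} qf≡qe e≢f =
    #-pick-third (λ g → q g == q e) (≤-reflexive (sym (degree-p≡3 (flip B) cubic e))) (==-refl (q e)) (≡⇒== qf≡qe) e≢f

  abstract
    third-b : ∃ λ g → (q g == b) ≡ true × g ≢ e₁ × g ≢ e₂
    third-b = thirdEdge qe₂≡qe₁ λ e₁≡e₂ → a≢c (cong p e₁≡e₂)

    third-d : ∃ λ g → (q g == d) ≡ true × g ≢ e₃ × g ≢ e₄
    third-d = thirdEdge qe₄≡qe₃ λ e₃≡e₄ → a≢c (trans (sym pe₄≡pe₁) (trans (cong p (sym e₃≡e₄)) pe₃≡pe₂))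

  e₅ e₆ : Fin m
  e₅ = proj₁ third-b
  e₆ = proj₁ third-d

  qe₅ : q e₅ ≡ b
  qe₅ = ==⇒≡ (proj₁ (proj₂ third-b))

  qe₆ : q e₆ ≡ d
  qe₆ = ==⇒≡ (proj₁ (proj₂ third-d))

  at-b : ∀ e → q e ≡ b → e ≡ e₁ ⊎ e ≡ e₂ ⊎ e ≡ e₅
  at-b e qe = #≤3⇒ (λ g → q g == b) (≤-reflexive (degree-p≡3 (flip B) cubic e₁)) (==-refl b) (≡⇒== qe₂≡qe₁) (≡⇒== qe₅)
    (λ eq → a≢c (cong p eq)) (proj₁ (proj₂ (proj₂ third-b))) (proj₂ (proj₂ (proj₂ third-b))) (≡⇒== qe)

  at-d : ∀ e → q e ≡ d → e ≡ e₃ ⊎ e ≡ e₄ ⊎ e ≡ e₆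
  at-d e qe = #≤3⇒ (λ g → q g == d) (≤-reflexive (degree-p≡3 (flip B) cubic e₃)) (==-refl d) (≡⇒== qe₄≡qe₃) (≡⇒== qe₆)
    (λ eq → a≢c (trans (sym pe₄≡pe₁) (trans (cong p (sym eq)) pe₃≡pe₂)))
    (proj₁ (proj₂ (proj₂ third-d))) (proj₂ (proj₂ (proj₂ third-d))) (≡⇒== qe)

  g≢a : p e₅ ≢ a
  g≢a eq = proj₁ (proj₂ (proj₂ third-b)) (simple e₅ e₁ eq qe₅)

  g≢c : p e₅ ≢ c
  g≢c eq = proj₂ (proj₂ (proj₂ third-b)) (simple e₅ e₂ eq (trans qe₅ (sym qe₂≡qe₁)))

  SW : Fin n → Bool
  SW v = (v == b) ∨ (v == d)

  SW⁻ : ∀ {v} → SW v ≡ true → v ≡ b ⊎ v ≡ d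
  SW⁻ {v} t = Sum.map ==⇒≡ ==⇒≡ (∨-true (v == b) t)

  SW-b : SW b ≡ true
  SW-b = ∨-trueˡ _ (==-refl b)

  SW-d : SW d ≡ true
  SW-d = ∨-trueʳ (d == b) (==-refl d)

  SW-p : ∀ e → SW (p e) ≡ false
  SW-p e = ¬-not λ t → true≢false (side-p e) (side-b (SW⁻ t))

  #SW≤2 : # SW ≤ 2
  #SW≤2 = ≤-trans (#-∨≤ (_== b) (_== d)) (≤-reflexive (cong₂ _+_ (#-== b) (#-== d)))

  -- The third neighbours of b and d coincide: {a, c, g, b, d} spans a K₂,₃.
  module Shared (g≡ : p e₅ ≡ p e₆) where
    g : Fin n
    g = p e₅

    SU S : Fin n → Bool
    SU v = (v == a) ∨ ((v == c) ∨ (v == g))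
    S v = SU v ∨ SW v

    SU-a : ∀ {v} → v ≡ a → SU v ≡ true
    SU-a eq = ∨-trueˡ _ (≡⇒== eq)
    SU-c : ∀ {v} → v ≡ c → SU v ≡ true
    SU-c {v} eq = ∨-trueʳ (v == a) (∨-trueˡ _ (≡⇒== eq))
    SU-g : ∀ {v} → v ≡ g → SU v ≡ true
    SU-g {v} eq = ∨-trueʳ (v == a) (∨-trueʳ (v == c) (≡⇒== eq))

    SU-side : SU ⊑ side
    SU-side v t with ∨-true (v == a) t
    ... | inj₁ eq = trans (cong side (==⇒≡ eq)) (side-p e₁)
    ... | inj₂ t′ with ∨-true (v == c) t′
    ... | inj₁ eq = trans (cong side (==⇒≡ eq)) (side-p e₂)
    ... | inj₂ eq = trans (cong side (==⇒≡ eq)) (side-p e₅)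

    #SU≤3 : # SU ≤ 3
    #SU≤3 = ≤-trans (#-∨≤ (_== a) _) (+-mono-≤ (≤-reflexive (#-== a))
      (≤-trans (#-∨≤ (_== c) (_== g)) (≤-reflexive (cong₂ _+_ (#-== c) (#-== g)))))

    entering-edge : ∀ e → q e ≡ b ⊎ q e ≡ d → SU (p e) ≡ true
    entering-edge e (inj₁ qe) with at-b e qe
    ... | inj₁ refl        = SU-a refl
    ... | inj₂ (inj₁ refl) = SU-c refl
    ... | inj₂ (inj₂ refl) = SU-g refl
    entering-edge e (inj₂ qe) with at-d e qe
    ... | inj₁ refl        = SU-c pe₃≡pe₂
    ... | inj₂ (inj₁ refl) = SU-a pe₄≡pe₁
    ... | inj₂ (inj₂ refl) = SU-g (sym g≡)

    q⇒p : ∀ e → S (q e) ≡ true → S (p e) ≡ true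
    q⇒p e t with ∨-true (SU (q e)) t
    ... | inj₁ u = contradiction (side-q e) (true≢false (SU-side (q e) u))
    ... | inj₂ w = ∨-trueˡ _ (entering-edge e (SW⁻ w))

    S∧side⊑ : (λ v → S v ∧ side v) ⊑ SU
    S∧side⊑ v t with ∨-true (SU v) (∧-trueˡ t)
    ... | inj₁ u = u
    ... | inj₂ w = contradiction (side-b (SW⁻ w)) (true≢false (∧-trueʳ {S v} t))

    -- Three vertices of one class against `b` and `d` in the other: the excess is one, worth three
    -- edges.
    ∂≤3 : # (boundary B S) ≤ 3
    ∂≤3 = boundary≤3 B cubic S q⇒p (≤-trans (≤-trans (#-mono S∧side⊑) #SU≤3) (s≤s
      (#≥2 (λ v → S v ∧ not (side v)) (∧-true (∨-trueʳ (SU b) SW-b) (cong not (side-b (inj₁ refl))))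
                                      (∧-true (∨-trueʳ (SU d) SW-d) (cong not (side-b (inj₂ refl)))) b≢d)))

    3≤side : 3 ≤ # side
    3≤side = #≥3 side (side-p e₁) (side-p e₂) (side-p e₅) a≢c (g≢a ∘ sym) (g≢c ∘ sym)

    -- `S` has at most five vertices, so with at most one vertex outside there are at most six in
    -- all, three in each class.
    side≤3 : # (not ∘ S) ≤ 1 → # side ≤ 3
    side≤3 #∁S≤1 = *-cancelˡ-≤ 2 (begin
      2 * # side                    ≡⟨ cong (# side +_) (+-identityʳ _) ⟩
      # side + # side               ≡⟨ cong (# side +_) (balanced B ⊤ cubic) ⟩
      # side + # (not ∘ side)       ≡⟨ trans (#-not side) (sym (#-not S)) ⟩
      # S + # (not ∘ S)             ≤⟨ +-mono-≤ (≤-trans (#-∨≤ SU SW) (+-mono-≤ #SU≤3 #SW≤2)) #∁S≤1 ⟩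
      6                             ∎)

    result : ∃ (Reducing B) ⊎ G ≅ K₃,₃
    result with 2 ≤? # (not ∘ S)
    ... | yes 2≤∁S = inj₁ (S , #≥2 S (∨-trueʳ (SU b) SW-b) (∨-trueʳ (SU d) SW-d) b≢d , 2≤∁S , ∂≤3)
    ... | no  2≰∁S = inj₂ (isK₃,₃-simple B cubic simple (≤-antisym (side≤3 (≤-pred (≰⇒> 2≰∁S))) 3≤side))

  F : Fin m → Bool
  F e = not (((e == e₁) ∨ (e == e₂)) ∨ ((e == e₃) ∨ (e == e₄)))

  F⁺ : ∀ {e} → e ≢ e₁ → e ≢ e₂ → e ≢ e₃ → e ≢ e₄ → F e ≡ true
  F⁺ x y z w rewrite ≢⇒== x | ≢⇒== y | ≢⇒== z | ≢⇒== w = refl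

  F-e₁ : F e₁ ≡ false
  F-e₁ rewrite ==-refl e₁ = refl
  F-e₂ : F e₂ ≡ false
  F-e₂ rewrite ==-refl e₂ | ∨-zeroʳ (e₂ == e₁) = refl
  F-e₃ : F e₃ ≡ false
  F-e₃ rewrite ==-refl e₃ | ∨-zeroʳ ((e₃ == e₁) ∨ (e₃ == e₂)) = refl
  F-e₄ : F e₄ ≡ false
  F-e₄ rewrite ==-refl e₄ | ∨-zeroʳ (e₄ == e₃) | ∨-zeroʳ ((e₄ == e₁) ∨ (e₄ == e₂)) = refl

  F⁻ : ∀ {e} → F e ≡ false → q e ≡ b ⊎ q e ≡ d
  F⁻ {e} t with e ≟ e₁ | e ≟ e₂ | e ≟ e₃ | e ≟ e₄
  ... | yes refl | _ | _ | _ = inj₁ refl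
  ... | no _ | yes refl | _ | _ = inj₁ qe₂≡qe₁
  ... | no _ | no _ | yes refl | _ = inj₂ refl
  ... | no _ | no _ | no _ | yes refl = inj₂ qe₄≡qe₃
  ... | no x | no y | no z | no w = contradiction t (true≢false (F⁺ x y z w))

  F-e₅ : F e₅ ≡ true
  F-e₅ = F⁺ (proj₁ (proj₂ (proj₂ third-b))) (proj₂ (proj₂ (proj₂ third-b)))
            (λ eq → b≢d (trans (sym qe₅) (cong q eq))) (λ eq → b≢d (trans (sym qe₅) (trans (cong q eq) qe₄≡qe₃)))

  F-e₆ : F e₆ ≡ true
  F-e₆ = F⁺ (λ eq → b≢d (trans (cong q (sym eq)) qe₆)) (λ eq → b≢d (trans (sym qe₂≡qe₁) (trans (cong q (sym eq)) qe₆)))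
            (proj₁ (proj₂ (proj₂ third-d))) (proj₂ (proj₂ (proj₂ third-d)))

  -- The complement of a perfect matching avoiding the 4-cycle has it as a component.
  matching-meets : ∀ M → PerfectMatching G M → lookup M ⊑ F → ⊥
  matching-meets M pm M⊑F = matching-misses-cut B cubic tfh M pm S same S-a (S-out (edgeAt G M a (≤-reflexive (sym (pm a)))))
    where
    S : Fin n → Bool
    S v = ((v == a) ∨ (v == c)) ∨ SW v

    S-a : S a ≡ true
    S-a = ∨-trueˡ _ (∨-trueˡ _ (==-refl a))

    misses : ∀ {e} → F e ≡ false → lookup M e ≡ false
    misses Fe = ¬-not λ Me → true≢false (M⊑F _ Me) Fe

    e₁≢e₄ : e₁ ≢ e₄
    e₁≢e₄ eq = b≢d (trans (cong q eq) qe₄≡qe₃)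
    e₂≢e₃ : e₂ ≢ e₃
    e₂≢e₃ eq = b≢d (trans (sym qe₂≡qe₁) (cong q eq))
    e₁≢e₂ : e₁ ≢ e₂
    e₁≢e₂ eq = a≢c (cong p eq)
    e₃≢e₄ : e₃ ≢ e₄
    e₃≢e₄ eq = a≢c (trans (sym pe₄≡pe₁) (trans (cong p (sym eq)) pe₃≡pe₂))

    pick : ∀ {e f g} {P : Fin m → Set} → g ≡ e ⊎ g ≡ f → P e → P f → P g
    pick (inj₁ refl) Pe _ = Pe
    pick (inj₂ refl) _ Pf = Pf

    to-q : ∀ e → lookup M e ≡ false → S (p e) ≡ true → S (q e) ≡ true
    to-q e Me t = [ (λ u → ∨-trueʳ ((q e == a) ∨ (q e == c)) ([ from-a , from-c ]′ (∨-true (p e == a) u)))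
                  , (λ w → ⊥-elim (true≢false w (SW-p e))) ]′ (∨-true ((p e == a) ∨ (p e == c)) t)
      where
      on-b : ∀ {f} → q f ≡ b → SW (q f) ≡ true
      on-b eq = ∨-trueˡ _ (≡⇒== eq)
      on-d : ∀ {f} → q f ≡ d → SW (q f) ≡ true
      on-d {f} eq = ∨-trueʳ (q f == b) (≡⇒== eq)
      from-a : (p e == a) ≡ true → SW (q e) ≡ true
      from-a eq = pick {P = λ e → SW (q e) ≡ true} (∁-pair B cubic tfh M pm (misses F-e₁) (misses F-e₄) Me
        (inc-p B e₁) (inc-at-p B e₄ pe₄≡pe₁) (inc-at-p B e (==⇒≡ eq)) e₁≢e₄) (on-b {e₁} refl) (on-d {e₄} qe₄≡qe₃)
      from-c : (p e == c) ≡ true → SW (q e) ≡ true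
      from-c eq = pick {P = λ e → SW (q e) ≡ true} (∁-pair B cubic tfh M pm (misses F-e₂) (misses F-e₃) Me
        (inc-p B e₂) (inc-at-p B e₃ pe₃≡pe₂) (inc-at-p B e (==⇒≡ eq)) e₂≢e₃) (on-b {e₂} qe₂≡qe₁) (on-d {e₃} refl)

    on-a : ∀ {v} → v ≡ a → S v ≡ true
    on-a eq = ∨-trueˡ _ (∨-trueˡ _ (≡⇒== eq))
    on-c : ∀ {v} → v ≡ c → S v ≡ true
    on-c {v} eq = ∨-trueˡ _ (∨-trueʳ (v == a) (≡⇒== eq))

    q∉ac : ∀ e → (q e == a) ∨ (q e == c) ≡ false
    q∉ac e = ¬-not λ t → [ (λ eq → true≢false (side-p e₁) (trans (cong side (sym (==⇒≡ eq))) (side-q e)))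
                         , (λ eq → true≢false (side-p e₂) (trans (cong side (sym (==⇒≡ eq))) (side-q e))) ]′ (∨-true (q e == a) t)

    to-p : ∀ e → lookup M e ≡ false → S (q e) ≡ true → S (p e) ≡ true
    to-p e Me t = [ (λ u → ⊥-elim (true≢false u (q∉ac e))) , (λ w → [ from-b , from-d ]′ (SW⁻ w)) ]′
                    (∨-true ((q e == a) ∨ (q e == c)) t)
      where
      from-b : q e ≡ b → S (p e) ≡ true
      from-b eq = pick {P = λ e → S (p e) ≡ true} (∁-pair B cubic tfh M pm (misses F-e₁) (misses F-e₂) Me
        (inc-q B e₁) (inc-at-q B e₂ qe₂≡qe₁) (inc-at-q B e eq) e₁≢e₂) (on-a refl) (on-c refl)
      from-d : q e ≡ d → S (p e) ≡ true
      from-d eq = pick {P = λ e → S (p e) ≡ true} (∁-pair B cubic tfh M pm (misses F-e₃) (misses F-e₄) Me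
        (inc-q B e₃) (inc-at-q B e₄ qe₄≡qe₃) (inc-at-q B e eq) e₃≢e₄) (on-c pe₃≡pe₂) (on-a pe₄≡pe₁)

    same : ∀ e → lookup M e ≡ false → S (p e) ≡ S (q e)
    same e Me = ⇔⇒≡ (to-q e Me) (to-p e Me)

    -- By simplicity an edge from `a` to `b` or `d` is `e₁` or `e₄`, so the matching edge at `a`
    -- leads away from the cycle.
    S-out : (f : ∃ λ e → lookup M e ≡ true × inc G e a ≡ true) → S (q (proj₁ f)) ≡ false
    S-out (f , Mf , fa) = ¬-not λ t → [ (λ u → true≢false u (q∉ac f)) , (λ w → [ not-b , not-d ]′ (SW⁻ w)) ]′
                                        (∨-true ((q f == a) ∨ (q f == c)) t)
      where
      pf : p f ≡ a
      pf = ==⇒≡ (trans (sym (inc≡p B f (side-p e₁))) fa)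
      not-b : q f ≢ b
      not-b eq = true≢false (M⊑F f Mf) (trans (cong F (simple f e₁ pf eq)) F-e₁)
      not-d : q f ≢ d
      not-d eq = true≢false (M⊑F f Mf) (trans (cong F (simple f e₄ (trans pf (sym pe₄≡pe₁)) (trans eq (sym qe₄≡qe₃)))) F-e₄)

  open Marriage p q side

  -- A set violating the marriage condition for the edges off the 4-cycle,
  -- together with its neighbours and b and d, is one side of a 3-edge cut.
  module Violating (g≢h : p e₅ ≢ p e₆) (X : Fin n → Bool) (X⊑side : X ⊑ side) (bad : # (neighbours F X) < # X) where
    T Y : Fin n → Bool
    T = neighbours F X
    Y v = X v ∨ (T v ∨ SW v)

    T-side : ∀ {v} → T v ≡ true → side v ≡ false
    T-side t = let e , _ , _ , eq = neighbours⁻ F X t in trans (cong side (sym eq)) (side-q e)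

    TSW-side : ∀ {v} → T v ∨ SW v ≡ true → side v ≡ false
    TSW-side {v} t = [ T-side , (λ w → side-b (SW⁻ w)) ]′ (∨-true (T v) t)

    Y-side : ∀ {v} → side v ≡ true → Y v ≡ true → X v ≡ true
    Y-side {v} sv t = [ id , (λ w → ⊥-elim (true≢false sv (TSW-side w))) ]′ (∨-true (X v) t)

    p⇒q : ∀ e → Y (p e) ≡ true → Y (q e) ≡ true
    p⇒q e t = ∨-trueʳ (X (q e)) (aux (F e) refl)
      where
      aux : ∀ f → F e ≡ f → T (q e) ∨ SW (q e) ≡ true
      aux true  Fe = ∨-trueˡ _ (neighbours⁺ F X Fe (Y-side (side-p e) t))
      aux false Fe = ∨-trueʳ (T (q e)) ([ (λ eq → trans (cong SW eq) SW-b) , (λ eq → trans (cong SW eq) SW-d) ]′ (F⁻ Fe))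

    YW⊑ : (λ v → Y v ∧ not (side v)) ⊑ (λ v → T v ∨ SW v)
    YW⊑ v t = [ (λ Xv → ⊥-elim (true≢false (∧-trueʳ {Y v} t) (cong not (X⊑side v Xv)))) , id ]′ (∨-true (X v) (∧-trueˡ t))

    X⊑YU : X ⊑ (λ v → Y v ∧ side v)
    X⊑YU v Xv = ∧-true (∨-trueˡ _ Xv) (X⊑side v Xv)

    ∂≤3 : # (boundary B Y) ≤ 3
    ∂≤3 = ≤-trans (≤-reflexive (#-cong λ e → ∨-comm (leaving B Y e) (entering B Y e)))
      -- A violator has at least one vertex more than `T`, so adding `b` and `d` to `T` exceeds `X`
      -- by at most one. The classes are flipped because the excess is now in the class `false`.
      (boundary≤3 (flip B) cubic Y p⇒q (begin
        # (λ v → Y v ∧ not (side v))                ≤⟨ #-mono YW⊑ ⟩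
        # (λ v → T v ∨ SW v)                        ≤⟨ #-∨≤ T SW ⟩
        # T + # SW                                  ≤⟨ +-monoʳ-≤ (# T) #SW≤2 ⟩
        # T + 2                                     ≡⟨ +-comm (# T) 2 ⟩
        suc (suc (# T))                             ≤⟨ s≤s bad ⟩
        suc (# X)                                   ≤⟨ s≤s (#-mono X⊑YU) ⟩
        suc (# (λ v → Y v ∧ side v))                ≡⟨ cong suc (#-cong λ v → cong (Y v ∧_) (sym (not-involutive (side v)))) ⟩
        suc (# (λ v → Y v ∧ not (not (side v))))    ∎))

    Y-b : Y b ≡ true
    Y-b = ∨-trueʳ (X b) (∨-trueʳ (T b) SW-b)
    Y-d : Y d ≡ true
    Y-d = ∨-trueʳ (X d) (∨-trueʳ (T d) SW-d)

    -- Were b or d in T, no edge would leave or enter Y, so Y would be everything.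
    ¬covered : # (λ v → T v ∨ SW v) ≤ suc (# T) → ⊥
    ¬covered small = contradiction (#-mono ∁side⊑T) (<⇒≱ (≤-trans bad (≤-trans (#-mono X⊑side) (≤-reflexive (balanced B ⊤ cubic)))))
      where
      YW≤YU : # (λ v → Y v ∧ not (side v)) ≤ # (λ v → Y v ∧ side v)
      YW≤YU = ≤-trans (#-mono YW⊑) (≤-trans small (≤-trans bad (#-mono X⊑YU)))
      no-leaving : # (leaving B Y) ≡ 0
      no-leaving = #-false λ e → ¬-not λ t → true≢false (∧-trueʳ {Y (p e)} t) (cong not (p⇒q e (∧-trueˡ t)))
      no-entering : # (entering B Y) ≤ 0
      no-entering = +-cancelʳ-≤ (3 * # (λ v → Y v ∧ side v)) _ _ (begin
        # (entering B Y) + 3 * # (λ v → Y v ∧ side v)       ≡⟨ cubic-balance B cubic Y ⟨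
        # (leaving B Y) + 3 * # (λ v → Y v ∧ not (side v))  ≡⟨ cong (_+ 3 * # (λ v → Y v ∧ not (side v))) no-leaving ⟩
        3 * # (λ v → Y v ∧ not (side v))                    ≤⟨ *-monoʳ-≤ 3 YW≤YU ⟩
        3 * # (λ v → Y v ∧ side v)                          ∎)
      closed : Closed G (lookup ⊤) Y
      closed = closed⇒ B {S = Y} λ e _ → ⇔⇒≡ (p⇒q e) λ Yq → ¬-not λ Yp →
        contradiction (≤-trans (#≥1 (entering B Y) {e} (∧-true Yq (cong not Yp))) no-entering) λ ()
      everything : ∀ v → Y v ≡ true
      everything v = trans (reachable-closed G {S = Y} closed (proj₂ connected v b)) Y-b
      side⊑X : side ⊑ X
      side⊑X v sv = Y-side sv (everything v)
      hit : ∀ {w} e → F e ≡ true → q e ≡ w → T w ≡ true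
      hit e Fe refl = neighbours⁺ F X Fe (side⊑X (p e) (side-p e))
      -- Any edge at `w` off the 4-cycle puts `w` into `T`; if the edge found is on the cycle, `w`
      -- is `b` or `d` and `e₅` or `e₆` serves instead. Then `T` is at least as large as its class,
      -- against the choice of `X`.
      ∁side⊑T : not ∘ side ⊑ T
      ∁side⊑T w sw = aux (edgeAt G ⊤ w (≤-trans (s≤s z≤n) (≤-reflexive (sym (cubic w)))))
        where
        aux : (∃ λ e → lookup ⊤ e ≡ true × inc G e w ≡ true) → T w ≡ true
        aux (e , _ , ew) = aux′ (F e) refl
          where
          qe : q e ≡ w
          qe = ==⇒≡ (trans (sym (inc≡p (flip B) e sw)) ew)
          aux′ : ∀ f → F e ≡ f → T w ≡ true
          aux′ true  Fe = hit e Fe qe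
          aux′ false Fe = [ (λ eq → hit e₅ F-e₅ (trans qe₅ (trans (sym eq) qe)))
                          , (λ eq → hit e₆ F-e₆ (trans qe₆ (trans (sym eq) qe))) ]′ (F⁻ Fe)

    ∨-absorb : ∀ {x y} → T x ≡ true → (∀ v → SW v ≡ true → v ≡ x ⊎ v ≡ y) → # (λ v → T v ∨ SW v) ≤ suc (# T)
    ∨-absorb {x} {y} Tx cover = ≤-trans (#-mono ⊑) (≤-trans (#-∨≤ T (_== y))
      (≤-reflexive (trans (cong (# T +_) (#-== y)) (+-comm (# T) 1))))
      where
      ⊑ : (λ v → T v ∨ SW v) ⊑ (λ v → T v ∨ (v == y))
      ⊑ v t = [ ∨-trueˡ _ , (λ w → [ (λ eq → ∨-trueˡ _ (trans (cong T eq) Tx)) , (λ eq → ∨-trueʳ (T v) (≡⇒== eq)) ]′ (cover v w)) ]′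
                (∨-true (T v) t)

    T-b : T b ≢ true
    T-b t = ¬covered (∨-absorb t λ v w → SW⁻ w)

    T-d : T d ≢ true
    T-d t = ¬covered (∨-absorb t λ v w → Sum.swap (SW⁻ w))

    outside : ∀ {e w} → F e ≡ true → q e ≡ w → T w ≢ true → not (Y (p e)) ≡ true
    outside {e} Fe refl ¬T = cong not (¬-not λ t → ¬T (neighbours⁺ F X Fe (Y-side (side-p e) t)))

    -- Since `b` and `d` are not in `T`, the other ends of `e₅` and `e₆` lie outside `Y`; they
    -- differ by `g≢h` and so supply the two vertices on the far side.
    reducing : Reducing B Y
    reducing = #≥2 Y Y-b Y-d b≢d , #≥2 (not ∘ Y) (outside F-e₅ qe₅ T-b) (outside F-e₆ qe₆ T-d) g≢h , ∂≤3

  -- The third neighbours of `b` and `d` must be distinct for the violator argument to find two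
  -- vertices outside its set; their coincidence is therefore treated separately, and only there
  -- does `K₃,₃` arise.
  reducing⊎K₃,₃ : ∃ (Reducing B) ⊎ G ≅ K₃,₃
  reducing⊎K₃,₃ with p e₅ ≟ p e₆
  ... | yes g≡h = Shared.result g≡h
  ... | no  g≢h = [ matched , (λ (X , X⊑ , bad) → inj₁ (_ , Violating.reducing g≢h X X⊑ bad)) ]′ (hall? F)
    where
    matched : Hall F → ∃ (Reducing B) ⊎ G ≅ K₃,₃
    matched hall = let M , pm , M⊑F = hall⇒matching B (balanced B ⊤ cubic) F hall in ⊥-elim (matching-meets M pm M⊑F)

-- Girth and cyclic edge-connectivity of irreducible graphs

module _ {n m : ℕ} {G : FiniteGraph n m} (B : Bipartition G) where
  open Bipartition B

  joins-side : ∀ {e u v} → Joins G e u v → side u ≡ not (side v)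
  joins-side {e} j = orient (joins e) j
    where
    orient : ∀ {u v} → Joins G e (p e) (q e) → Joins G e u v → side u ≡ not (side v)
    p≡ : ∀ {u v} → (p e , q e) ≡ (u , v) → side u ≡ true × side v ≡ false
    p≡ eq = trans (sym (cong (side ∘ proj₁) eq)) (side-p e) , trans (sym (cong (side ∘ proj₂) eq)) (side-q e)
    opposite : ∀ {x y} → x ≡ true × y ≡ false → x ≡ not y
    opposite (refl , refl) = refl
    opposite′ : ∀ {x y} → x ≡ true × y ≡ false → y ≡ not x
    opposite′ (refl , refl) = refl
    orient (inj₁ x) (inj₁ y) = opposite (p≡ (trans (sym x) y))
    orient (inj₁ x) (inj₂ y) = opposite′ (p≡ (trans (sym x) y))
    orient (inj₂ x) (inj₁ y) = opposite′ (p≡ (cong Prod.swap (trans (sym x) y)))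
    orient (inj₂ x) (inj₂ y) = opposite (p≡ (cong Prod.swap (trans (sym x) y)))

  joins-pq : ∀ {e u v} → side u ≡ true → Joins G e u v → p e ≡ u × q e ≡ v
  joins-pq {e} {u} {v} su j = orient (joins e) j
    where
    both : (p e , q e) ≡ (u , v) → p e ≡ u × q e ≡ v
    both eq = cong proj₁ eq , cong proj₂ eq
    wrong : (p e , q e) ≡ (v , u) → p e ≡ u × q e ≡ v
    wrong eq = contradiction (trans (sym (cong (side ∘ proj₂) eq)) (side-q e)) (true≢false su)
    orient : Joins G e (p e) (q e) → Joins G e u v → p e ≡ u × q e ≡ v
    orient (inj₁ x) (inj₁ y) = both (trans (sym x) y)
    orient (inj₁ x) (inj₂ y) = wrong (trans (sym x) y)
    orient (inj₂ x) (inj₁ y) = wrong (cong Prod.swap (trans (sym x) y))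
    orient (inj₂ x) (inj₂ y) = both (cong Prod.swap (trans (sym x) y))

  simple-joins : Simple B → ∀ {e f u v} → Joins G e u v → Joins G f u v → e ≡ f
  simple-joins simple {e} {f} {u} {v} j j′ = aux (side u) refl
    where
    aux : ∀ b → side u ≡ b → e ≡ f
    aux true su = let x , y = joins-pq su j ; x′ , y′ = joins-pq su j′ in simple e f (trans x (sym x′)) (trans y (sym y′))
    aux false su =
      let sv = not-injective (trans (sym (joins-side j)) su)
          x , y = joins-pq sv (joins-sym G j) ; x′ , y′ = joins-pq sv (joins-sym G j′)
      in simple e f (trans x (sym x′)) (trans y (sym y′))

  fourCycle : ∀ {v₀ v₁ v₂ v₃ f₀ f₁ f₂ f₃} → side v₀ ≡ true → v₀ ≢ v₂ → v₁ ≢ v₃ →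
              Joins G f₀ v₀ v₁ → Joins G f₁ v₁ v₂ → Joins G f₂ v₂ v₃ → Joins G f₃ v₃ v₀ → FourCycle B
  fourCycle {f₀ = f₀} {f₁} {f₂} {f₃} s₀ v₀≢v₂ v₁≢v₃ j₀ j₁ j₂ j₃ =
    let s₂ = trans (joins-side (joins-sym G j₁)) (trans (cong not (joins-side (joins-sym G j₀))) (trans (not-involutive _) s₀))
        p₀ , q₀ = joins-pq s₀ j₀
        p₁ , q₁ = joins-pq s₂ (joins-sym G j₁)
        p₂ , q₂ = joins-pq s₂ j₂
        p₃ , q₃ = joins-pq s₀ (joins-sym G j₃)
    in record { e₁ = f₀ ; e₂ = f₁ ; e₃ = f₂ ; e₄ = f₃
              ; pe₄≡pe₁ = trans p₃ (sym p₀) ; pe₃≡pe₂ = trans p₂ (sym p₁)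
              ; qe₂≡qe₁ = trans q₁ (sym q₀) ; qe₄≡qe₃ = trans q₃ (sym q₂)
              ; a≢c = λ eq → v₀≢v₂ (trans (sym p₀) (trans eq p₁)) ; b≢d = λ eq → v₁≢v₃ (trans (sym q₀) (trans eq q₂)) }

  -- Odd lengths contradict the colouring, length 2 contradicts simplicity, and a 4-cycle is read
  -- off from vertex 0 or 1, whichever is in the class `true`. The cases of `bound` are numbered by
  -- the length minus one.
  girth≥6 : Simple B → ¬ FourCycle B → GirthAtLeast G 6
  girth≥6 simple ¬four c = bound (Cycle.length-1 c) (Cycle.vertex c) (Cycle.edge c)
      (Cycle.vertex-injective c) (Cycle.edge-injective c) (Cycle.edge-joins c)
    where
    even : ∀ {x y z} → x ≡ not y → y ≡ not z → x ≡ z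
    even {z = z} refl refl = not-involutive z
    bound : ∀ l (v : Fin (suc l) → Fin n) (e : Fin (suc l) → Fin m) → Injective _≡_ _≡_ v → Injective _≡_ _≡_ e →
            (∀ i → Joins G (e i) (v i) (v (suc (toℕ i) mod suc l))) → 6 ≤ suc l
    bound 0 v e _ _ j = contradiction (joins-side (j zero)) (not-¬ refl)
    bound 1 v e _ e-inj j = contradiction (e-inj (simple-joins simple (j zero) (joins-sym G (j (suc zero))))) λ ()
    bound 2 v e _ _ j = contradiction
      (trans (even (joins-side (j zero)) (joins-side (j (suc zero)))) (joins-side (j (suc (suc zero))))) (not-¬ refl)
    bound 3 v e v-inj _ j = ⊥-elim (aux (side (v zero)) refl)
      where
      aux : ∀ b → side (v zero) ≡ b → ⊥
      aux true s = ¬four (fourCycle s (λ eq → contradiction (v-inj eq) λ ()) (λ eq → contradiction (v-inj eq) λ ())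
        (j zero) (j (suc zero)) (j (suc (suc zero))) (j (suc (suc (suc zero)))))
      aux false s = ¬four (fourCycle (trans (joins-side (joins-sym G (j zero))) (cong not s))
        (λ eq → contradiction (v-inj eq) λ ()) (λ eq → contradiction (v-inj eq) λ ())
        (j (suc zero)) (j (suc (suc zero))) (j (suc (suc (suc zero)))) (j zero))
    bound 4 v e _ _ j = contradiction
      (trans (even (joins-side (j zero)) (joins-side (j (suc zero))))
        (trans (even (joins-side (j (suc (suc zero)))) (joins-side (j (suc (suc (suc zero))))))
          (joins-side (j (suc (suc (suc (suc zero))))))))  (not-¬ refl)
    bound (suc (suc (suc (suc (suc l))))) _ _ _ _ _ = s≤s (s≤s (s≤s (s≤s (s≤s (s≤s z≤n)))))

  -- The component of `u` off `X` is one side of a reducing cut: its boundary lies in `X`, and each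
  -- side contains a cycle, whose first edge already supplies two vertices, distinct because
  -- differently coloured.
  cyclically4 : ¬ ∃ (Reducing B) → CyclicallyEdgeConnected G 4
  cyclically4 irreducible X ∣X∣<4 (_ , u , w , ¬u~w , (cᵤ , u~cᵤ) , (c𝓌 , w~c𝓌)) = cut (component G (∁ X) u)
    where
    twoVertices : ∀ (S : Fin n → Bool) → Closed G (lookup (∁ X)) S → (c : Cycle G (∁ X)) → S (Cycle.vertex c zero) ≡ true → 2 ≤ # S
    twoVertices S closed c S₀ = #≥2 S S₀
      (trans (sym (closed-joins G {S = S} closed ([]=⇒lookup (Cycle.edge∈F c zero)) (Cycle.edge-joins c zero))) S₀)
      λ eq → not-¬ refl (trans (joins-side (Cycle.edge-joins c zero)) (cong (not ∘ side) (sym eq)))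

    cut : ∃ (ComponentOf G (∁ X) u) → ⊥
    cut (S , Su , reach , closed) = irreducible (S , twoVertices S closed cᵤ (trans (sym (reachable-closed G {S = S} closed u~cᵤ)) Su) ,
        twoVertices (not ∘ S) (λ e t → cong not (closed e t)) c𝓌
          (cong not (trans (sym (reachable-closed G {S = S} closed w~c𝓌)) (¬-not (¬u~w ∘ reach w)))) ,
        ≤-trans (#-mono ∂⊑X) (≤-trans (≤-reflexive (sym (∣∣≡# X))) (≤-pred ∣X∣<4)))
      where
      ∂⊑X : boundary B S ⊑ lookup X
      ∂⊑X e ∂e = ¬-not λ Xe → true≢false ∂e (crossing (closed-joins G {S = S} closed (trans (lookup-∁ X e) (cong not Xe)) (joins e)))
        where
        crossing : S (p e) ≡ S (q e) → boundary B S e ≡ false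
        crossing eq rewrite eq = same (S (q e))
          where
          same : ∀ b → (b ∧ not b) ∨ (b ∧ not b) ≡ false
          same true = refl
          same false = refl

-- The main induction

module _ (extend : UniqueExtension) where

  -- Contractions are not structurally smaller, so the induction is on a bound `N` for the number of
  -- vertices.
  generate : ∀ N {n m} (G : FiniteGraph n m) → n ≤ N →
    Connected G → Bipartite G → Cubic G → TwoFactorHamiltonian G → ¬ (G ≅ theta) → Generated G
  -- Connectedness supplies a vertex, so the empty graph is excluded.
  generate zero {zero} G _ (() , _)
  generate (suc N) {n} {m} G n≤N conn bip cubic tfh ¬θ = parallelCase (simple⊎parallel B)
    where
    B : Bipartition G
    B = bipartition bip

    starCase : (B : Bipartition G) → ∀ S → Reducing B S → StarCut B S → Generated G
    starCase B S (2≤S , 2≤∁S , _) cut = isStar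
      (generate N D.C₁.G₁ (≤-pred (≤-trans (smaller S 2≤∁S) n≤N)) (D.C₁.connected conn) D.C₁.bipartite
        (D.C₁.cubic₁ cubic) (D.C₁.twoFactorHamiltonian₁ cubic tfh) (D.C₁.¬theta 2≤S))
      (generate N D.C₂.G₁ (≤-pred (≤-trans (smaller (not ∘ S) 2≤S′) n≤N)) (D.C₂.connected conn) D.C₂.bipartite
        (D.C₂.cubic₁ cubic) (D.C₂.twoFactorHamiltonian₁ cubic tfh) (D.C₂.¬theta 2≤∁S))
      zero D.C₁.claw zero D.C₂.claw D.decomposition
      where
      module D = Decomposition B S cut (#-pick S (≤-trans (s≤s z≤n) 2≤S))
                   (Prod.map₂ not-injective (#-pick (not ∘ S) (≤-trans (s≤s z≤n) 2≤∁S)))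
      2≤S′ : 2 ≤ # (not ∘ not ∘ S)
      2≤S′ = ≤-trans 2≤S (≤-reflexive (#-cong λ v → sym (not-involutive (S v))))
      -- Collapsing at least two vertices to one is a strict decrease; the contraction has
      -- `suc (# S)` vertices.
      smaller : ∀ S → 2 ≤ # (not ∘ S) → suc (suc (# S)) ≤ n
      smaller S 2≤ = ≤-trans (≤-reflexive (+-comm 2 (# S))) (≤-trans (+-monoʳ-≤ (# S) 2≤) (≤-reflexive (#-not S)))

    reducible : ∃ (Reducing B) → Generated G
    reducible (S , red) = [ starCase B S red , starCase (flip B) S (flipped red) ]′ (reducing⇒starCut B cubic tfh S red)
      where
      flipped : Reducing B S → Reducing (flip B) S
      flipped (x , y , z) = x , y , ≤-trans (≤-reflexive (#-cong λ e → ∨-comm (leaving (flip B) S e) (entering (flip B) S e))) z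

    irreducible : Simple B → ¬ ∃ (Reducing B) → ¬ FourCycle B → Generated G
    irreducible simple ¬red ¬four = recognise (G ≅? heawood)
      where
      recognise : Dec (G ≅ heawood) → Generated G
      recognise (yes iso) = isHeawood iso
      recognise (no ¬iso) =
        let M , pm , unique = extend G conn bip (cyclically4 B ¬red) cubic (twoFactorHamiltonian⇒PMH B cubic tfh)
                                (girth≥6 B simple ¬four) ¬iso
        in contradiction unique (notUniquelyExtendible B cubic tfh M pm)

    simpleCase : Simple B → Dec (∃ (Reducing B)) → Dec (FourCycle B) → Generated G
    simpleCase simple (yes red) _         = reducible red
    simpleCase simple (no ¬red) (yes C)   = [ reducible , isK₃,₃ ]′ (FourCycles.reducing⊎K₃,₃ B conn cubic tfh simple C)
    simpleCase simple (no ¬red) (no ¬four) = irreducible simple ¬red ¬four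

    parallelCase : Simple B ⊎ ∃₂ (Parallel B) → Generated G
    parallelCase (inj₁ simple)        = simpleCase simple (reducible? B) (fourCycle? B)
    parallelCase (inj₂ (e , f , par)) = contradiction (parallel⇒theta B cubic tfh par) ¬θ

mainTheorem3 : (∀ {n m} (G : FiniteGraph n m) →
    Connected G → Bipartite G → Cubic G → TwoFactorHamiltonian G →
    ¬ (G ≅ theta) →
    Generated G)
    ⇔
    (∀ {n m} (G : FiniteGraph n m) →
    Connected G → Bipartite G → CyclicallyEdgeConnected G 4 → Cubic G → PMH G →
    GirthAtLeast G 6 →
    ¬ (G ≅ heawood) →
    ∃ λ M → PerfectMatching G M × ExtendsUniquely G M)
mainTheorem3 = mk⇔ generation⇒uniqueExtension (λ extend G → generate extend _ G ≤-refl)
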